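{- Let $q$ be a prime power and let $n$ be an integer with $n\geq 5$, or $n=4$ and $q\in\{2,3\}$. Let $\alpha\in\mathbb{F}_{q^n}^*$ and let $a,b\in\mathbb{F}_q$. Then there exist $x,y\in\mathbb{F}_{q^n}$ with $\mathrm{Tr}(x)=a$, $\mathrm{Tr}(y)=b$ and $\alpha=x\cdot y$.
   Context: $\mathrm{Tr}$ denotes the field trace $\mathrm{Tr}_{\mathbb{F}_{q^n}/\mathbb{F}_q}(x)=x+x^q+\cdots+x^{q^{n-1}}$. -}

module Defs where

open import Level using (0ℓ)
open import Data.Nat using (ℕ; zero; suc; _^_)
open import Data.Nat.Primality using (Prime)
open import Data.Product using (Σ; ∃; _×_)
open import Data.Fin using (Fin)
open import Function.Bundles using (_↔_)
open import Relation.Binary.PropositionalEquality using (_≡_)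
open import Relation.Nullary using (¬_)
open import Algebra.Bundles using (CommutativeRing)

record Field : Set₁ where
  field
    commutativeRing : CommutativeRing 0ℓ 0ℓ
  open CommutativeRing commutativeRing public
  field
    ≈-is-≡   : ∀ {x y} → x ≈ y → x ≡ y
    0≢1      : ¬ (0# ≡ 1#)
    inverse  : ∀ x → ¬ (x ≡ 0#) → ∃ λ y → x * y ≡ 1#

module _ (K : Field) where
  open Field K

  pow : Carrier → ℕ → Carrier
  pow x zero    = 1#
  pow x (suc m) = x * pow x m

  trAux : ℕ → ℕ → Carrier → Carrier
  trAux q zero    x = 0#
  trAux q (suc k) x = trAux q k x + pow x (q ^ k)

  Tr : (q n : ℕ) → Carrier → Carrier
  Tr q n x = trAux q n x

HasSize : Set → ℕ → Set
HasSize A m = A ↔ Fin m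

IsPrimePower : ℕ → Set
IsPrimePower q = Σ ℕ λ p → Σ ℕ λ k → Prime p × q ≡ p ^ suc k

-- Unital ring homomorphism F → K (an embedding, as F is a field).
record IsRingHom (F K : Field) (ι : Field.Carrier F → Field.Carrier K) : Set where
  private
    module F = Field F
    module K = Field K
  field
    hom-1 : ι F.1# ≡ K.1#
    hom-+ : ∀ x y → ι (x F.+ y) ≡ ι x K.+ ι y
    hom-* : ∀ x y → ι (x F.* y) ≡ ι x K.* ι y

{-# OPTIONS --safe #-}
module Submission where

-- Let Q = q^n = |K| and let N(a , b) be the number of x ∈ K* with Tr x = a and Tr(α / x) = b. The
-- sum of the N(a , b)² counts pairs (x , y) with Tr(x - y) = 0 and Tr(α / x - α / y) = 0; in terms
-- of s = x - y and p = - x y this says that X² - s X + p splits over K for a pair (s , p) with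
-- Tr s = Tr(α s / p) = 0. The same pairs for which it does not split are counted by the number
-- N₂(0 , 0) belonging to the quadratic extension E of K, so Σ N² + N₂(0 , 0) is known, and a lower
-- bound for N₂(0 , 0) forces N to be nearly constant, in particular nowhere zero.
--
-- The lower bound for N₂(0 , 0) comes from Stepanov's polynomial method. With x = z^q - z and
-- t = Tr(α / x) one bounds the number of z ∈ E with t ≠ 0: there t^(q-1) = 1, so a nonzero
-- polynomial Σ c z^i (z^j)^Q T^l, where T is the first half of the trace t, can be made to vanish
-- at all of them, because its Q-th power becomes a polynomial of small degree in z.

open import Defs
open import Algebra.Bundles using (CommutativeMonoid; CommutativeRing; Semiring)
import Algebra.Solver.Ring as RingSolver
open import Algebra.Solver.Ring.AlmostCommutativeRing using (fromCommutativeRing; _-Raw-AlmostCommutative⟶_)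
open import Algebra.Structures using (IsCommutativeRing)
open import Data.Fin.Base as Fin using (Fin; zero; suc; toℕ)
open import Data.Fin.Permutation using (Permutation; permutation)
import Data.Fin.Properties as Fin
open import Data.Integer.Base as ℤ using (ℤ; -[1+_])
import Data.Integer.Properties as ℤ
open import Data.List.Base as List using (List; []; _∷_; length; map)
import Data.List.Properties as List
open import Data.List.Relation.Unary.All as All using (All; []; _∷_)
import Data.List.Relation.Unary.All.Properties as All
open import Data.Maybe.Base using (just; nothing)
open import Data.Nat.Base as ℕ using (ℕ; zero; suc; _≤_; z≤n; s≤s; _∸_; _^_; _!)
open import Data.Nat.Combinatorics using (nCn≡1; nCk≡n!/k![n-k]!; k![n∸k]!∣n!) renaming (_C_ to _choose_)
open import Data.Nat.Divisibility using (_∣_; _∤_; divides; m∣m*n; ∣⇒≤)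
import Data.Nat.DivMod as ℕ
open import Data.Nat.Primality using (Prime; euclidsLemma; prime⇒nonTrivial; prime⇒nonZero)
import Data.Nat.Properties as ℕ
open import Data.Nat.Tactic.RingSolver using (solve-∀)
open import Data.Product using (∃; ∃₂; _×_; _,_; proj₁; proj₂)
open import Data.Sum using (_⊎_; inj₁; inj₂; [_,_]′)
open import Function.Base using (_∘_; id; case_of_)
open import Function.Bundles using (Inverse; mk↔ₛ′)
open import Level using (0ℓ)
open import Relation.Binary.Definitions using (DecidableEquality; WeaklyDecidable; tri<; tri≈; tri>)
import Relation.Binary.PropositionalEquality as ≡
open import Relation.Binary.PropositionalEquality hiding (J)
open import Relation.Nullary using (¬_; Dec; yes; no; contradiction)
open import Relation.Nullary.Decidable using (map′; ¬?; _×-dec_; decidable-stable; from-no)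

-- Statements of this kind usually rest on Weil's bound for Kloosterman sums; here everything is
-- counting, and a bound in one direction is enough. Stepanov's method bounds the z with t ≠ 0 from
-- above, so it bounds N₂(0 , 0) from below, and the exact count turns that into an upper bound for
-- Σ N², the direction a variance argument needs. The method wants a field of square order Q², where
-- t = T + T^Q and z^(Q Q) = z; this is why it is run over E and not over K. Its error is of order
-- q² d with d = q^(n-1), against a main term d².
--
-- The variance is taken around q^(n-2) - c v(a) v(b), where v is q - 1 at the wanted index and -1
-- elsewhere. This function has the row and column sums of N up to 1 and dips at the wanted pair,
-- which is where a zero of N would be. The resulting polynomial inequality settles n ≥ 5 and,
-- barely, q = 2 with n = 4. For q = 3 and n = 4 it has the wrong sign, and a sharper bound for N₂(0
-- , 0) comes from running the same argument over E and its own quadratic extension.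

private
  variable
    A B : Set
    m n : ℕ

-- Field arithmetic with propositional equality

module FieldProperties (K : Field) where
  private module K = Field K
  open K using (≈-is-≡)

  -- Since `≈-is-≡` turns all ring laws into propositional ones, the ring is rebuilt over `_≡_`.
  -- Then `cong` serves for every congruence, also under functions that are not ring operations.
  ≡-commutativeRing : CommutativeRing 0ℓ 0ℓ
  ≡-commutativeRing = record
    { Carrier = K.Carrier
    ; _≈_ = _≡_
    ; _+_ = K._+_
    ; _*_ = K._*_
    ; -_ = K.-_
    ; 0# = K.0#
    ; 1# = K.1#
    ; isCommutativeRing = record
      { isRing = record
        { +-isAbelianGroup = record
          { isGroup = record
            { isMonoid = record
              { isSemigroup = record
                { isMagma = record { isEquivalence = isEquivalence ; ∙-cong = cong₂ K._+_ }
                ; assoc = λ x y z → ≈-is-≡ (K.+-assoc x y z) }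
              ; identity = (λ x → ≈-is-≡ (K.+-identityˡ x)) , (λ x → ≈-is-≡ (K.+-identityʳ x)) }
            ; inverse = (λ x → ≈-is-≡ (K.-‿inverseˡ x)) , (λ x → ≈-is-≡ (K.-‿inverseʳ x))
            ; ⁻¹-cong = cong (K.-_) }
          ; comm = λ x y → ≈-is-≡ (K.+-comm x y) }
        ; *-cong = cong₂ K._*_
        ; *-assoc = λ x y z → ≈-is-≡ (K.*-assoc x y z)
        ; *-identity = (λ x → ≈-is-≡ (K.*-identityˡ x)) , (λ x → ≈-is-≡ (K.*-identityʳ x))
        ; distrib = (λ x y z → ≈-is-≡ (K.distribˡ x y z)) , (λ x y z → ≈-is-≡ (K.distribʳ x y z)) }
      ; *-comm = λ x y → ≈-is-≡ (K.*-comm x y) } }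

  open CommutativeRing ≡-commutativeRing public
    using ( Carrier; _+_; _*_; -_; _-_; 0#; 1#; +-assoc; +-comm; +-identityˡ; +-identityʳ
          ; *-assoc; *-comm; *-identityˡ; *-identityʳ; distribˡ; distribʳ; zeroˡ; zeroʳ; -‿inverseˡ; -‿inverseʳ
          ; ring; semiring; commutativeSemiring; +-abelianGroup; +-commutativeMonoid; *-commutativeMonoid)
  open import Algebra.Properties.Ring ring public
    using (-‿distribˡ-*; -‿distribʳ-*; -0#≈0#)
    renaming (-‿involutive to neg-involutive)
  open import Algebra.Properties.AbelianGroup +-abelianGroup public using (⁻¹-∙-comm)
  open import Algebra.Properties.Semiring.Mult semiring public using (×-homo-+; ×1-homo-*) renaming (_×_ to _·_)

  private
    ⟦_⟧ℤ : ℤ → Carrier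
    ⟦ ℤ.+ n ⟧ℤ = n · 1#
    ⟦ -[1+ n ] ⟧ℤ = - (suc n · 1#)

    cancel : ∀ x y z → (x + y) + - (x + z) ≡ y + - z
    cancel x y z = begin
      (x + y) + - (x + z)  ≡⟨ cong (x + y +_) (sym (⁻¹-∙-comm x z)) ⟩
      (x + y) + (- x + - z)  ≡⟨ cong (_+ (- x + - z)) (+-comm x y) ⟩
      (y + x) + (- x + - z)  ≡⟨ +-assoc y x _ ⟩
      y + (x + (- x + - z))  ≡⟨ cong (y +_) (sym (+-assoc x (- x) (- z))) ⟩
      y + ((x + - x) + - z)  ≡⟨ cong (λ w → y + (w + - z)) (-‿inverseʳ x) ⟩
      y + (0# + - z)  ≡⟨ cong (y +_) (+-identityˡ _) ⟩
      y + - z  ∎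
      where open ≡-Reasoning

    ⊖-homo : ∀ m n → ⟦ m ℤ.⊖ n ⟧ℤ ≡ m · 1# + - (n · 1#)
    ⊖-homo zero zero = sym (-‿inverseʳ 0#)
    ⊖-homo zero (suc n) = sym (+-identityˡ _)
    ⊖-homo (suc m) zero = sym (trans (cong (suc m · 1# +_) -0#≈0#) (+-identityʳ _))
    ⊖-homo (suc m) (suc n) = begin
      ⟦ suc m ℤ.⊖ suc n ⟧ℤ  ≡⟨ cong ⟦_⟧ℤ (ℤ.[1+m]⊖[1+n]≡m⊖n m n) ⟩
      ⟦ m ℤ.⊖ n ⟧ℤ  ≡⟨ ⊖-homo m n ⟩
      m · 1# + - (n · 1#)  ≡⟨ sym (cancel 1# _ _) ⟩
      suc m · 1# + - (suc n · 1#)  ∎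
      where open ≡-Reasoning

    neg-homo : ∀ i → ⟦ ℤ.- i ⟧ℤ ≡ - ⟦ i ⟧ℤ
    neg-homo (ℤ.+ zero) = sym -0#≈0#
    neg-homo (ℤ.+ suc n) = refl
    neg-homo -[1+ n ] = sym (neg-involutive _)

    +-homo : ∀ i j → ⟦ i ℤ.+ j ⟧ℤ ≡ ⟦ i ⟧ℤ + ⟦ j ⟧ℤ
    +-homo (ℤ.+ m) (ℤ.+ n) = ×-homo-+ 1# m n
    +-homo (ℤ.+ m) -[1+ n ] = ⊖-homo m (suc n)
    +-homo -[1+ m ] (ℤ.+ n) = trans (⊖-homo n (suc m)) (+-comm _ _)
    +-homo -[1+ m ] -[1+ n ] = trans
      (cong (λ k → - (suc k · 1#)) (sym (ℕ.+-suc m n)))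
      (trans (cong (-_) (×-homo-+ 1# (suc m) (suc n))) (sym (⁻¹-∙-comm _ _)))

    *-homo⁺ : ∀ m j → ⟦ ℤ.+ m ℤ.* j ⟧ℤ ≡ ⟦ ℤ.+ m ⟧ℤ * ⟦ j ⟧ℤ
    *-homo⁺ m (ℤ.+ n) = trans (cong ⟦_⟧ℤ (sym (ℤ.pos-* m n))) (×1-homo-* m n)
    *-homo⁺ m -[1+ n ] = begin
      ⟦ ℤ.+ m ℤ.* -[1+ n ] ⟧ℤ  ≡⟨ cong ⟦_⟧ℤ (sym (ℤ.neg-distribʳ-* (ℤ.+ m) (ℤ.+ suc n))) ⟩
      ⟦ ℤ.- (ℤ.+ m ℤ.* ℤ.+ suc n) ⟧ℤ  ≡⟨ neg-homo (ℤ.+ m ℤ.* ℤ.+ suc n) ⟩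
      - ⟦ ℤ.+ m ℤ.* ℤ.+ suc n ⟧ℤ  ≡⟨ cong (-_) (*-homo⁺ m (ℤ.+ suc n)) ⟩
      - (m · 1# * (suc n · 1#))  ≡⟨ -‿distribʳ-* _ _ ⟩
      m · 1# * - (suc n · 1#)  ∎
      where open ≡-Reasoning

    *-homo : ∀ i j → ⟦ i ℤ.* j ⟧ℤ ≡ ⟦ i ⟧ℤ * ⟦ j ⟧ℤ
    *-homo (ℤ.+ m) j = *-homo⁺ m j
    *-homo -[1+ m ] j = begin
      ⟦ -[1+ m ] ℤ.* j ⟧ℤ  ≡⟨ cong ⟦_⟧ℤ (sym (ℤ.neg-distribˡ-* (ℤ.+ suc m) j)) ⟩
      ⟦ ℤ.- (ℤ.+ suc m ℤ.* j) ⟧ℤ  ≡⟨ neg-homo (ℤ.+ suc m ℤ.* j) ⟩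
      - ⟦ ℤ.+ suc m ℤ.* j ⟧ℤ  ≡⟨ cong (-_) (*-homo⁺ (suc m) j) ⟩
      - (suc m · 1# * ⟦ j ⟧ℤ)  ≡⟨ -‿distribˡ-* _ _ ⟩
      - (suc m · 1#) * ⟦ j ⟧ℤ  ∎
      where open ≡-Reasoning

    -- Integer coefficients let the solver cancel numerals although equality in `Carrier` need not
    -- be decidable here. The numeral 1 is interpreted as `1# + 0#`, so the element `1#` enters many
    -- solver calls as a variable of its own.
    morphism : ℤ.+-*-rawRing -Raw-AlmostCommutative⟶ fromCommutativeRing ≡-commutativeRing
    morphism = record
      { ⟦_⟧ = ⟦_⟧ℤ
      ; +-homo = +-homo
      ; *-homo = *-homo
      ; -‿homo = neg-homo
      ; 0-homo = refl
      ; 1-homo = +-identityʳ 1# }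

    coeff≟ : WeaklyDecidable λ i j → ⟦ i ⟧ℤ ≡ ⟦ j ⟧ℤ
    coeff≟ i j with i ℤ.≟ j
    ... | yes i≡j = just (cong ⟦_⟧ℤ i≡j)
    ... | no _ = nothing

  open RingSolver ℤ.+-*-rawRing (fromCommutativeRing ≡-commutativeRing) morphism coeff≟ public
    using (solve; _:=_; _:+_; _:*_; _:-_; :-_; con)

  infixr 8 _↑_
  _↑_ : Carrier → ℕ → Carrier
  _↑_ = pow K

  ↑-+ : ∀ x m n → x ↑ (m ℕ.+ n) ≡ x ↑ m * x ↑ n
  ↑-+ x zero n = sym (*-identityˡ _)
  ↑-+ x (suc m) n = trans (cong (x *_) (↑-+ x m n)) (sym (*-assoc x _ _))

  ↑-distrib-* : ∀ x y m → (x * y) ↑ m ≡ x ↑ m * y ↑ m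
  ↑-distrib-* x y zero = sym (*-identityˡ _)
  ↑-distrib-* x y (suc m) = trans (cong (x * y *_) (↑-distrib-* x y m))
    (solve 4 (λ x y u v → (x :* y) :* (u :* v) := (x :* u) :* (y :* v)) refl x y _ _)

  1↑ : ∀ m → 1# ↑ m ≡ 1#
  1↑ zero = refl
  1↑ (suc m) = trans (*-identityˡ _) (1↑ m)

  0↑ : ∀ {m} → 0 ℕ.< m → 0# ↑ m ≡ 0#
  0↑ (s≤s _) = zeroˡ _

  ↑1 : ∀ x → x ↑ 1 ≡ x
  ↑1 = *-identityʳ

  ↑-* : ∀ x m n → x ↑ (m ℕ.* n) ≡ (x ↑ m) ↑ n
  ↑-* x zero n = sym (1↑ n)
  ↑-* x (suc m) n = begin
    x ↑ (n ℕ.+ m ℕ.* n)  ≡⟨ ↑-+ x n (m ℕ.* n) ⟩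
    x ↑ n * x ↑ (m ℕ.* n)  ≡⟨ cong (x ↑ n *_) (↑-* x m n) ⟩
    x ↑ n * (x ↑ m) ↑ n  ≡⟨ sym (↑-distrib-* x (x ↑ m) n) ⟩
    (x * x ↑ m) ↑ n  ∎
    where open ≡-Reasoning

  ↑-comm : ∀ x m n → (x ↑ m) ↑ n ≡ (x ↑ n) ↑ m
  ↑-comm x m n = trans (sym (↑-* x m n)) (trans (cong (x ↑_) (ℕ.*-comm m n)) (↑-* x n m))

  1≢0 : 1# ≢ 0#
  1≢0 1≡0 = K.0≢1 (sym 1≡0)

  *-cancel-≢0 : ∀ {x y} → x ≢ 0# → x * y ≡ 0# → y ≡ 0#
  *-cancel-≢0 {x} {y} x≢0 xy≡0 with K.inverse x x≢0
  ... | x′ , xx′≡1 = begin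
    y  ≡⟨ sym (*-identityˡ y) ⟩
    1# * y  ≡⟨ cong (_* y) (sym xx′≡1) ⟩
    x * x′ * y  ≡⟨ solve 3 (λ x x′ y → x :* x′ :* y := x′ :* (x :* y)) refl x x′ y ⟩
    x′ * (x * y)  ≡⟨ cong (x′ *_) xy≡0 ⟩
    x′ * 0#  ≡⟨ zeroʳ x′ ⟩
    0#  ∎
    where open ≡-Reasoning

  *-≢0 : ∀ {x y} → x ≢ 0# → y ≢ 0# → x * y ≢ 0#
  *-≢0 x≢0 y≢0 xy≡0 = y≢0 (*-cancel-≢0 x≢0 xy≡0)

  ↑-≢0 : ∀ {x} m → x ≢ 0# → x ↑ m ≢ 0#
  ↑-≢0 zero x≢0 = 1≢0
  ↑-≢0 (suc m) x≢0 = *-≢0 x≢0 (↑-≢0 m x≢0)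

  x-y≡0⇒x≡y : ∀ {x y} → x - y ≡ 0# → x ≡ y
  x-y≡0⇒x≡y {x} {y} x-y≡0 = begin
    x  ≡⟨ solve 2 (λ x y → x := (x :- y) :+ y) refl x y ⟩
    x - y + y  ≡⟨ cong (_+ y) x-y≡0 ⟩
    0# + y  ≡⟨ +-identityˡ y ⟩
    y  ∎
    where open ≡-Reasoning

  x≡y⇒x-y≡0 : ∀ {x y} → x ≡ y → x - y ≡ 0#
  x≡y⇒x-y≡0 {x} refl = -‿inverseʳ x

  *-cancelˡ : ∀ {x y z} → x ≢ 0# → x * y ≡ x * z → y ≡ z
  *-cancelˡ {x} {y} {z} x≢0 xy≡xz = x-y≡0⇒x≡y (*-cancel-≢0 x≢0
    (trans (solve 3 (λ x y z → x :* (y :- z) := x :* y :- x :* z) refl x y z) (x≡y⇒x-y≡0 xy≡xz)))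

-- Finite sums and counting by indicator functions

𝟙 : ∀ {P : Set} → Dec P → ℕ
𝟙 (yes _) = 1
𝟙 (no _) = 0

𝟙-mono : ∀ {P Q : Set} (p : Dec P) (q : Dec Q) → (P → Q) → 𝟙 p ℕ.≤ 𝟙 q
𝟙-mono (yes p) (yes q) f = ℕ.≤-refl
𝟙-mono (yes p) (no ¬q) f = contradiction (f p) ¬q
𝟙-mono (no _) _ f = z≤n

𝟙-cong : ∀ {P Q : Set} (p : Dec P) (q : Dec Q) → (P → Q) → (Q → P) → 𝟙 p ≡ 𝟙 q
𝟙-cong p q f g = ℕ.≤-antisym (𝟙-mono p q f) (𝟙-mono q p g)

𝟙-yes : ∀ {P : Set} (p : Dec P) → P → 𝟙 p ≡ 1
𝟙-yes (yes _) _ = refl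
𝟙-yes (no ¬p) p = contradiction p ¬p

𝟙-no : ∀ {P : Set} (p : Dec P) → ¬ P → 𝟙 p ≡ 0
𝟙-no (yes p) ¬p = contradiction p ¬p
𝟙-no (no _) _ = refl

𝟙≤1 : ∀ {P : Set} (p : Dec P) → 𝟙 p ℕ.≤ 1
𝟙≤1 (yes _) = ℕ.≤-refl
𝟙≤1 (no _) = z≤n

module Sums (R : Semiring 0ℓ 0ℓ) where
  open Semiring R using (Carrier; _≈_; _+_; _*_; 0#; *-identityˡ; zeroˡ; reflexive)
  open import Algebra.Properties.Semiring.Sum R public

  ∑ : HasSize A m → (A → Carrier) → Carrier
  ∑ e f = sum (f ∘ Inverse.from e)

  ∑-cong : (e : HasSize A m) {f g : A → Carrier} → (∀ x → f x ≈ g x) → ∑ e f ≈ ∑ e g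
  ∑-cong e f≈g = sum-cong-≋ (λ i → f≈g (Inverse.from e i))

  ∑-+ : (e : HasSize A m) (f g : A → Carrier) → ∑ e (λ x → f x + g x) ≈ ∑ e f + ∑ e g
  ∑-+ e f g = ∑-distrib-+ (f ∘ Inverse.from e) (g ∘ Inverse.from e)

  ∑-*ˡ : (e : HasSize A m) (c : Carrier) (f : A → Carrier) → c * ∑ e f ≈ ∑ e (λ x → c * f x)
  ∑-*ˡ e c f = *-distribˡ-sum c (f ∘ Inverse.from e)

  ∑-*ʳ : (e : HasSize A m) (c : Carrier) (f : A → Carrier) → ∑ e f * c ≈ ∑ e (λ x → f x * c)
  ∑-*ʳ e c f = *-distribʳ-sum c (f ∘ Inverse.from e)

  ∑-swap : (e : HasSize A m) (e′ : HasSize B n) (f : A → B → Carrier) →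
           ∑ e (λ x → ∑ e′ (f x)) ≈ ∑ e′ (λ y → ∑ e (λ x → f x y))
  ∑-swap e e′ f = ∑-comm (λ i j → f (Inverse.from e i) (Inverse.from e′ j))

module Reindexing (M : CommutativeMonoid 0ℓ 0ℓ) where
  open CommutativeMonoid M using (Carrier; _≈_; reflexive) renaming (trans to ≈-trans)
  open import Algebra.Properties.CommutativeMonoid.Sum M

  -- A bijection of A becomes a permutation of `Fin m` after conjugation with the enumeration. The
  -- general monoid serves three purposes: counting in ℕ, the product in `fermat` and the sum in
  -- `size·1≡0`.
  sum-reindex : (e : HasSize A m) (σ τ : A → A) → (∀ x → σ (τ x) ≡ x) → (∀ x → τ (σ x) ≡ x) →
                (f : A → Carrier) → sum (f ∘ Inverse.from e) ≈ sum (f ∘ σ ∘ Inverse.from e)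
  sum-reindex {A} {m} e σ τ στ τσ f = ≈-trans (sum-permute (f ∘ from) π)
    (sum-cong-≋ λ i → reflexive (cong f (Inverse.strictlyInverseʳ e (σ (from i)))))
    where
    open Inverse e using (to; from)
    conj : (ρ : A → A) → Fin m → Fin m
    conj ρ = to ∘ ρ ∘ from
    conj-inverse : ∀ ρ ρ′ → (∀ x → ρ (ρ′ x) ≡ x) → ∀ i → conj ρ (conj ρ′ i) ≡ i
    conj-inverse ρ ρ′ eq i = trans (cong (to ∘ ρ) (Inverse.strictlyInverseʳ e _))
      (trans (cong to (eq (from i))) (Inverse.strictlyInverseˡ e i))
    π : Permutation m m
    π = permutation (conj σ) (conj τ) (conj-inverse σ τ στ) (conj-inverse τ σ τσ)

module ∑ℕ = Sums ℕ.+-*-semiring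

open ∑ℕ using (∑; ∑-cong; ∑-+; ∑-*ˡ; ∑-*ʳ; ∑-swap; sum)

sum-mono : {f g : Fin n → ℕ} → (∀ i → f i ℕ.≤ g i) → sum f ℕ.≤ sum g
sum-mono {zero} f≤g = z≤n
sum-mono {suc n} f≤g = ℕ.+-mono-≤ (f≤g zero) (sum-mono (f≤g ∘ suc))

∑-mono : (e : HasSize A m) {f g : A → ℕ} → (∀ x → f x ℕ.≤ g x) → ∑ e f ℕ.≤ ∑ e g
∑-mono e f≤g = sum-mono (λ i → f≤g (Inverse.from e i))

sum-const : ∀ n c → sum {n} (λ _ → c) ≡ n ℕ.* c
sum-const zero c = refl
sum-const (suc n) c = cong (c ℕ.+_) (sum-const n c)

∑-const : (e : HasSize A m) (c : ℕ) → ∑ e (λ _ → c) ≡ m ℕ.* c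
∑-const {m = m} e c = sum-const m c

sum-δ : (k : Fin n) (g : Fin n → ℕ) → sum (λ i → 𝟙 (i Fin.≟ k) ℕ.* g i) ≡ g k
sum-δ {suc n} zero g = trans (cong (g zero ℕ.+ 0 ℕ.+_)
  (trans (∑ℕ.sum-cong-≋ λ i → cong (ℕ._* g (suc i)) (𝟙-no (suc i Fin.≟ zero) λ ()))
         (trans (sum-const n 0) (ℕ.*-zeroʳ n))))
  (trans (ℕ.+-identityʳ _) (ℕ.+-identityʳ _))
sum-δ {suc n} (suc k) g = trans
  (∑ℕ.sum-cong-≋ λ i → cong (ℕ._* g (suc i)) (𝟙-cong (suc i Fin.≟ suc k) (i Fin.≟ k) Fin.suc-injective (cong suc)))
  (sum-δ k (g ∘ suc))

decEq : HasSize A m → DecidableEquality A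
decEq e x y = map′ injective (cong (Inverse.to e)) (Inverse.to e x Fin.≟ Inverse.to e y)
  where
  injective : Inverse.to e x ≡ Inverse.to e y → x ≡ y
  injective eq = trans (sym (Inverse.strictlyInverseʳ e x))
    (trans (cong (Inverse.from e) eq) (Inverse.strictlyInverseʳ e y))

∑-δ : (e : HasSize A m) (a : A) (d : ∀ x → Dec (x ≡ a)) (g : A → ℕ) → ∑ e (λ x → 𝟙 (d x) ℕ.* g x) ≡ g a
∑-δ e a d g = begin
  sum (λ i → 𝟙 (d (from i)) ℕ.* g (from i))  ≡⟨ ∑ℕ.sum-cong-≋
    (λ i → cong (ℕ._* g (from i)) (𝟙-cong (d (from i)) (i Fin.≟ to a) (fwd i) (bwd i))) ⟩
  sum (λ i → 𝟙 (i Fin.≟ to a) ℕ.* g (from i))  ≡⟨ sum-δ (to a) (g ∘ from) ⟩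
  g (from (to a))  ≡⟨ cong g (Inverse.strictlyInverseʳ e a) ⟩
  g a  ∎
  where
  open ≡-Reasoning
  open Inverse e using (to; from)
  fwd : ∀ i → from i ≡ a → i ≡ to a
  fwd i eq = trans (sym (Inverse.strictlyInverseˡ e i)) (cong to eq)
  bwd : ∀ i → i ≡ to a → from i ≡ a
  bwd i eq = trans (cong from eq) (Inverse.strictlyInverseʳ e a)

∑-reindex : (e : HasSize A m) (σ τ : A → A) → (∀ x → σ (τ x) ≡ x) → (∀ x → τ (σ x) ≡ x) →
            (f : A → ℕ) → ∑ e f ≡ ∑ e (f ∘ σ)
∑-reindex = Reindexing.sum-reindex ℕ.+-0-commutativeMonoid

any? : (e : HasSize A m) {P : A → Set} → (∀ x → Dec (P x)) → Dec (∃ P)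
any? e {P} P? = map′ (λ (i , p) → Inverse.from e i , p)
  (λ (x , p) → Inverse.to e x , subst P (sym (Inverse.strictlyInverseʳ e x)) p)
  (Fin.any? (P? ∘ Inverse.from e))

#-positive : (e : HasSize A m) {P : A → Set} (P? : ∀ x → Dec (P x)) → 0 ℕ.< ∑ e (𝟙 ∘ P?) → ∃ P
#-positive {m = m} e P? 0<# with any? e P?
... | yes ∃P = ∃P
... | no ∄P = contradiction 0<# (ℕ.≤⇒≯ (ℕ.≤-reflexive
  (trans (∑-cong e λ x → 𝟙-no (P? x) (λ p → ∄P (x , p))) (trans (∑-const e 0) (ℕ.*-zeroʳ m)))))

∑-term : (e : HasSize A m) (f : A → ℕ) (a : A) → f a ℕ.≤ ∑ e f
∑-term e f a = ℕ.≤-trans (ℕ.≤-reflexive (sym (∑-δ e a (λ x → decEq e x a) f)))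
  (∑-mono e λ x → ℕ.≤-trans (ℕ.*-monoˡ-≤ (f x) (𝟙≤1 (decEq e x a))) (ℕ.≤-reflexive (ℕ.*-identityˡ (f x))))

-- The deficits `c ∸ f x` are nonnegative and add up to at most 0, so each of them vanishes. This
-- turns upper bounds on fibres into exact sizes.
∑-tight : (e : HasSize A m) {f : A → ℕ} {c : ℕ} → (∀ x → f x ℕ.≤ c) → m ℕ.* c ℕ.≤ ∑ e f → ∀ x → f x ≡ c
∑-tight {m = m} e {f} {c} f≤c mc≤∑f x = ℕ.≤-antisym (f≤c x) (ℕ.m∸n≡0⇒m≤n (ℕ.n≤0⇒n≡0
  (ℕ.≤-trans (∑-term e (λ x → c ∸ f x) x) (ℕ.≤-reflexive (ℕ.m+n≡0⇒n≡0 0 (ℕ.+-cancelˡ-≡ (∑ e f) _ _ deficit))))))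
  where
  ∑f+∑deficit : ∑ e f ℕ.+ ∑ e (λ x → c ∸ f x) ≡ m ℕ.* c
  ∑f+∑deficit = trans (sym (∑-+ e f (λ x → c ∸ f x))) (trans (∑-cong e λ x → ℕ.m+[n∸m]≡n (f≤c x)) (∑-const e c))
  deficit : ∑ e f ℕ.+ ∑ e (λ x → c ∸ f x) ≡ ∑ e f ℕ.+ 0
  deficit = ℕ.≤-antisym (ℕ.≤-trans (ℕ.≤-reflexive ∑f+∑deficit) (ℕ.≤-trans mc≤∑f (ℕ.≤-reflexive (sym (ℕ.+-identityʳ _)))))
    (ℕ.+-monoʳ-≤ (∑ e f) z≤n)

∑-unique : (e : HasSize A m) {P : A → Set} (P? : ∀ x → Dec (P x)) (a : A) →
           P a → (∀ {x} → P x → x ≡ a) → ∑ e (𝟙 ∘ P?) ≡ 1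
∑-unique e P? a Pa unique = trans
  (∑-cong e λ x → trans (𝟙-cong (P? x) (decEq e x a) unique λ { refl → Pa }) (sym (ℕ.*-identityʳ _)))
  (∑-δ e a (λ x → decEq e x a) (λ _ → 1))

∑-empty : (e : HasSize A m) {P : A → Set} (P? : ∀ x → Dec (P x)) → (∀ x → ¬ P x) → ∑ e (𝟙 ∘ P?) ≡ 0
∑-empty {m = m} e P? ¬P = trans (∑-cong e λ x → 𝟙-no (P? x) (¬P x)) (trans (∑-const e 0) (ℕ.*-zeroʳ m))

∑-atMostOne : (e : HasSize A m) {P : A → Set} (P? : ∀ x → Dec (P x)) →
              (∀ {x y} → P x → P y → x ≡ y) → ∑ e (𝟙 ∘ P?) ℕ.≤ 1
∑-atMostOne e P? unique with any? e P?
... | yes (a , Pa) = ℕ.≤-reflexive (∑-unique e P? a Pa λ Px → unique Px Pa)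
... | no ∄P = ℕ.≤-trans (ℕ.≤-reflexive (∑-empty e P? λ x Px → ∄P (x , Px))) z≤n

𝟙-¬ : ∀ {P : Set} (p : Dec P) → 𝟙 (¬? p) ℕ.+ 𝟙 p ≡ 1
𝟙-¬ (yes _) = refl
𝟙-¬ (no _) = refl

-- Finite fields

module FiniteField (K : Field) {size : ℕ} (K↔ : HasSize (Field.Carrier K) size) where
  open FieldProperties K public

  infix 4 _≟_
  infix 9 _⁻¹

  abstract
    _≟_ : DecidableEquality Carrier
    _≟_ = decEq K↔

    -- With the value 0 at 0, the map x ↦ β / x is an involution of the whole field for β ≠ 0, and
    -- sums over the field can be reindexed along it.
    _⁻¹ : Carrier → Carrier
    x ⁻¹ with x ≟ 0#
    ... | yes _ = 0#
    ... | no x≢0 = proj₁ (Field.inverse K x x≢0)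

    0⁻¹ : 0# ⁻¹ ≡ 0#
    0⁻¹ with 0# ≟ 0#
    ... | yes _ = refl
    ... | no 0≢0 = contradiction refl 0≢0

    *-inverseʳ : ∀ {x} → x ≢ 0# → x * x ⁻¹ ≡ 1#
    *-inverseʳ {x} x≢0 with x ≟ 0#
    ... | yes x≡0 = contradiction x≡0 x≢0
    ... | no x≢0′ = proj₂ (Field.inverse K x x≢0′)

  *-≡1⇒⁻¹ : ∀ {x y} → x * y ≡ 1# → y ≡ x ⁻¹
  *-≡1⇒⁻¹ {x} {y} xy≡1 = *-cancelˡ x≢0 (trans xy≡1 (sym (*-inverseʳ x≢0)))
    where
    x≢0 : x ≢ 0#
    x≢0 refl = 1≢0 (trans (sym xy≡1) (zeroˡ y))

  ⁻¹-≢0 : ∀ {x} → x ≢ 0# → x ⁻¹ ≢ 0#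
  ⁻¹-≢0 {x} x≢0 x⁻¹≡0 = 1≢0 (trans (sym (*-inverseʳ x≢0)) (trans (cong (x *_) x⁻¹≡0) (zeroʳ x)))

  divide-involutive : ∀ {β} → β ≢ 0# → ∀ x → β * (β * x ⁻¹) ⁻¹ ≡ x
  divide-involutive {β} β≢0 x with x ≟ 0#
  ... | yes refl = begin
    β * (β * 0# ⁻¹) ⁻¹  ≡⟨ cong (λ y → β * (β * y) ⁻¹) 0⁻¹ ⟩
    β * (β * 0#) ⁻¹  ≡⟨ cong (λ y → β * y ⁻¹) (zeroʳ β) ⟩
    β * 0# ⁻¹  ≡⟨ cong (β *_) 0⁻¹ ⟩
    β * 0#  ≡⟨ zeroʳ β ⟩
    0#  ∎
    where open ≡-Reasoning
  ... | no x≢0 = begin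
    β * (β * x ⁻¹) ⁻¹  ≡⟨ cong (β *_) (sym (*-≡1⇒⁻¹ inverse)) ⟩
    β * (β ⁻¹ * x)  ≡⟨ sym (*-assoc β (β ⁻¹) x) ⟩
    β * β ⁻¹ * x  ≡⟨ cong (_* x) (*-inverseʳ β≢0) ⟩
    1# * x  ≡⟨ *-identityˡ x ⟩
    x  ∎
    where
    open ≡-Reasoning
    inverse : (β * x ⁻¹) * (β ⁻¹ * x) ≡ 1#
    inverse = trans (solve 4 (λ β x′ β⁻ x → (β :* x′) :* (β⁻ :* x) := (β :* β⁻) :* (x :* x′)) refl β (x ⁻¹) (β ⁻¹) x)
      (trans (cong₂ _*_ (*-inverseʳ β≢0) (*-inverseʳ x≢0)) (*-identityʳ 1#))

  count : (Carrier → Carrier) → ℕ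
  count f = ∑ K↔ (λ z → 𝟙 (f z ≟ 0#))

  private
    module Π = Reindexing *-commutativeMonoid
    module ΠSum where
      open import Algebra.Properties.CommutativeMonoid.Sum *-commutativeMonoid public
    module +R = Reindexing +-commutativeMonoid
  module ∑ᴷ = Sums semiring

  ∏ : ∀ {m} → (Fin m → Carrier) → Carrier
  ∏ = ΠSum.sum

  ∏-≢0 : ∀ {m} (f : Fin m → Carrier) → (∀ i → f i ≢ 0#) → ∏ f ≢ 0#
  ∏-≢0 {zero} f f≢0 = 1≢0
  ∏-≢0 {suc m} f f≢0 = *-≢0 (f≢0 zero) (∏-≢0 (f ∘ suc) (f≢0 ∘ suc))

  ∏-const : ∀ m x → ∏ {m} (λ _ → x) ≡ x ↑ m
  ∏-const zero x = refl
  ∏-const (suc m) x = cong (x *_) (∏-const m x)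

  -- With w y = y for y ≠ 0 and w 0 = 1, reindexing ∏ w along multiplication by x shows x ∏ w = x ^ |K| ∏ w.
  fermat : ∀ x → x ↑ size ≡ x
  fermat x with x ≟ 0#
  ... | yes refl = 0↑ (positive (Inverse.to K↔ 0#))
    where
    positive : ∀ {m} → Fin m → 0 ℕ.< m
    positive zero = s≤s z≤n
    positive (suc _) = s≤s z≤n
  ... | no x≢0 = sym (*-cancelˡ (∏-≢0 (w ∘ from) (w≢0 ∘ from)) (begin
    ∏ (w ∘ from) * x  ≡⟨ cong₂ _*_ (Π.sum-reindex K↔ (x *_) (x ⁻¹ *_) (unscale x (x ⁻¹) (*-inverseʳ x≢0))
      (unscale (x ⁻¹) x (trans (*-comm _ _) (*-inverseʳ x≢0))) w) (sym ∏v) ⟩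
    ∏ (w ∘ (x *_) ∘ from) * ∏ (v ∘ from)  ≡⟨ sym (ΠSum.∑-distrib-+ (w ∘ (x *_) ∘ from) (v ∘ from)) ⟩
    ∏ (λ i → w (x * from i) * v (from i))  ≡⟨ ΠSum.sum-cong-≋ (λ i → wv (from i)) ⟩
    ∏ (λ i → w (from i) * x)  ≡⟨ ΠSum.∑-distrib-+ (w ∘ from) (λ _ → x) ⟩
    ∏ (w ∘ from) * ∏ {size} (λ _ → x)  ≡⟨ cong (∏ (w ∘ from) *_) (∏-const size x) ⟩
    ∏ (w ∘ from) * x ↑ size  ∎))
    where
    open ≡-Reasoning
    open Inverse K↔ using (from; to)
    unscale : ∀ x y → x * y ≡ 1# → ∀ z → x * (y * z) ≡ z
    unscale x y xy≡1 z = trans (sym (*-assoc x y z)) (trans (cong (_* z) xy≡1) (*-identityˡ z))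
    w v : Carrier → Carrier
    w y with y ≟ 0#
    ... | yes _ = 1#
    ... | no _ = y
    v y with y ≟ 0#
    ... | yes _ = x
    ... | no _ = 1#
    w≢0 : ∀ y → w y ≢ 0#
    w≢0 y with y ≟ 0#
    ... | yes _ = 1≢0
    ... | no y≢0 = y≢0
    wv : ∀ y → w (x * y) * v y ≡ w y * x
    wv y with y ≟ 0#
    wv y | yes y≡0 with x * y ≟ 0#
    ... | yes _ = refl
    ... | no xy≢0 = contradiction (trans (cong (x *_) y≡0) (zeroʳ x)) xy≢0
    wv y | no y≢0 with x * y ≟ 0#
    ... | yes xy≡0 = contradiction xy≡0 (*-≢0 x≢0 y≢0)
    ... | no _ = trans (*-identityʳ _) (*-comm x y)
    ∏v : ∏ (v ∘ from) ≡ x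
    ∏v = ∏-v {size} from (to 0#) (λ i eq → trans (sym (Inverse.strictlyInverseˡ K↔ i)) (cong to eq))
      (Inverse.strictlyInverseʳ K↔ 0#)
      where
      ∏-1 : ∀ {m} (g : Fin m → Carrier) → (∀ i → g i ≢ 0#) → ∏ (v ∘ g) ≡ 1#
      ∏-1 {zero} g g≢0 = refl
      ∏-1 {suc m} g g≢0 with g zero ≟ 0#
      ... | yes g0≡0 = contradiction g0≡0 (g≢0 zero)
      ... | no _ = trans (*-identityˡ _) (∏-1 (g ∘ suc) (g≢0 ∘ suc))
      ∏-v : ∀ {m} (g : Fin m → Carrier) (k : Fin m) → (∀ i → g i ≡ 0# → i ≡ k) → g k ≡ 0# → ∏ (v ∘ g) ≡ x
      ∏-v g zero unique gk≡0 with g zero ≟ 0#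
      ... | yes _ = trans (cong (x *_) (∏-1 (g ∘ suc) (λ i gi≡0 → case unique (suc i) gi≡0 of λ ()))) (*-identityʳ x)
      ... | no g0≢0 = contradiction gk≡0 g0≢0
      ∏-v g (suc k) unique gk≡0 with g zero ≟ 0#
      ... | yes g0≡0 = case unique zero g0≡0 of λ ()
      ... | no _ = trans (*-identityˡ _) (∏-v (g ∘ suc) k (λ i eq → Fin.suc-injective (unique (suc i) eq)) gk≡0)

  -- Translation by 1 permutes the field, so the sum s of all elements equals s + |K| · 1.
  size·1≡0 : size · 1# ≡ 0#
  size·1≡0 = begin
    size · 1#  ≡⟨ solve 2 (λ s y → y := (s :+ y) :- s) refl s (size · 1#) ⟩
    (s + size · 1#) - s  ≡⟨ cong (λ y → (s + y) - s) (sym (∑ᴷ.sum-replicate size)) ⟩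
    (s + ∑ᴷ.sum {size} (λ _ → 1#)) - s  ≡⟨ cong (_- s) (sym (∑ᴷ.∑-distrib-+ from (λ _ → 1#))) ⟩
    ∑ᴷ.sum (λ i → from i + 1#) - s  ≡⟨ cong (_- s) (sym (+R.sum-reindex K↔ (_+ 1#) (_- 1#)
      (λ x → solve 2 (λ x y → (x :- y) :+ y := x) refl x 1#) (λ x → solve 2 (λ x y → (x :+ y) :- y := x) refl x 1#) id)) ⟩
    s - s  ≡⟨ -‿inverseʳ s ⟩
    0#  ∎
    where
    open ≡-Reasoning
    open Inverse K↔ using (from)
    s = ∑ᴷ.sum from

-- Additivity of p-power maps

p∤k! : ∀ {p} → Prime p → ∀ k → k ℕ.< p → p ∤ k !
p∤k! pr zero _ p∣1 with ℕ.≤-antisym (∣⇒≤ p∣1) (ℕ.>-nonZero⁻¹ _ ⦃ prime⇒nonZero pr ⦄)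
... | refl = contradiction refl (ℕ.nonTrivial⇒≢1 ⦃ prime⇒nonTrivial pr ⦄)
p∤k! pr (suc k) k<p p∣k! with euclidsLemma (suc k) (k !) pr p∣k!
... | inj₁ p∣1+k = contradiction (∣⇒≤ p∣1+k) (ℕ.<⇒≱ k<p)
... | inj₂ p∣k!′ = p∤k! pr k (ℕ.<⇒≤ k<p) p∣k!′

-- The prime p divides p! = C(p , k) k! (p - k)! but neither of the two factorials.
p∣pCk : ∀ {p} → Prime p → ∀ k → 0 ℕ.< k → k ℕ.< p → p ∣ p choose k
p∣pCk {p} pr k 0<k k<p with euclidsLemma (p choose k) (k ! ℕ.* (p ∸ k) !) pr p∣product
  where
  instance
    _ = (k ℕ.!* (p ∸ k) !≢0)
  p∣p! : ∀ {p} → Prime p → p ∣ p !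
  p∣p! {zero} pr = contradiction (ℕ.>-nonZero⁻¹ _ ⦃ prime⇒nonZero pr ⦄) λ ()
  p∣p! {suc p} pr = m∣m*n (p !)
  p∣product : p ∣ (p choose k) ℕ.* (k ! ℕ.* (p ∸ k) !)
  p∣product = subst (p ∣_) (sym (trans (cong (ℕ._* (k ! ℕ.* (p ∸ k) !)) (nCk≡n!/k![n-k]! (ℕ.<⇒≤ k<p)))
    (ℕ.m/n*n≡m (k![n∸k]!∣n! (ℕ.<⇒≤ k<p))))) (p∣p! pr)
... | inj₁ p∣C = p∣C
... | inj₂ p∣k!l! with euclidsLemma (k !) ((p ∸ k) !) pr p∣k!l!
...   | inj₁ p∣k! = contradiction p∣k! (p∤k! pr k k<p)
...   | inj₂ p∣l! = contradiction p∣l! (p∤k! pr (p ∸ k) (ℕ.∸-monoʳ-< {p} 0<k (ℕ.<⇒≤ k<p)))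

module AdditivePowers (K : Field) where
  open FieldProperties K

  -- Later modules assume this property of q instead of a characteristic: the trace, its telescoping
  -- and Stepanov's argument use nothing else about how q relates to the field's characteristic.
  Additive : ℕ → Set
  Additive m = ∀ x y → (x + y) ↑ m ≡ x ↑ m + y ↑ m

  additive-* : ∀ {m n} → Additive m → Additive n → Additive (m ℕ.* n)
  additive-* {m} {n} add-m add-n x y = begin
    (x + y) ↑ (m ℕ.* n)  ≡⟨ ↑-* (x + y) m n ⟩
    ((x + y) ↑ m) ↑ n  ≡⟨ cong (_↑ n) (add-m x y) ⟩
    (x ↑ m + y ↑ m) ↑ n  ≡⟨ add-n _ _ ⟩
    (x ↑ m) ↑ n + (y ↑ m) ↑ n  ≡⟨ sym (cong₂ _+_ (↑-* x m n) (↑-* y m n)) ⟩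
    x ↑ (m ℕ.* n) + y ↑ (m ℕ.* n)  ∎
    where open ≡-Reasoning

  additive-^ : ∀ {m} → Additive m → ∀ k → Additive (m ^ k)
  additive-^ add-m zero x y = trans (↑1 _) (cong₂ _+_ (sym (↑1 x)) (sym (↑1 y)))
  additive-^ {m} add-m (suc k) = additive-* {m} {m ^ k} add-m (additive-^ add-m k)

  module _ {p : ℕ} (pr : Prime p) (p·1≡0 : p · 1# ≡ 0#) where
    open import Algebra.Properties.CommutativeSemiring.Binomial commutativeSemiring using (theorem; binomialTerm)
    open import Algebra.Properties.Semiring.Exp semiring using () renaming (_^_ to _^ᴷ_)
    open import Algebra.Properties.Semiring.Mult semiring using (×-assoc-*; ×-homo-1)
    private
      module ∑ᴷ = Sums semiring

      ^ᴷ≡↑ : ∀ x m → x ^ᴷ m ≡ x ↑ m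
      ^ᴷ≡↑ x zero = refl
      ^ᴷ≡↑ x (suc m) = cong (x *_) (^ᴷ≡↑ x m)

      multiple≡0 : ∀ {m} → p ∣ m → ∀ x → m · x ≡ 0#
      multiple≡0 (divides k refl) x = begin
        (k ℕ.* p) · x  ≡⟨ cong ((k ℕ.* p) ·_) (sym (*-identityˡ x)) ⟩
        (k ℕ.* p) · (1# * x)  ≡⟨ sym (×-assoc-* (k ℕ.* p) 1# x) ⟩
        ((k ℕ.* p) · 1#) * x  ≡⟨ cong (_* x) (×1-homo-* k p) ⟩
        (k · 1#) * (p · 1#) * x  ≡⟨ cong (λ y → (k · 1#) * y * x) p·1≡0 ⟩
        (k · 1#) * 0# * x  ≡⟨ cong (_* x) (zeroʳ _) ⟩
        0# * x  ≡⟨ zeroˡ x ⟩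
        0#  ∎
        where open ≡-Reasoning

    additive-char : Additive p
    additive-char x y = begin
      (x + y) ↑ p  ≡⟨ sym (^ᴷ≡↑ (x + y) p) ⟩
      (x + y) ^ᴷ p  ≡⟨ theorem p x y ⟩
      ∑ᴷ.sum (binomialTerm x y p)  ≡⟨ split p pr refl ⟩
      y ↑ p + x ↑ p  ≡⟨ +-comm _ _ ⟩
      x ↑ p + y ↑ p  ∎
      where
      open ≡-Reasoning
      -- Replacing p by a variable r allows it to be split as a successor, which exposes the first
      -- and the last term of the binomial sum.
      split : ∀ r → Prime r → r ≡ p → ∑ᴷ.sum (binomialTerm x y r) ≡ y ↑ r + x ↑ r
      split zero pr0 _ = contradiction (ℕ.>-nonZero⁻¹ _ ⦃ prime⇒nonZero pr0 ⦄) λ ()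
      split (suc r) _ refl = cong₂ _+_ first (begin
        ∑ᴷ.sum (λ i → term (suc i))  ≡⟨ ∑ᴷ.sum-init-last (λ i → term (suc i)) ⟩
        ∑ᴷ.sum (λ i → term (suc (Fin.inject₁ i))) + term (suc (Fin.fromℕ r))
          ≡⟨ cong₂ _+_ (trans (∑ᴷ.sum-cong-≋ middle) (∑ᴷ.sum-replicate-zero r)) last ⟩
        0# + x ↑ suc r  ≡⟨ +-identityˡ _ ⟩
        x ↑ suc r  ∎)
        where
        term = binomialTerm x y (suc r)
        first : term zero ≡ y ↑ suc r
        first = trans (+-identityʳ _) (trans (*-identityˡ _) (^ᴷ≡↑ y (suc r)))
        middle : ∀ (i : Fin r) → term (suc (Fin.inject₁ i)) ≡ 0#
        middle i = multiple≡0 (p∣pCk pr (suc (toℕ (Fin.inject₁ i))) (s≤s z≤n)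
          (s≤s (subst (ℕ._< r) (sym (Fin.toℕ-inject₁ i)) (Fin.toℕ<n i)))) _
        last : term (suc (Fin.fromℕ r)) ≡ x ↑ suc r
        last rewrite Fin.toℕ-fromℕ r | nCn≡1 (suc r) | ℕ.n∸n≡0 r = trans (×-homo-1 _)
          (trans (*-identityʳ _) (^ᴷ≡↑ x (suc r)))

  module _ (m : ℕ) (add-m : Additive m) where
    0↑-additive : 0# ↑ m ≡ 0#
    0↑-additive = begin
      0# ↑ m  ≡⟨ solve 1 (λ x → x := (x :+ x) :- x) refl (0# ↑ m) ⟩
      (0# ↑ m + 0# ↑ m) - 0# ↑ m  ≡⟨ cong (_- 0# ↑ m) (sym (add-m 0# 0#)) ⟩
      (0# + 0#) ↑ m - 0# ↑ m  ≡⟨ cong (λ x → x ↑ m - 0# ↑ m) (+-identityˡ 0#) ⟩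
      0# ↑ m - 0# ↑ m  ≡⟨ -‿inverseʳ _ ⟩
      0#  ∎
      where open ≡-Reasoning

    neg-additive : ∀ x → (- x) ↑ m ≡ - (x ↑ m)
    neg-additive x = x-y≡0⇒x≡y (begin
      (- x) ↑ m - - (x ↑ m)  ≡⟨ cong ((- x) ↑ m +_) (neg-involutive _) ⟩
      (- x) ↑ m + x ↑ m  ≡⟨ sym (add-m (- x) x) ⟩
      (- x + x) ↑ m  ≡⟨ cong (_↑ m) (-‿inverseˡ x) ⟩
      0# ↑ m  ≡⟨ 0↑-additive ⟩
      0#  ∎)
      where open ≡-Reasoning

    sub-additive : ∀ x y → (x - y) ↑ m ≡ x ↑ m - y ↑ m
    sub-additive x y = trans (add-m x (- y)) (cong (x ↑ m +_) (neg-additive y))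

    sum-additive : ∀ {n} (f : Fin n → Carrier) → Sums.sum semiring f ↑ m ≡ Sums.sum semiring (λ i → f i ↑ m)
    sum-additive {zero} f = 0↑-additive
    sum-additive {suc n} f = trans (add-m _ _) (cong (f zero ↑ m +_) (sum-additive (f ∘ suc)))

-- Polynomial functions and their zeros

module Polynomials (K : Field) where
  open FieldProperties K

  -- Functions given by a polynomial of degree < m.
  data Poly : ℕ → (Carrier → Carrier) → Set where
    nil  : ∀ {f} → (∀ z → f z ≡ 0#) → Poly 0 f
    cons : ∀ {m f g} c → Poly m g → (∀ z → f z ≡ c + z * g z) → Poly (suc m) f

  poly-cong : ∀ {m f g} → (∀ z → f z ≡ g z) → Poly m f → Poly m g
  poly-cong f≗g (nil f≗0) = nil λ z → trans (sym (f≗g z)) (f≗0 z)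
  poly-cong f≗g (cons c h f≗) = cons c h λ z → trans (sym (f≗g z)) (f≗ z)

  poly-0 : ∀ m → Poly m (λ _ → 0#)
  poly-0 zero = nil λ _ → refl
  poly-0 (suc m) = cons 0# (poly-0 m) λ z → sym (trans (+-identityˡ _) (zeroʳ z))

  poly-const : ∀ c → Poly 1 (λ _ → c)
  poly-const c = cons c (poly-0 0) λ z → sym (trans (cong (c +_) (zeroʳ z)) (+-identityʳ c))

  poly-weaken : ∀ {m n f} → m ℕ.≤ n → Poly m f → Poly n f
  poly-weaken {n = n} z≤n (nil f≗0) = poly-cong (sym ∘ f≗0) (poly-0 n)
  poly-weaken (s≤s m≤n) (cons c g f≗) = cons c (poly-weaken m≤n g) f≗

  poly-+ : ∀ {m f g} → Poly m f → Poly m g → Poly m (λ z → f z + g z)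
  poly-+ (nil f≗0) (nil g≗0) = nil λ z → trans (cong₂ _+_ (f≗0 z) (g≗0 z)) (+-identityˡ 0#)
  poly-+ (cons c f′ f≗) (cons d g′ g≗) = cons (c + d) (poly-+ f′ g′) λ z → trans (cong₂ _+_ (f≗ z) (g≗ z))
    (solve 5 (λ c z u d v → (c :+ z :* u) :+ (d :+ z :* v) := (c :+ d) :+ z :* (u :+ v)) refl c z _ d _)

  poly-scale : ∀ {m f} c → Poly m f → Poly m (λ z → c * f z)
  poly-scale c (nil f≗0) = nil λ z → trans (cong (c *_) (f≗0 z)) (zeroʳ c)
  poly-scale c (cons d g f≗) = cons (c * d) (poly-scale c g) λ z → trans (cong (c *_) (f≗ z))
    (solve 4 (λ c d z u → c :* (d :+ z :* u) := c :* d :+ z :* (c :* u)) refl c d z _)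

  poly-shift : ∀ {m f} → Poly m f → Poly (suc m) (λ z → z * f z)
  poly-shift f = cons 0# f λ z → sym (+-identityˡ _)

  poly-sum : ∀ {m n} (f : Fin n → Carrier → Carrier) → (∀ i → Poly m (f i)) → Poly m (λ z → Sums.sum semiring (λ i → f i z))
  poly-sum {n = zero} f p = poly-0 _
  poly-sum {n = suc n} f p = poly-+ (p zero) (poly-sum (f ∘ suc) (p ∘ suc))

  poly-* : ∀ {m n f g} → Poly (suc m) f → Poly (suc n) g → Poly (suc (m ℕ.+ n)) (λ z → f z * g z)
  poly-* {zero} (cons c (nil h≗0) f≗) q = poly-cong
    (λ z → cong (_* _) (sym (trans (f≗ z) (trans (cong (λ y → c + z * y) (h≗0 z))
      (trans (cong (c +_) (zeroʳ z)) (+-identityʳ c))))))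
    (poly-scale c q)
  poly-* {suc m} {n} {f} {g} (cons {g = h} c p f≗) q = poly-cong
    (λ z → trans (solve 4 (λ c z h g → c :* g :+ z :* (h :* g) := (c :+ z :* h) :* g) refl c z (h z) (g z))
      (cong (_* g z) (sym (f≗ z))))
    (poly-+ (poly-weaken (s≤s (ℕ.m≤n+m n (suc m))) (poly-scale c q)) (poly-shift (poly-* p q)))

  poly-neg : ∀ {m f} → Poly m f → Poly m (λ z → - f z)
  poly-neg {f = f} p = poly-cong (λ z → solve 1 (λ x → con (ℤ.- (ℤ.+ 1)) :* x := :- x) refl (f z))
    -- The unsimplified scalar is what the solver's constant -1 evaluates to.
    (poly-scale (- (1# + 0#)) p)

  poly-sub : ∀ {m f g} → Poly m f → Poly m g → Poly m (λ z → f z - g z)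
  poly-sub p q = poly-+ p (poly-neg q)

  poly-id : Poly 2 (λ z → z)
  poly-id = poly-cong *-identityʳ (poly-shift (poly-const 1#))

  poly-↑ : ∀ {m f} → Poly (suc m) f → ∀ k → Poly (suc (k ℕ.* m)) (λ z → f z ↑ k)
  poly-↑ p zero = poly-const 1#
  poly-↑ p (suc k) = poly-* p (poly-↑ p k)

  poly-monomial : ∀ k → Poly (suc k) (_↑ k)
  poly-monomial k = subst (λ m → Poly (suc m) (_↑ k)) (ℕ.*-identityʳ k) (poly-↑ poly-id k)

  divide-root : ∀ {m f} → Poly (suc m) f → ∀ r → ∃ λ g → Poly m g × (∀ z → f z - f r ≡ (z - r) * g z)
  divide-root {zero} (cons c (nil h≗0) f≗) r = (λ _ → 0#) , poly-0 0 , λ z →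
    trans (cong₂ _-_ (constant z) (constant r)) (trans (-‿inverseʳ c) (sym (zeroʳ _)))
    where
    constant : ∀ z → _ ≡ c
    constant z = trans (f≗ z) (trans (cong (λ y → c + z * y) (h≗0 z)) (trans (cong (c +_) (zeroʳ z)) (+-identityʳ c)))
  divide-root {suc m} (cons {g = h} c p f≗) r with divide-root p r
  ... | g , q , h- = (λ z → h z + r * g z) , poly-+ p (poly-weaken (ℕ.n≤1+n m) (poly-scale r q)) , λ z →
    trans (cong₂ _-_ (f≗ z) (f≗ r))
      (trans (solve 5 (λ c z h r h′ → (c :+ z :* h) :- (c :+ r :* h′) := (z :- r) :* h :+ r :* (h :- h′)) refl c z (h z) r
        (h r))
      (trans (cong (λ y → (z - r) * h z + r * y) (h- z))
      (solve 4 (λ z h r g → (z :- r) :* h :+ r :* ((z :- r) :* g) := (z :- r) :* (h :+ r :* g)) refl z (h z) r (g z))))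

  -- `Poly` bounds a degree but does not show the leading coefficient. Keeping z^m apart from g
  -- records that the quotient is monic again, as the induction in `monic-roots` requires.
  divide-root-monomial : ∀ m r → ∃ λ g → Poly m g × (∀ z → z ↑ suc m - r ↑ suc m ≡ (z - r) * (z ↑ m + g z))
  divide-root-monomial zero r = (λ _ → 0#) , poly-0 0 , λ z →
    solve 3 (λ z r u → z :* u :- r :* u := (z :- r) :* (u :+ con (ℤ.+ 0))) refl z r 1#
  divide-root-monomial (suc m) r with divide-root-monomial m r
  ... | g , q , mono- = (λ z → z * g z + r ↑ suc m) ,
    poly-+ (poly-shift q) (poly-weaken (s≤s z≤n) (poly-const _)) , λ z →
    trans (solve 4 (λ z w r s → z :* w :- r :* s := z :* (w :- s) :+ s :* (z :- r)) refl z (z ↑ suc m) r (r ↑ suc m))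
    (trans (cong (λ y → z * y + r ↑ suc m * (z - r)) (mono- z))
      (solve 5 (λ z w r s g → z :* ((z :- r) :* (w :+ g)) :+ s :* (z :- r) := (z :- r) :* (z :* w :+ (z :* g :+ s))) refl z
        (z ↑ m) r (r ↑ suc m) (g z)))

module RootBounds (K : Field) {size : ℕ} (K↔ : HasSize (Field.Carrier K) size) where
  open FiniteField K K↔
  open Polynomials K

  count-factor : ∀ {f g} r → (∀ z → f z ≡ (z - r) * g z) → count f ℕ.≤ 1 ℕ.+ count g
  count-factor {f} {g} r f≗ = begin
    count f  ≤⟨ ∑-mono K↔ pointwise ⟩
    ∑ K↔ (λ z → 𝟙 (z ≟ r) ℕ.* 1 ℕ.+ 𝟙 (g z ≟ 0#))  ≡⟨ ∑-+ K↔ (λ z → 𝟙 (z ≟ r) ℕ.* 1) (λ z → 𝟙 (g z ≟ 0#)) ⟩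
    ∑ K↔ (λ z → 𝟙 (z ≟ r) ℕ.* 1) ℕ.+ count g  ≡⟨ cong (ℕ._+ count g) (∑-δ K↔ r (_≟ r) (λ _ → 1)) ⟩
    1 ℕ.+ count g  ∎
    where
    open ℕ.≤-Reasoning
    pointwise : ∀ z → 𝟙 (f z ≟ 0#) ℕ.≤ 𝟙 (z ≟ r) ℕ.* 1 ℕ.+ 𝟙 (g z ≟ 0#)
    pointwise z with z ≟ r
    ... | yes _ = ℕ.≤-trans (𝟙≤1 (f z ≟ 0#)) (ℕ.m≤m+n 1 _)
    ... | no z≢r = 𝟙-mono (f z ≟ 0#) (g z ≟ 0#) λ fz≡0 →
      *-cancel-≢0 (λ z-r≡0 → z≢r (x-y≡0⇒x≡y z-r≡0)) (trans (sym (f≗ z)) fz≡0)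

  -- Each division by a zero lowers the degree bound by one and loses at most one zero, until
  -- `Poly 0` is reached. The conclusion concerns values, not coefficients.
  vanishing : ∀ {m f} → Poly m f → m ℕ.≤ count f → ∀ z → f z ≡ 0#
  vanishing (nil f≗0) _ = f≗0
  vanishing {suc m} {f} p m<count with #-positive K↔ (λ z → f z ≟ 0#) (ℕ.≤-trans (s≤s z≤n) m<count)
  ... | r , fr≡0 with divide-root p r
  ...   | g , q , f- = λ z → trans (factor z) (trans (cong ((z - r) *_) (vanishing q m≤count z)) (zeroʳ _))
    where
    factor : ∀ z → f z ≡ (z - r) * g z
    factor z = trans (trans (solve 1 (λ x → x := x :- con (ℤ.+ 0)) refl (f z)) (cong (λ y → f z - y) (sym fr≡0))) (f- z)
    m≤count : m ℕ.≤ count g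
    m≤count = ℕ.≤-pred (ℕ.≤-trans m<count (count-factor r factor))

  -- Dividing out zeros keeps the polynomial monic, and in degree 0 it is the constant 1, which has
  -- no zero. Hence the bound holds with no comparison between m and the size of the field.
  monic-roots : ∀ {m f g} → Poly m g → (∀ z → f z ≡ z ↑ m + g z) → count f ℕ.≤ m
  monic-roots {zero} {f} (nil g≗0) f≗ = ℕ.≤-reflexive
    (trans (∑-cong K↔ λ z → 𝟙-no (f z ≟ 0#) λ fz≡0 → 1≢0 (trans
      (sym (trans (f≗ z) (trans (cong (1# +_) (g≗0 z)) (+-identityʳ 1#)))) fz≡0))
      (trans (∑-const K↔ 0) (ℕ.*-zeroʳ size)))
  monic-roots {suc m} {f} {g} p f≗ with any? K↔ (λ z → f z ≟ 0#)
  ... | no ∄root = ℕ.≤-trans (ℕ.≤-reflexive (trans (∑-cong K↔ λ z → 𝟙-no (f z ≟ 0#) (λ fz≡0 → ∄root (z , fz≡0)))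
    (trans (∑-const K↔ 0) (ℕ.*-zeroʳ size)))) z≤n
  ... | yes (r , fr≡0) with divide-root p r | divide-root-monomial m r
  ...   | h , ph , h- | k , pk , k- = ℕ.≤-trans (count-factor r factor)
    (s≤s (monic-roots {f = λ z → z ↑ m + (k z + h z)} (poly-+ pk ph) (λ z → refl)))
    where
    factor : ∀ z → f z ≡ (z - r) * (z ↑ m + (k z + h z))
    factor z = begin
      f z  ≡⟨ solve 1 (λ x → x := x :- con (ℤ.+ 0)) refl (f z) ⟩
      f z - 0#  ≡⟨ cong (λ y → f z - y) (sym fr≡0) ⟩
      f z - f r  ≡⟨ cong₂ _-_ (f≗ z) (f≗ r) ⟩
      (z ↑ suc m + g z) - (r ↑ suc m + g r)  ≡⟨ solve 4 (λ a b c d → (a :+ b) :- (c :+ d) := (a :- c) :+ (b :- d)) refl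
        (z ↑ suc m) (g z) (r ↑ suc m) (g r) ⟩
      (z ↑ suc m - r ↑ suc m) + (g z - g r)  ≡⟨ cong₂ _+_ (k- z) (h- z) ⟩
      (z - r) * (z ↑ m + k z) + (z - r) * h z  ≡⟨ solve 4 (λ a b c d → a :* (b :+ c) :+ a :* d := a :* (b :+ (c :+ d))) refl
        (z - r) (z ↑ m) (k z) (h z) ⟩
      (z - r) * (z ↑ m + (k z + h z))  ∎
      where open ≡-Reasoning

-- The trace as a q-polynomial

module Trace (K : Field) (q : ℕ) (add-q : AdditivePowers.Additive K q) where
  open FieldProperties K
  open AdditivePowers K

  Trace : ℕ → Carrier → Carrier
  Trace = Tr K q

  private
    add-q^ : ∀ k → Additive (q ^ k)
    add-q^ = additive-^ add-q

  Tr-+ : ∀ k x y → Trace k (x + y) ≡ Trace k x + Trace k y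
  Tr-+ zero x y = sym (+-identityˡ 0#)
  Tr-+ (suc k) x y = trans (cong₂ _+_ (Tr-+ k x y) (add-q^ k x y))
    (solve 4 (λ a b c d → (a :+ b) :+ (c :+ d) := (a :+ c) :+ (b :+ d)) refl _ _ _ _)

  Tr-0 : ∀ k → Trace k 0# ≡ 0#
  Tr-0 zero = refl
  Tr-0 (suc k) = trans (cong₂ _+_ (Tr-0 k) (0↑-additive (q ^ k) (add-q^ k))) (+-identityˡ 0#)

  Tr-neg : ∀ k x → Trace k (- x) ≡ - Trace k x
  Tr-neg zero x = sym -0#≈0#
  Tr-neg (suc k) x = trans (cong₂ _+_ (Tr-neg k x) (neg-additive (q ^ k) (add-q^ k) x)) (⁻¹-∙-comm _ _)

  Tr-sub : ∀ k x y → Trace k (x - y) ≡ Trace k x - Trace k y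
  Tr-sub k x y = trans (Tr-+ k x (- y)) (cong (Trace k x +_) (Tr-neg k y))

  -- For k = l this writes the trace of a field of square order as T + T^Q, which drives both
  -- `TE-trace` and Stepanov's argument.
  Tr-split : ∀ k l x → Trace (k ℕ.+ l) x ≡ Trace k x + Trace l x ↑ (q ^ k)
  Tr-split k zero x = begin
    Trace (k ℕ.+ 0) x  ≡⟨ cong (λ j → Trace j x) (ℕ.+-identityʳ k) ⟩
    Trace k x  ≡⟨ sym (+-identityʳ _) ⟩
    Trace k x + 0#  ≡⟨ cong (Trace k x +_) (sym (0↑-additive (q ^ k) (add-q^ k))) ⟩
    Trace k x + 0# ↑ (q ^ k)  ∎
    where open ≡-Reasoning
  Tr-split k (suc l) x = begin
    Trace (k ℕ.+ suc l) x  ≡⟨ cong (λ j → Trace j x) (ℕ.+-suc k l) ⟩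
    Trace (k ℕ.+ l) x + x ↑ (q ^ (k ℕ.+ l))  ≡⟨ cong₂ _+_ (Tr-split k l x) power ⟩
    Trace k x + Trace l x ↑ (q ^ k) + (x ↑ (q ^ l)) ↑ (q ^ k)  ≡⟨ +-assoc _ _ _ ⟩
    Trace k x + (Trace l x ↑ (q ^ k) + (x ↑ (q ^ l)) ↑ (q ^ k))  ≡⟨ cong (Trace k x +_) (sym (add-q^ k _ _)) ⟩
    Trace k x + (Trace l x + x ↑ (q ^ l)) ↑ (q ^ k)  ∎
    where
    open ≡-Reasoning
    power : x ↑ (q ^ (k ℕ.+ l)) ≡ (x ↑ (q ^ l)) ↑ (q ^ k)
    power = trans (cong (x ↑_) (trans (ℕ.^-distribˡ-+-* q k l) (ℕ.*-comm (q ^ k) (q ^ l)))) (↑-* x (q ^ l) (q ^ k))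

  Tr-↑ : ∀ {m} → Additive m → ∀ k x → Trace k x ↑ m ≡ Trace k (x ↑ m)
  Tr-↑ {m} add-m zero x = 0↑-additive m add-m
  Tr-↑ {m} add-m (suc k) x = trans (add-m _ _) (cong₂ _+_ (Tr-↑ {m} add-m k x) (↑-comm x (q ^ k) m))

  Tr-1 : ∀ x → Trace 1 x ≡ x
  Tr-1 x = trans (+-identityˡ _) (↑1 x)

  -- Splitting `Trace (suc k) x` at its two ends gives x + Tr^q on one side and Tr + x^(q^k) on the
  -- other; since x^(q^k) = x, the two x cancel.
  Tr-fixed : ∀ k x → x ↑ (q ^ k) ≡ x → Trace k x ↑ q ≡ Trace k x
  Tr-fixed k x fixed = begin
    Trace k x ↑ q  ≡⟨ cong (Trace k x ↑_) (sym (ℕ.*-identityʳ q)) ⟩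
    Trace k x ↑ (q ^ 1)  ≡⟨ solve 2 (λ x y → y := (x :+ y) :- x) refl x _ ⟩
    (x + Trace k x ↑ (q ^ 1)) - x  ≡⟨ cong (λ y → (y + Trace k x ↑ (q ^ 1)) - x) (sym (Tr-1 x)) ⟩
    (Trace 1 x + Trace k x ↑ (q ^ 1)) - x  ≡⟨ cong (_- x) (sym (Tr-split 1 k x)) ⟩
    (Trace k x + x ↑ (q ^ k)) - x  ≡⟨ cong (λ y → (Trace k x + y) - x) fixed ⟩
    (Trace k x + x) - x  ≡⟨ solve 2 (λ x y → (y :+ x) :- x := y) refl x _ ⟩
    Trace k x  ∎
    where open ≡-Reasoning

  -- The easy half of the additive Hilbert 90: when z^(q^k) = z, the element z^q - z has trace 0.
  -- The condition Tr x = 0 is thus built into the substitution x = z^q - z.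
  Tr-telescope : ∀ k z → Trace k (z ↑ q - z) ≡ z ↑ (q ^ k) - z
  Tr-telescope zero z = sym (trans (cong (_- z) (↑1 z)) (-‿inverseʳ z))
  Tr-telescope (suc k) z = begin
    Trace k (z ↑ q - z) + (z ↑ q - z) ↑ (q ^ k)  ≡⟨ cong₂ _+_ (Tr-telescope k z) (sub-additive (q ^ k) (add-q^ k) _ _) ⟩
    (z ↑ (q ^ k) - z) + ((z ↑ q) ↑ (q ^ k) - z ↑ (q ^ k))  ≡⟨ solve 3 (λ a b c → (a :- b) :+ (c :- a) := c :- b) refl _ z
      _ ⟩
    (z ↑ q) ↑ (q ^ k) - z  ≡⟨ cong (_- z) (sym (↑-* z q (q ^ k))) ⟩
    z ↑ (q ^ suc k) - z  ∎
    where open ≡-Reasoning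

  open Polynomials K

  -- The degree stays below q^k, so in `Trace (suc k)` the last summand is the leading term and the
  -- trace is monic.
  poly-Tr : 1 ℕ.< q → ∀ k → Poly (q ^ k) (Trace k)
  poly-Tr 1<q zero = poly-0 1
  poly-Tr 1<q (suc k) = poly-weaken q^k<q^1+k
    (poly-+ (poly-weaken (ℕ.n≤1+n _) (poly-Tr 1<q k)) (poly-monomial (q ^ k)))
    where
    q^k<q^1+k : q ^ k ℕ.< q ^ suc k
    q^k<q^1+k = ℕ.^-monoʳ-< q 1<q (ℕ.n<1+n k)

-- The image of F in K

module Subfield {F K : Field} {q size : ℕ} (F↔ : HasSize (Field.Carrier F) q) (K↔ : HasSize (Field.Carrier K) size)
  (1<q : 1 ℕ.< q) (ι : Field.Carrier F → Field.Carrier K) (ι-hom : IsRingHom F K ι) where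
  private
    module F = FiniteField F F↔
  open FiniteField K K↔
  open Polynomials K
  open RootBounds K K↔
  open IsRingHom ι-hom

  ι-0 : ι F.0# ≡ 0#
  ι-0 = trans (solve 1 (λ x → x := (x :+ x) :- x) refl (ι F.0#))
    (trans (cong (_- ι F.0#) (trans (sym (hom-+ F.0# F.0#)) (cong ι (F.+-identityˡ F.0#)))) (-‿inverseʳ _))

  ι-neg : ∀ a → ι (F.- a) ≡ - ι a
  ι-neg a = x-y≡0⇒x≡y (trans (cong (ι (F.- a) +_) (neg-involutive _))
    (trans (sym (hom-+ _ _)) (trans (cong ι (F.-‿inverseˡ a)) ι-0)))

  ι-↑ : ∀ a m → ι (a F.↑ m) ≡ ι a ↑ m
  ι-↑ a zero = hom-1
  ι-↑ a (suc m) = trans (hom-* a _) (cong (ι a *_) (ι-↑ a m))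

  ι-kernel : ∀ {a} → ι a ≡ 0# → a ≡ F.0#
  ι-kernel {a} ιa≡0 with a F.≟ F.0#
  ... | yes a≡0 = a≡0
  ... | no a≢0 = contradiction (begin
    1#  ≡⟨ sym hom-1 ⟩
    ι F.1#  ≡⟨ cong ι (sym (F.*-inverseʳ a≢0)) ⟩
    ι (a F.* a F.⁻¹)  ≡⟨ hom-* a _ ⟩
    ι a * ι (a F.⁻¹)  ≡⟨ cong (_* ι (a F.⁻¹)) ιa≡0 ⟩
    0# * ι (a F.⁻¹)  ≡⟨ zeroˡ _ ⟩
    0#  ∎) 1≢0
    where open ≡-Reasoning

  ι-injective : ∀ {a b} → ι a ≡ ι b → a ≡ b
  ι-injective {a} {b} ιa≡ιb = F.x-y≡0⇒x≡y (ι-kernel (trans (hom-+ a (F.- b))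
    (trans (cong (ι a +_) (ι-neg b)) (x≡y⇒x-y≡0 ιa≡ιb))))

  ι-fixed : ∀ a → ι a ↑ q ≡ ι a
  ι-fixed a = trans (sym (ι-↑ a q)) (cong ι (F.fermat a))

  -- ι(F) consists of q roots of z^q - z, so there is no room for another one.
  fixed⇒image : ∀ {c} → c ↑ q ≡ c → ∃ λ a → c ≡ ι a
  fixed⇒image {c} fixed with any? F↔ (λ a → c ≟ ι a)
  ... | yes image = image
  ... | no ∉image = contradiction roots≤q (ℕ.<⇒≱ q<roots)
    where
    roots≤q : count (λ z → z ↑ q - z) ℕ.≤ q
    roots≤q = monic-roots (poly-neg (poly-weaken 1<q poly-id)) (λ z → refl)
    pointwise : ∀ z → 𝟙 (z ≟ c) ℕ.* 1 ℕ.+ ∑ F↔ (λ a → 𝟙 (z ≟ ι a)) ℕ.≤ 𝟙 (z ↑ q - z ≟ 0#)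
    pointwise z with z ≟ c
    ... | yes refl = ℕ.≤-reflexive (trans
        (cong (1 ℕ.+_) (∑-empty F↔ (λ a → c ≟ ι a) λ a c≡ιa → ∉image (a , c≡ιa)))
        (sym (𝟙-yes (c ↑ q - c ≟ 0#) (x≡y⇒x-y≡0 fixed))))
    ... | no _ with any? F↔ (λ a → z ≟ ι a)
    ...   | yes (a , refl) = ℕ.≤-trans (∑-atMostOne F↔ (λ a′ → ι a ≟ ι a′) (λ p p′ → ι-injective (trans (sym p) p′)))
              (ℕ.≤-reflexive (sym (𝟙-yes (ι a ↑ q - ι a ≟ 0#) (x≡y⇒x-y≡0 (ι-fixed a)))))
    ...   | no ∉ = ℕ.≤-trans (ℕ.≤-reflexive (∑-empty F↔ (λ a → z ≟ ι a) λ a p → ∉ (a , p))) z≤n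
    q<roots : q ℕ.< count (λ z → z ↑ q - z)
    q<roots = begin
      1 ℕ.+ q  ≡⟨ cong₂ ℕ._+_ (sym (∑-δ K↔ c (_≟ c) (λ _ → 1))) (sym image-size) ⟩
      ∑ K↔ (λ z → 𝟙 (z ≟ c) ℕ.* 1) ℕ.+ ∑ K↔ (λ z → ∑ F↔ (λ a → 𝟙 (z ≟ ι a)))
        ≡⟨ sym (∑-+ K↔ (λ z → 𝟙 (z ≟ c) ℕ.* 1) (λ z → ∑ F↔ (λ a → 𝟙 (z ≟ ι a)))) ⟩
      ∑ K↔ (λ z → 𝟙 (z ≟ c) ℕ.* 1 ℕ.+ ∑ F↔ (λ a → 𝟙 (z ≟ ι a)))  ≤⟨ ∑-mono K↔ pointwise ⟩
      count (λ z → z ↑ q - z)  ∎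
      where
      open ℕ.≤-Reasoning
      image-size : ∑ K↔ (λ z → ∑ F↔ (λ a → 𝟙 (z ≟ ι a))) ≡ q
      image-size = trans (∑-swap K↔ F↔ (λ z a → 𝟙 (z ≟ ι a)))
        (trans (∑-cong F↔ λ a → ∑-unique K↔ (_≟ ι a) (ι a) refl id)
          (trans (∑-const F↔ 1) (ℕ.*-identityʳ q)))

-- The numbers N(a , b) and their first two moments

∑-factor : (e : HasSize A m) (e′ : HasSize B n) (c : ℕ) (f : A → ℕ) (g : B → ℕ) →
           ∑ e (λ x → ∑ e′ (λ y → c ℕ.* (f x ℕ.* g y))) ≡ c ℕ.* (∑ e f ℕ.* ∑ e′ g)
∑-factor e e′ c f g = begin
  ∑ e (λ x → ∑ e′ (λ y → c ℕ.* (f x ℕ.* g y)))  ≡⟨ ∑-cong e (λ x → trans (sym (∑-*ˡ e′ c (λ y → f x ℕ.* g y)))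
    (cong (c ℕ.*_) (sym (∑-*ˡ e′ (f x) g)))) ⟩
  ∑ e (λ x → c ℕ.* (f x ℕ.* ∑ e′ g))  ≡⟨ sym (∑-*ˡ e c (λ x → f x ℕ.* ∑ e′ g)) ⟩
  c ℕ.* ∑ e (λ x → f x ℕ.* ∑ e′ g)  ≡⟨ cong (c ℕ.*_) (sym (∑-*ʳ e (∑ e′ g) f)) ⟩
  c ℕ.* (∑ e f ℕ.* ∑ e′ g)  ∎
  where open ≡-Reasoning

module Counting {F K : Field} {q n′ : ℕ}
  (F↔ : HasSize (Field.Carrier F) q) (K↔ : HasSize (Field.Carrier K) (q ^ suc n′))
  (1<q : 1 ℕ.< q) (add-q : AdditivePowers.Additive K q)
  (ι : Field.Carrier F → Field.Carrier K) (ι-hom : IsRingHom F K ι) where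
  private
    module F = FiniteField F F↔
  open FiniteField K K↔
  open Polynomials K
  open RootBounds K K↔
  open Trace K q add-q
  open Subfield {F} {K} F↔ K↔ 1<q ι ι-hom

  d : ℕ
  d = q ^ n′

  T : Carrier → Carrier
  T = Trace (suc n′)

  ∑K : (Carrier → ℕ) → ℕ
  ∑K = ∑ K↔

  ∑F : (F.Carrier → ℕ) → ℕ
  ∑F = ∑ F↔

  χ : Carrier → ℕ
  χ x = 𝟙 (¬? (x ≟ 0#))

  ∑-punctured : ∀ g → ∑K (λ x → χ x ℕ.* g x) ℕ.+ g 0# ≡ ∑K g
  ∑-punctured g = begin
    ∑K (λ x → χ x ℕ.* g x) ℕ.+ g 0#  ≡⟨ cong (∑K (λ x → χ x ℕ.* g x) ℕ.+_) (sym (∑-δ K↔ 0# (_≟ 0#) g)) ⟩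
    ∑K (λ x → χ x ℕ.* g x) ℕ.+ ∑K (λ x → 𝟙 (x ≟ 0#) ℕ.* g x)
      ≡⟨ sym (∑-+ K↔ (λ x → χ x ℕ.* g x) (λ x → 𝟙 (x ≟ 0#) ℕ.* g x)) ⟩
    ∑K (λ x → χ x ℕ.* g x ℕ.+ 𝟙 (x ≟ 0#) ℕ.* g x)  ≡⟨ ∑-cong K↔
      (λ x → trans (sym (ℕ.*-distribʳ-+ (g x) (χ x) _)) (trans (cong (ℕ._* g x) (𝟙-¬ (x ≟ 0#))) (ℕ.*-identityˡ _))) ⟩
    ∑K g  ∎
    where open ≡-Reasoning

  T-image : ∀ x → ∃ λ a → T x ≡ ι a
  T-image x = fixed⇒image (Tr-fixed (suc n′) x (fermat x))

  ∑F-image : ∀ x → ∑F (λ a → 𝟙 (T x ≟ ι a)) ≡ 1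
  ∑F-image x with T-image x
  ... | a , Tx≡ιa = ∑-unique F↔ (λ a → T x ≟ ι a) a Tx≡ιa λ Tx≡ιb → ι-injective (trans (sym Tx≡ιb) Tx≡ιa)

  -- A fibre is the zero set of a monic polynomial of degree d, and the q fibres together contain
  -- all q d elements, so none of these bounds can be strict.
  T-fiber : ∀ a → ∑K (λ x → 𝟙 (T x ≟ ι a)) ≡ d
  T-fiber = ∑-tight F↔ {f = λ a → ∑K (λ x → 𝟙 (T x ≟ ι a))} fiber≤d (ℕ.≤-reflexive (sym total))
    where
    fiber≤d : ∀ a → ∑K (λ x → 𝟙 (T x ≟ ι a)) ℕ.≤ d
    fiber≤d a = ℕ.≤-trans
      (ℕ.≤-reflexive (∑-cong K↔ λ x → 𝟙-cong (T x ≟ ι a) (T x - ι a ≟ 0#) x≡y⇒x-y≡0 x-y≡0⇒x≡y))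
      (monic-roots {g = λ x → Trace n′ x - ι a}
        (poly-sub (poly-Tr 1<q n′) (poly-weaken (ℕ.^-monoʳ-≤ q ⦃ ℕ.>-nonZero (ℕ.<⇒≤ 1<q) ⦄ {0} {n′} z≤n)
          (poly-const (ι a))))
        (λ x → solve 3 (λ t y a → (t :+ y) :- a := y :+ (t :- a)) refl (Trace n′ x) (x ↑ d) (ι a)))
    total : ∑F (λ a → ∑K (λ x → 𝟙 (T x ≟ ι a))) ≡ q ℕ.* d
    total = trans (∑-swap F↔ K↔ (λ a x → 𝟙 (T x ≟ ι a)))
      (trans (∑-cong K↔ ∑F-image) (trans (∑-const K↔ 1) (ℕ.*-identityʳ _)))

  -- An inequality is enough, because `pairs` has to bound Σ N² only from above.
  coincidence : ∀ u v → ∑F (λ a → 𝟙 (u ≟ ι a) ℕ.* 𝟙 (v ≟ ι a)) ℕ.≤ 𝟙 (u ≟ v)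
  coincidence u v with u ≟ v
  ... | yes refl = ℕ.≤-trans
    (∑-mono F↔ {g = λ a → 𝟙 (u ≟ ι a)} λ a → ℕ.≤-trans (ℕ.*-monoʳ-≤ (𝟙 (u ≟ ι a)) (𝟙≤1 (u ≟ ι a)))
      (ℕ.≤-reflexive (ℕ.*-identityʳ (𝟙 (u ≟ ι a)))))
    (∑-atMostOne F↔ (λ a → u ≟ ι a) λ p p′ → ι-injective (trans (sym p) p′))
  ... | no u≢v = ℕ.≤-reflexive (trans (∑-cong F↔ disjoint) (trans (∑-const F↔ 0) (ℕ.*-zeroʳ q)))
    where
    disjoint : ∀ a → 𝟙 (u ≟ ι a) ℕ.* 𝟙 (v ≟ ι a) ≡ 0
    disjoint a with u ≟ ι a
    ... | no _ = refl
    ... | yes u≡ιa = trans (ℕ.+-identityʳ _) (𝟙-no (v ≟ ι a) λ v≡ιa → u≢v (trans u≡ιa (sym v≡ιa)))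

  module _ (α : Carrier) where

    N : F.Carrier → F.Carrier → ℕ
    N a b = ∑K λ x → χ x ℕ.* (𝟙 (T x ≟ ι a) ℕ.* 𝟙 (T (α * x ⁻¹) ≟ ι b))

    pairs : ℕ
    pairs = ∑K λ x → ∑K λ y → (χ x ℕ.* χ y) ℕ.* (𝟙 (T x ≟ T y) ℕ.* 𝟙 (T (α * x ⁻¹) ≟ T (α * y ⁻¹)))

    N-solution : ∀ {a b} → 0 ℕ.< N a b → ∃₂ λ x y → T x ≡ ι a × T y ≡ ι b × α ≡ x * y
    N-solution {a} {b} 0<N with #-positive K↔ (λ x → ¬? (x ≟ 0#) ×-dec ((T x ≟ ι a) ×-dec (T (α * x ⁻¹) ≟ ι b)))
                                  (ℕ.<-≤-trans 0<N (ℕ.≤-reflexive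
                                    (∑-cong K↔ λ x → 𝟙-× (¬? (x ≟ 0#)) (T x ≟ ι a) (T (α * x ⁻¹) ≟ ι b))))
      where
      𝟙-× : ∀ {P Q R : Set} (p : Dec P) (q : Dec Q) (r : Dec R) → 𝟙 p ℕ.* (𝟙 q ℕ.* 𝟙 r) ≡ 𝟙 (p ×-dec (q ×-dec r))
      𝟙-× (yes _) (yes _) (yes _) = refl
      𝟙-× (yes _) (yes _) (no _) = refl
      𝟙-× (yes _) (no _) _ = refl
      𝟙-× (no _) _ _ = refl
    ... | x , x≢0 , Tx≡a , Ty≡b = x , α * x ⁻¹ , Tx≡a , Ty≡b , (begin
      α  ≡⟨ sym (*-identityʳ α) ⟩
      α * 1#  ≡⟨ cong (α *_) (sym (*-inverseʳ x≢0)) ⟩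
      α * (x * x ⁻¹)  ≡⟨ solve 3 (λ α x y → α :* (x :* y) := x :* (α :* y)) refl α x (x ⁻¹) ⟩
      x * (α * x ⁻¹)  ∎)
      where open ≡-Reasoning

    ∑b-N : ∀ a → ∑F (N a) ≡ ∑K (λ x → χ x ℕ.* 𝟙 (T x ≟ ι a))
    ∑b-N a = trans (∑-swap F↔ K↔ (λ b x → χ x ℕ.* (𝟙 (T x ≟ ι a) ℕ.* 𝟙 (T (α * x ⁻¹) ≟ ι b))))
      (∑-cong K↔ λ x → trans (sym (∑-*ˡ F↔ (χ x) (λ b → 𝟙 (T x ≟ ι a) ℕ.* 𝟙 (T (α * x ⁻¹) ≟ ι b))))
        (cong (χ x ℕ.*_) (trans (sym (∑-*ˡ F↔ (𝟙 (T x ≟ ι a)) (λ b → 𝟙 (T (α * x ⁻¹) ≟ ι b))))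
          (trans (cong (𝟙 (T x ≟ ι a) ℕ.*_) (∑F-image (α * x ⁻¹))) (ℕ.*-identityʳ (𝟙 (T x ≟ ι a)))))))

    ∑a-N : ∀ b → ∑F (λ a → N a b) ≡ ∑K (λ x → χ x ℕ.* 𝟙 (T (α * x ⁻¹) ≟ ι b))
    ∑a-N b = trans (∑-swap F↔ K↔ (λ a x → χ x ℕ.* (𝟙 (T x ≟ ι a) ℕ.* 𝟙 (T (α * x ⁻¹) ≟ ι b))))
      (∑-cong K↔ λ x → trans (sym (∑-*ˡ F↔ (χ x) (λ a → 𝟙 (T x ≟ ι a) ℕ.* 𝟙 (T (α * x ⁻¹) ≟ ι b))))
        (cong (χ x ℕ.*_) (trans (sym (∑-*ʳ F↔ (𝟙 (T (α * x ⁻¹) ≟ ι b)) (λ a → 𝟙 (T x ≟ ι a))))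
          (trans (cong (ℕ._* 𝟙 (T (α * x ⁻¹) ≟ ι b)) (∑F-image x)) (ℕ.*-identityˡ (𝟙 (T (α * x ⁻¹) ≟ ι b)))))))

    N-total : ∑F (λ a → ∑F (N a)) ℕ.+ 1 ≡ q ℕ.* d
    N-total = begin
      ∑F (λ a → ∑F (N a)) ℕ.+ 1  ≡⟨ cong (ℕ._+ 1) (trans (∑-cong F↔ ∑b-N) (∑-swap F↔ K↔ (λ a x → χ x ℕ.* 𝟙 (T x ≟ ι a)))) ⟩
      ∑K (λ x → ∑F (λ a → χ x ℕ.* 𝟙 (T x ≟ ι a))) ℕ.+ 1  ≡⟨ cong (ℕ._+ 1)
        (∑-cong K↔ λ x → trans (sym (∑-*ˡ F↔ (χ x) (λ a → 𝟙 (T x ≟ ι a)))) (cong (χ x ℕ.*_) (∑F-image x))) ⟩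
      ∑K (λ x → χ x ℕ.* 1) ℕ.+ 1  ≡⟨ ∑-punctured (λ _ → 1) ⟩
      ∑K (λ _ → 1)  ≡⟨ trans (∑-const K↔ 1) (ℕ.*-identityʳ _) ⟩
      q ℕ.* d  ∎
      where open ≡-Reasoning

    -- The element 0, excluded by `χ`, lies in the fibre over 0 alone. So the sum is d - 1 or d, and
    -- this bound covers both without deciding whether a is 0.
    punctured-fiber : ∀ a → d ℕ.≤ ∑K (λ x → χ x ℕ.* 𝟙 (T x ≟ ι a)) ℕ.+ 1
    punctured-fiber a = begin
      d  ≡⟨ sym (T-fiber a) ⟩
      ∑K (λ x → 𝟙 (T x ≟ ι a))  ≡⟨ sym (∑-punctured (λ x → 𝟙 (T x ≟ ι a))) ⟩
      ∑K (λ x → χ x ℕ.* 𝟙 (T x ≟ ι a)) ℕ.+ 𝟙 (T 0# ≟ ι a)  ≤⟨ ℕ.+-monoʳ-≤ _ (𝟙≤1 (T 0# ≟ ι a)) ⟩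
      ∑K (λ x → χ x ℕ.* 𝟙 (T x ≟ ι a)) ℕ.+ 1  ∎
      where open ℕ.≤-Reasoning

    N-row : ∀ a → d ℕ.≤ ∑F (N a) ℕ.+ 1
    N-row a = ℕ.≤-trans (punctured-fiber a) (ℕ.≤-reflexive (cong (ℕ._+ 1) (sym (∑b-N a))))

    ∑-divide : ∀ {β} → β ≢ 0# → (g : Carrier → ℕ) → ∑K (λ x → χ x ℕ.* g (β * x ⁻¹)) ≡ ∑K (λ x → χ x ℕ.* g x)
    ∑-divide {β} β≢0 g = sym (trans
      (∑-reindex K↔ (λ x → β * x ⁻¹) (λ x → β * x ⁻¹) (divide-involutive β≢0) (divide-involutive β≢0) (λ x → χ x ℕ.* g x))
      (∑-cong K↔ λ x → cong (ℕ._* g (β * x ⁻¹)) (𝟙-cong (¬? (β * x ⁻¹ ≟ 0#)) (¬? (x ≟ 0#))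
        (λ βx⁻¹≢0 x≡0 → βx⁻¹≢0 (trans (cong (λ y → β * y ⁻¹) x≡0) (trans (cong (β *_) 0⁻¹) (zeroʳ β))))
        (λ x≢0 → *-≢0 β≢0 (⁻¹-≢0 x≢0)))))

    N-column : α ≢ 0# → ∀ b → d ℕ.≤ ∑F (λ a → N a b) ℕ.+ 1
    N-column α≢0 b = ℕ.≤-trans (punctured-fiber b)
      (ℕ.≤-reflexive (cong (ℕ._+ 1) (sym (trans (∑a-N b) (∑-divide α≢0 (λ x → 𝟙 (T x ≟ ι b)))))))

    ∑N² : ∑F (λ a → ∑F (λ b → N a b ℕ.* N a b)) ℕ.≤ pairs
    ∑N² = begin
      ∑F (λ a → ∑F (λ b → N a b ℕ.* N a b))
        ≡⟨ ∑-cong F↔ (λ a → ∑-cong F↔ (λ b → square a b)) ⟩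
      ∑F (λ a → ∑F (λ b → ∑K (λ x → ∑K (λ y → G a b x y))))
        ≡⟨ ∑-cong F↔ (λ a → trans (∑-swap F↔ K↔ (λ b x → ∑K (λ y → G a b x y)))
          (∑-cong K↔ λ x → ∑-swap F↔ K↔ (λ b y → G a b x y))) ⟩
      ∑F (λ a → ∑K (λ x → ∑K (λ y → ∑F (λ b → G a b x y))))
        ≡⟨ trans (∑-swap F↔ K↔ (λ a x → ∑K (λ y → ∑F (λ b → G a b x y))))
          (∑-cong K↔ λ x → ∑-swap F↔ K↔ (λ a y → ∑F (λ b → G a b x y))) ⟩
      ∑K (λ x → ∑K (λ y → ∑F (λ a → ∑F (λ b → G a b x y))))
        ≤⟨ ∑-mono K↔ (λ x → ∑-mono K↔ (λ y → collapse x y)) ⟩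
      pairs ∎
      where
      open ℕ.≤-Reasoning
      G : F.Carrier → F.Carrier → Carrier → Carrier → ℕ
      G a b x y = (χ x ℕ.* χ y) ℕ.* ((𝟙 (T x ≟ ι a) ℕ.* 𝟙 (T y ≟ ι a)) ℕ.* (𝟙 (T (α * x ⁻¹) ≟ ι b) ℕ.* 𝟙
        (T (α * y ⁻¹) ≟ ι b)))
      shuffle : ∀ c a b c′ a′ b′ → (c ℕ.* (a ℕ.* b)) ℕ.* (c′ ℕ.* (a′ ℕ.* b′)) ≡ (c ℕ.* c′) ℕ.* ((a ℕ.* a′) ℕ.* (b ℕ.* b′))
      shuffle = solve-∀
      square : ∀ a b → N a b ℕ.* N a b ≡ ∑K (λ x → ∑K (λ y → G a b x y))
      square a b = trans (∑-*ʳ K↔ (N a b) f) (∑-cong K↔ λ x → trans (∑-*ˡ K↔ (f x) f)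
        (∑-cong K↔ λ y → shuffle (χ x) (𝟙 (T x ≟ ι a)) (𝟙 (T (α * x ⁻¹) ≟ ι b)) (χ y) (𝟙 (T y ≟ ι a))
          (𝟙 (T (α * y ⁻¹) ≟ ι b))))
        where
        f : Carrier → ℕ
        f x = χ x ℕ.* (𝟙 (T x ≟ ι a) ℕ.* 𝟙 (T (α * x ⁻¹) ≟ ι b))
      collapse : ∀ x y → ∑F (λ a → ∑F (λ b → G a b x y)) ℕ.≤ (χ x ℕ.* χ y)
        ℕ.* (𝟙 (T x ≟ T y) ℕ.* 𝟙 (T (α * x ⁻¹) ≟ T (α * y ⁻¹)))
      collapse x y = ℕ.≤-trans
        (ℕ.≤-reflexive (∑-factor F↔ F↔ (χ x ℕ.* χ y) (λ a → 𝟙 (T x ≟ ι a) ℕ.* 𝟙 (T y ≟ ι a))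
          (λ b → 𝟙 (T (α * x ⁻¹) ≟ ι b) ℕ.* 𝟙 (T (α * y ⁻¹) ≟ ι b))))
        (ℕ.*-monoʳ-≤ (χ x ℕ.* χ y) (ℕ.*-mono-≤ (coincidence (T x) (T y)) (coincidence (T (α * x ⁻¹)) (T (α * y ⁻¹)))))

    weight : Carrier → Carrier → ℕ
    weight s p = χ p ℕ.* (𝟙 (T s ≟ 0#) ℕ.* 𝟙 (T (α * (s * p ⁻¹)) ≟ 0#))

    kernel : ℕ
    kernel = ∑K λ x → χ x ℕ.* 𝟙 (T x ≟ 0#)

    T≟0 : ∀ x → 𝟙 (T x ≟ 0#) ≡ 𝟙 (T x ≟ ι F.0#)
    T≟0 x = 𝟙-cong (T x ≟ 0#) (T x ≟ ι F.0#) (λ Tx≡0 → trans Tx≡0 (sym ι-0)) (λ Tx≡ι0 → trans Tx≡ι0 ι-0)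

    ∑-T≟0 : ∑K (λ x → 𝟙 (T x ≟ 0#)) ≡ d
    ∑-T≟0 = trans (∑-cong K↔ T≟0) (T-fiber F.0#)

    kernel+1 : kernel ℕ.+ 1 ≡ d
    kernel+1 = trans (cong (kernel ℕ.+_) (sym (𝟙-yes (T 0# ≟ 0#) (Tr-0 (suc n′)))))
      (trans (∑-punctured (λ x → 𝟙 (T x ≟ 0#))) ∑-T≟0)

    -- Each of the d - 1 nonzero s of trace 0 admits d - 1 values of p, because p ↦ α s / p permutes
    -- the nonzero elements. For s = 0 all q d - 1 nonzero p count. The total is (d - 1)² + q d - 1.
    ∑-weight : α ≢ 0# → ∑K (λ s → ∑K (λ p → weight s p)) ℕ.+ 2 ℕ.* d ≡ d ℕ.* d ℕ.+ q ℕ.* d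
    ∑-weight α≢0 = begin
      ∑K (λ s → ∑K (λ p → weight s p)) ℕ.+ 2 ℕ.* d  ≡⟨ cong (ℕ._+ 2 ℕ.* d) (∑-cong K↔ inner) ⟩
      ∑K (λ s → 𝟙 (T s ≟ 0#) ℕ.* I s) ℕ.+ 2 ℕ.* d  ≡⟨ cong (ℕ._+ 2 ℕ.* d) (sym (∑-punctured (λ s → 𝟙 (T s ≟ 0#) ℕ.* I s))) ⟩
      ∑K (λ s → χ s ℕ.* (𝟙 (T s ≟ 0#) ℕ.* I s)) ℕ.+ 𝟙 (T 0# ≟ 0#) ℕ.* I 0# ℕ.+ 2 ℕ.* d
        ≡⟨ cong₂ (λ u v → u ℕ.+ v ℕ.+ 2 ℕ.* d) (trans (∑-cong K↔ I≢0) (sym (∑-*ʳ K↔ kernel (λ s → χ s ℕ.* 𝟙 (T s ≟ 0#)))))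
          (trans (cong (ℕ._* I 0#) (𝟙-yes (T 0# ≟ 0#) (Tr-0 (suc n′)))) (ℕ.*-identityˡ (I 0#))) ⟩
      kernel ℕ.* kernel ℕ.+ I 0# ℕ.+ 2 ℕ.* d  ≡⟨ cong (λ y → kernel ℕ.* kernel ℕ.+ I 0# ℕ.+ 2 ℕ.* y) (sym kernel+1) ⟩
      kernel ℕ.* kernel ℕ.+ I 0# ℕ.+ 2 ℕ.* (kernel ℕ.+ 1)  ≡⟨ complete-square kernel (I 0#) ⟩
      (kernel ℕ.+ 1) ℕ.* (kernel ℕ.+ 1) ℕ.+ (I 0# ℕ.+ 1)  ≡⟨ cong₂ (λ u v → u ℕ.* u ℕ.+ v) kernel+1 I0+1 ⟩
      d ℕ.* d ℕ.+ q ℕ.* d  ∎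
      where
      open ≡-Reasoning
      I : Carrier → ℕ
      I s = ∑K λ p → χ p ℕ.* 𝟙 (T (α * (s * p ⁻¹)) ≟ 0#)
      complete-square : ∀ k i → k ℕ.* k ℕ.+ i ℕ.+ 2 ℕ.* (k ℕ.+ 1) ≡ (k ℕ.+ 1) ℕ.* (k ℕ.+ 1) ℕ.+ (i ℕ.+ 1)
      complete-square = solve-∀
      exchange : ∀ x y z → x ℕ.* (y ℕ.* z) ≡ y ℕ.* (x ℕ.* z)
      exchange = solve-∀
      inner : ∀ s → ∑K (λ p → weight s p) ≡ 𝟙 (T s ≟ 0#) ℕ.* I s
      inner s = trans (∑-cong K↔ λ p → exchange (χ p) (𝟙 (T s ≟ 0#)) (𝟙 (T (α * (s * p ⁻¹)) ≟ 0#)))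
        (sym (∑-*ˡ K↔ (𝟙 (T s ≟ 0#)) (λ p → χ p ℕ.* 𝟙 (T (α * (s * p ⁻¹)) ≟ 0#))))
      I≢0 : ∀ s → χ s ℕ.* (𝟙 (T s ≟ 0#) ℕ.* I s) ≡ χ s ℕ.* 𝟙 (T s ≟ 0#) ℕ.* kernel
      I≢0 s with s ≟ 0#
      ... | yes _ = refl
      ... | no s≢0 = trans (ℕ.+-identityʳ _) (cong₂ ℕ._*_ (sym (ℕ.+-identityʳ (𝟙 (T s ≟ 0#))))
        (trans (∑-cong K↔ λ p → cong (λ y → χ p ℕ.* 𝟙 (T y ≟ 0#)) (sym (*-assoc α s (p ⁻¹))))
          (∑-divide (*-≢0 α≢0 s≢0) (λ x → 𝟙 (T x ≟ 0#)))))
      I0+1 : I 0# ℕ.+ 1 ≡ q ℕ.* d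
      I0+1 = begin
        I 0# ℕ.+ 1  ≡⟨ cong (ℕ._+ 1) (∑-cong K↔ λ p → cong (χ p ℕ.*_)
          (𝟙-yes (T (α * (0# * p ⁻¹)) ≟ 0#) (trans (cong T (trans (cong (α *_) (zeroˡ _)) (zeroʳ α))) (Tr-0 (suc n′))))) ⟩
        ∑K (λ p → χ p ℕ.* 1) ℕ.+ 1  ≡⟨ ∑-punctured (λ _ → 1) ⟩
        ∑K (λ _ → 1)  ≡⟨ trans (∑-const K↔ 1) (ℕ.*-identityʳ _) ⟩
        q ℕ.* d  ∎

-- The quadratic extension

×-size : HasSize A m → HasSize B n → HasSize (A × B) (m ℕ.* n)
×-size {m = m} {n = n} e e′ = mk↔ₛ′
  (λ (x , y) → Fin.combine (to e x) (to e′ y))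
  (λ i → from e (proj₁ (Fin.remQuot {m} n i)) , from e′ (proj₂ (Fin.remQuot {m} n i)))
  (λ i → trans (cong₂ Fin.combine (strictlyInverseˡ e _) (strictlyInverseˡ e′ _)) (Fin.combine-remQuot {m} n i))
  (λ (x , y) → trans (cong (λ (i , j) → from e i , from e′ j) (Fin.remQuot-combine (to e x) (to e′ y)))
                     (cong₂ _,_ (strictlyInverseʳ e x) (strictlyInverseʳ e′ y)))
  where open Inverse

module ArtinSchreier (K : Field) {size : ℕ} (K↔ : HasSize (Field.Carrier K) size) where
  open FiniteField K K↔

  -- u ↦ u² - u takes the value 0 at both 0 and 1, so it cannot be onto.
  irreducible : ∃ λ c → ∀ u → u * u - u ≢ c
  irreducible with any? K↔ (λ c → ¬? (any? K↔ (λ u → u * u - u ≟ c)))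
  ... | yes (c , ∄u) = c , λ u u²-u≡c → ∄u (u , u²-u≡c)
  ... | no surjective = contradiction too-many (ℕ.<-irrefl refl)
    where
    fibre : Carrier → ℕ
    fibre c = ∑ K↔ (λ u → 𝟙 (u * u - u ≟ c))
    1≤fibre : ∀ c → 1 ℕ.≤ fibre c
    1≤fibre c with any? K↔ (λ u → u * u - u ≟ c)
    ... | no ∄u = contradiction (c , ∄u) surjective
    ... | yes (u , p) = ℕ.≤-trans (ℕ.≤-reflexive (sym (𝟙-yes (u * u - u ≟ c) p))) (∑-term K↔ (λ u → 𝟙 (u * u - u ≟ c)) u)
    fibre≥ : ∀ c → 1 ℕ.+ 𝟙 (c ≟ 0#) ℕ.* 1 ℕ.≤ fibre c
    fibre≥ c with c ≟ 0#
    ... | no _ = 1≤fibre c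
    ... | yes refl = begin
      2  ≡⟨ sym (cong₂ ℕ._+_ (∑-δ K↔ 0# (_≟ 0#) (λ _ → 1)) (∑-δ K↔ 1# (_≟ 1#) (λ _ → 1))) ⟩
      ∑ K↔ (λ u → 𝟙 (u ≟ 0#) ℕ.* 1) ℕ.+ ∑ K↔ (λ u → 𝟙 (u ≟ 1#) ℕ.* 1)
        ≡⟨ sym (∑-+ K↔ (λ u → 𝟙 (u ≟ 0#) ℕ.* 1) (λ u → 𝟙 (u ≟ 1#) ℕ.* 1)) ⟩
      ∑ K↔ (λ u → 𝟙 (u ≟ 0#) ℕ.* 1 ℕ.+ 𝟙 (u ≟ 1#) ℕ.* 1)  ≤⟨ ∑-mono K↔ pointwise ⟩
      fibre 0#  ∎
      where
      open ℕ.≤-Reasoning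
      pointwise : ∀ u → 𝟙 (u ≟ 0#) ℕ.* 1 ℕ.+ 𝟙 (u ≟ 1#) ℕ.* 1 ℕ.≤ 𝟙 (u * u - u ≟ 0#)
      pointwise u with u ≟ 0# | u ≟ 1#
      ... | yes u≡0 | yes u≡1 = contradiction (trans (sym u≡1) u≡0) 1≢0
      ... | yes refl | no _ = ℕ.≤-reflexive (sym (𝟙-yes (0# * 0# - 0# ≟ 0#)
        (trans (cong (_- 0#) (zeroˡ 0#)) (-‿inverseʳ 0#))))
      ... | no _ | yes refl = ℕ.≤-reflexive (sym (𝟙-yes (1# * 1# - 1# ≟ 0#)
        (trans (cong (_- 1#) (*-identityˡ 1#)) (-‿inverseʳ 1#))))
      ... | no _ | no _ = z≤n
    too-many : size ℕ.< size
    too-many = begin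
      1 ℕ.+ size  ≡⟨ ℕ.+-comm 1 size ⟩
      size ℕ.+ 1  ≡⟨ sym (cong₂ ℕ._+_ (trans (∑-const K↔ 1) (ℕ.*-identityʳ size)) (∑-δ K↔ 0# (_≟ 0#) (λ _ → 1))) ⟩
      ∑ K↔ (λ _ → 1) ℕ.+ ∑ K↔ (λ c → 𝟙 (c ≟ 0#) ℕ.* 1) ≡⟨ sym (∑-+ K↔ (λ _ → 1) (λ c → 𝟙 (c ≟ 0#) ℕ.* 1)) ⟩
      ∑ K↔ (λ c → 1 ℕ.+ 𝟙 (c ≟ 0#) ℕ.* 1)  ≤⟨ ∑-mono K↔ fibre≥ ⟩
      ∑ K↔ fibre  ≡⟨ ∑-swap K↔ K↔ (λ c u → 𝟙 (u * u - u ≟ c)) ⟩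
      ∑ K↔ (λ u → ∑ K↔ (λ c → 𝟙 (u * u - u ≟ c)))  ≡⟨ ∑-cong K↔ (λ u → ∑-unique K↔ (u * u - u ≟_) (u * u - u) refl sym) ⟩
      ∑ K↔ (λ _ → 1)  ≡⟨ trans (∑-const K↔ 1) (ℕ.*-identityʳ size) ⟩
      size  ∎
      where open ℕ.≤-Reasoning

-- The form X² - X - c, rather than X² - c, works in every characteristic: in characteristic 2 a
-- finite field has no nonsquares, whereas `irreducible` always supplies a suitable c.
module QuadraticExtension (K : Field) {size : ℕ} (K↔ : HasSize (Field.Carrier K) size)
  (c : Field.Carrier K)
  (irr : ∀ u → FieldProperties._-_ K (Field._*_ K u u) u ≢ c) where
  open FiniteField K K↔

  -- (u , v) stands for u + v θ with θ² = θ + c.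
  Pair : Set
  Pair = Carrier × Carrier

  norm trace : Pair → Carrier
  norm (u , v) = u * u + u * v - c * (v * v)
  trace (u , v) = u + u + v

  -- This sends θ to 1 - θ, the other root of X² - X - c.
  conj : Pair → Pair
  conj (u , v) = u + v , - v

  κ : Carrier → Pair
  κ u = u , 0#

  θ : Pair
  θ = 0# , 1#

  private
    _⊕_ _⊗_ : Pair → Pair → Pair
    (u , v) ⊕ (u′ , v′) = u + u′ , v + v′
    (u , v) ⊗ (u′ , v′) = u * u′ + c * (v * v′) , u * v′ + v * u′ + v * v′

    ⊖_ : Pair → Pair
    ⊖ (u , v) = - u , - v

    ⊗-comm : ∀ x y → x ⊗ y ≡ y ⊗ x
    ⊗-comm (u , v) (u′ , v′) = cong₂ _,_
      (solve 5 (λ c u v x y → u :* x :+ c :* (v :* y) := x :* u :+ c :* (y :* v)) refl c u v u′ v′)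
      (solve 4 (λ u v x y → u :* y :+ v :* x :+ v :* y := x :* v :+ y :* u :+ y :* v) refl u v u′ v′)

    ⊗-assoc : ∀ x y z → (x ⊗ y) ⊗ z ≡ x ⊗ (y ⊗ z)
    ⊗-assoc (u , v) (u′ , v′) (u″ , v″) = cong₂ _,_
      (solve 7 (λ c a b d e f g → (a :* d :+ c :* (b :* e)) :* f :+ c :* ((a :* e :+ b :* d :+ b :* e) :* g)
         := a :* (d :* f :+ c :* (e :* g)) :+ c :* (b :* (d :* g :+ e :* f :+ e :* g))) refl c u v u′ v′ u″ v″)
      (solve 7 (λ c a b d e f g → (a :* d :+ c :* (b :* e)) :* g :+ (a :* e :+ b :* d :+ b :* e) :* f :+
        (a :* e :+ b :* d :+ b :* e) :* g
         := a :* (d :* g :+ e :* f :+ e :* g) :+ b :* (d :* f :+ c :* (e :* g)) :+ b :* (d :* g :+ e :* f :+ e :* g)) refl c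
           u v u′ v′ u″ v″)

    ⊗-identityˡ : ∀ x → κ 1# ⊗ x ≡ x
    ⊗-identityˡ (u , v) = cong₂ _,_
      (trans (solve 4 (λ c o u v → o :* u :+ c :* (con (ℤ.+ 0) :* v) := o :* u) refl c 1# u v) (*-identityˡ u))
      (trans (solve 3 (λ o u v → o :* v :+ con (ℤ.+ 0) :* u :+ con (ℤ.+ 0) :* v := o :* v) refl 1# u v) (*-identityˡ v))

    ⊗-distribˡ : ∀ x y z → x ⊗ (y ⊕ z) ≡ (x ⊗ y) ⊕ (x ⊗ z)
    ⊗-distribˡ (u , v) (u′ , v′) (u″ , v″) = cong₂ _,_
      (solve 7 (λ c a b d e f g → a :* (d :+ f) :+ c :* (b :* (e :+ g)) := (a :* d :+ c :* (b :* e)) :+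
        (a :* f :+ c :* (b :* g))) refl c u v u′ v′ u″ v″)
      (solve 6 (λ a b d e f g → a :* (e :+ g) :+ b :* (d :+ f) :+ b :* (e :+ g) := (a :* e :+ b :* d :+ b :* e) :+
        (a :* g :+ b :* f :+ b :* g)) refl u v u′ v′ u″ v″)

    ext-isCommutativeRing : IsCommutativeRing _≡_ _⊕_ _⊗_ ⊖_ (κ 0#) (κ 1#)
    ext-isCommutativeRing = record
      { isRing = record
        { +-isAbelianGroup = record
          { isGroup = record
            { isMonoid = record
              { isSemigroup = record
                { isMagma = record { isEquivalence = ≡.isEquivalence ; ∙-cong = cong₂ _⊕_ }
                ; assoc = λ (u , v) (u′ , v′) (u″ , v″) → cong₂ _,_ (+-assoc u u′ u″) (+-assoc v v′ v″) }
              ; identity = (λ (u , v) → cong₂ _,_ (+-identityˡ u) (+-identityˡ v))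
                         , (λ (u , v) → cong₂ _,_ (+-identityʳ u) (+-identityʳ v)) }
            ; inverse = (λ (u , v) → cong₂ _,_ (-‿inverseˡ u) (-‿inverseˡ v))
                      , (λ (u , v) → cong₂ _,_ (-‿inverseʳ u) (-‿inverseʳ v))
            ; ⁻¹-cong = cong ⊖_ }
          ; comm = λ (u , v) (u′ , v′) → cong₂ _,_ (+-comm u u′) (+-comm v v′) }
        ; *-cong = cong₂ _⊗_
        ; *-assoc = ⊗-assoc
        ; *-identity = ⊗-identityˡ , λ x → trans (⊗-comm x (κ 1#)) (⊗-identityˡ x)
        ; distrib = ⊗-distribˡ , λ x y z → trans (⊗-comm (y ⊕ z) x)
          (trans (⊗-distribˡ x y z) (cong₂ _⊕_ (⊗-comm x y) (⊗-comm x z))) }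
      ; *-comm = ⊗-comm }

    conj-norm : ∀ z → z ⊗ conj z ≡ κ (norm z)
    conj-norm (u , v) = cong₂ _,_
      (solve 3 (λ c u v → u :* (u :+ v) :+ c :* (v :* (:- v)) := u :* u :+ u :* v :- c :* (v :* v)) refl c u v)
      (solve 2 (λ u v → u :* (:- v) :+ v :* (u :+ v) :+ v :* (:- v) := con (ℤ.+ 0)) refl u v)

  -- If v ≠ 0 then norm (u , v) = 0 makes - u / v a root of X² - X - c.
  norm≡0 : ∀ z → norm z ≡ 0# → z ≡ κ 0#
  norm≡0 (u , v) N≡0 with v ≟ 0#
  ... | no v≢0 = contradiction (x-y≡0⇒x≡y (begin
      w * w - w - c  ≡⟨ solve 3 (λ w c o → w :* w :- w :- c := w :* w :- w :* o :- c :* (o :* o) :+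
        (w :* o :- w :+ c :* (o :* o) :- c)) refl w c 1# ⟩
      w * w - w * 1# - c * (1# * 1#) + (w * 1# - w + c * (1# * 1#) - c)
        ≡⟨ cong₂ (λ x y → w * w - w * 1# - c * (1# * 1#) + (x - w + y - c)) (*-identityʳ w)
          (trans (cong (c *_) (*-identityʳ 1#)) (*-identityʳ c)) ⟩
      w * w - w * 1# - c * (1# * 1#) + (w - w + c - c)  ≡⟨ solve 3 (λ w c x → x :+ (w :- w :+ c :- c) := x) refl w c _ ⟩
      w * w - w * 1# - c * (1# * 1#)  ≡⟨ cong (λ o → w * w - w * o - c * (o * o)) (sym (*-inverseʳ v≢0)) ⟩
      w * w - w * (v * v⁻) - c * ((v * v⁻) * (v * v⁻))  ≡⟨ solve 4
        (λ c u v v⁻ → (:- u :* v⁻) :* (:- u :* v⁻) :- (:- u :* v⁻) :* (v :* v⁻) :- c :* ((v :* v⁻) :* (v :* v⁻)) :=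
        (v⁻ :* v⁻) :* (u :* u :+ u :* v :- c :* (v :* v))) refl c u v v⁻ ⟩
      (v⁻ * v⁻) * (u * u + u * v - c * (v * v))  ≡⟨ cong ((v⁻ * v⁻) *_) N≡0 ⟩
      (v⁻ * v⁻) * 0#  ≡⟨ zeroʳ _ ⟩
      0#  ∎)) (irr w)
    where
    open ≡-Reasoning
    v⁻ = v ⁻¹
    w = - u * v⁻
  ... | yes refl with u ≟ 0#
  ...   | yes refl = refl
  ...   | no u≢0 = contradiction (trans (solve 2 (λ c u → u :* u := u :* u :+ u :* con (ℤ.+ 0) :- c :*
    (con (ℤ.+ 0) :* con (ℤ.+ 0))) refl c u) N≡0) (*-≢0 u≢0 u≢0)

  private
    invert : ∀ z → z ≢ κ 0# → ∃ λ z′ → z ⊗ z′ ≡ κ 1#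
    invert z z≢0 = conj z ⊗ κ (norm z ⁻¹) , (begin
      z ⊗ (conj z ⊗ κ (norm z ⁻¹))  ≡⟨ sym (⊗-assoc z (conj z) _) ⟩
      (z ⊗ conj z) ⊗ κ (norm z ⁻¹)  ≡⟨ cong (_⊗ κ (norm z ⁻¹)) (conj-norm z) ⟩
      κ (norm z) ⊗ κ (norm z ⁻¹)  ≡⟨ cong₂ _,_ (solve 3 (λ c u v → u :* v :+ c :* (con (ℤ.+ 0) :* con (ℤ.+ 0)) := u :* v)
        refl c (norm z) (norm z ⁻¹)) (solve 2 (λ u v → u :* con (ℤ.+ 0) :+ con (ℤ.+ 0) :* v :+ con (ℤ.+ 0) :* con (ℤ.+ 0) :=
        con (ℤ.+ 0)) refl (norm z) (norm z ⁻¹)) ⟩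
      κ (norm z * norm z ⁻¹)  ≡⟨ cong κ (*-inverseʳ (λ N≡0 → z≢0 (norm≡0 z N≡0))) ⟩
      κ 1#  ∎)
      where open ≡-Reasoning

  E : Field
  E = record
    { commutativeRing = record { isCommutativeRing = ext-isCommutativeRing }
    ; ≈-is-≡ = id
    ; 0≢1 = λ 0≡1 → 1≢0 (sym (cong proj₁ 0≡1))
    ; inverse = invert }

  E↔ : HasSize Pair (size ℕ.* size)
  E↔ = ×-size K↔ K↔

  private
    module E = FiniteField E E↔

  κ-hom : IsRingHom K E κ
  κ-hom = record
    { hom-1 = refl
    ; hom-+ = λ u v → cong (u + v ,_) (sym (+-identityˡ 0#))
    ; hom-* = λ u v → cong₂ _,_
        (solve 3 (λ c u v → u :* v := u :* v :+ c :* (con (ℤ.+ 0) :* con (ℤ.+ 0))) refl c u v)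
        (solve 2 (λ u v → con (ℤ.+ 0) := u :* con (ℤ.+ 0) :+ con (ℤ.+ 0) :* v :+ con (ℤ.+ 0) :* con (ℤ.+ 0)) refl u v) }

  open IsRingHom κ-hom public

  *-conj : ∀ z → z E.* conj z ≡ κ (norm z)
  *-conj = conj-norm

  +-conj : ∀ z → z E.+ conj z ≡ κ (trace z)
  +-conj (u , v) = cong₂ _,_ (sym (+-assoc u u v)) (-‿inverseʳ v)

  trace-κ* : ∀ a z → trace (κ a E.* z) ≡ a * trace z
  trace-κ* a (u , v) = solve 4 (λ a c u v → (a :* u :+ c :* (con (ℤ.+ 0) :* v)) :+ (a :* u :+ c :* (con (ℤ.+ 0) :* v)) :+
    (a :* v :+ con (ℤ.+ 0) :* u :+ con (ℤ.+ 0) :* v) := a :* (u :+ u :+ v)) refl a c u v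

  trace-conj : ∀ z → trace (conj z) ≡ trace z
  trace-conj (u , v) = solve 2 (λ u v → (u :+ v) :+ (u :+ v) :+ (:- v) := u :+ u :+ v) refl u v

  trace-κ : ∀ a → trace (κ a) ≡ a + a
  trace-κ a = +-identityʳ _

  norm-≢0 : ∀ {z} → z ≢ E.0# → norm z ≢ 0#
  norm-≢0 {z} z≢0 N≡0 = z≢0 (norm≡0 z N≡0)

  -- z ↦ z^|K| fixes K, and it cannot fix θ since z^|K| = z has only |K| solutions.
  module _ (1<size : 1 ℕ.< size) (add-size : AdditivePowers.Additive E size) where
    open Polynomials E
    open RootBounds E E↔

    private
      κ-↑ : ∀ a m → κ (a ↑ m) ≡ κ a E.↑ m
      κ-↑ a zero = refl
      κ-↑ a (suc m) = trans (hom-* a _) (cong (κ a E.*_) (κ-↑ a m))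

      decompose : ∀ u v → (u , v) ≡ κ u E.+ κ v E.* θ
      decompose u v = cong₂ _,_
        (solve 4 (λ c u v o → u := u :+ (v :* con (ℤ.+ 0) :+ c :* (con (ℤ.+ 0) :* o))) refl c u v 1#)
        (trans (sym (*-identityʳ v)) (solve 2 (λ v o → v :* o := con (ℤ.+ 0) :+
          (v :* o :+ con (ℤ.+ 0) :* con (ℤ.+ 0) :+ con (ℤ.+ 0) :* o)) refl v 1#))

      frobenius-decompose : ∀ u v → (u , v) E.↑ size ≡ κ u E.+ κ v E.* (θ E.↑ size)
      frobenius-decompose u v = begin
        (u , v) E.↑ size  ≡⟨ cong (E._↑ size) (decompose u v) ⟩
        (κ u E.+ κ v E.* θ) E.↑ size  ≡⟨ add-size _ _ ⟩
        κ u E.↑ size E.+ (κ v E.* θ) E.↑ size  ≡⟨ cong₂ E._+_ (frob-κ u)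
          (trans (E.↑-distrib-* (κ v) θ size) (cong (E._* (θ E.↑ size)) (frob-κ v))) ⟩
        κ u E.+ κ v E.* (θ E.↑ size)  ∎
        where
        open ≡-Reasoning
        frob-κ : ∀ u → κ u E.↑ size ≡ κ u
        frob-κ u = trans (sym (κ-↑ u size)) (cong κ (fermat u))

      θ² : θ E.* θ ≡ θ E.+ κ c
      θ² = cong₂ _,_ (trans (cong (λ o → 0# * 0# + c * o) (*-identityˡ 1#))
        (trans (cong₂ _+_ (zeroˡ 0#) (*-identityʳ c)) refl))
                     (trans (cong₂ (λ x y → x + y + 1# * 1#) (zeroˡ 1#) (zeroʳ 1#))
                       (trans (cong (_+ 1# * 1#) (+-identityˡ 0#))
                       (trans (+-identityˡ _) (trans (*-identityˡ 1#) (sym (+-identityʳ 1#))))))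

      θ′ = θ E.↑ size

      θ′² : θ′ E.* θ′ ≡ θ′ E.+ κ c
      θ′² = trans (sym (E.↑-distrib-* θ θ size)) (trans (cong (E._↑ size) θ²) (trans (add-size θ (κ c))
        (cong (θ′ E.+_) (trans (sym (κ-↑ c size)) (cong κ (fermat c))))))

      θ′≢θ : θ′ ≢ θ
      θ′≢θ θ′≡θ = contradiction (ℕ.*-cancelˡ-≤ size ⦃ ℕ.>-nonZero (ℕ.<⇒≤ 1<size) ⦄
        (ℕ.≤-trans all-roots (ℕ.≤-reflexive (sym (ℕ.*-identityʳ size))))) (ℕ.<⇒≱ 1<size)
        where
        fixed : ∀ z → z E.↑ size ≡ z
        fixed (u , v) = trans (frobenius-decompose u v) (trans (cong (λ t → κ u E.+ κ v E.* t) θ′≡θ) (sym (decompose u v)))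
        all-roots : size ℕ.* size ℕ.≤ size
        all-roots = ℕ.≤-trans (ℕ.≤-reflexive (sym (trans
            (∑-cong E↔ λ z → 𝟙-yes (z E.↑ size E.- z E.≟ E.0#) (E.x≡y⇒x-y≡0 (fixed z)))
            (trans (∑-const E↔ 1) (ℕ.*-identityʳ _)))))
          (monic-roots (poly-neg (poly-weaken 1<size poly-id)) (λ z → refl))

      -- Like θ, the element θ′ satisfies X² = X + c, so (θ′ - θ) (θ′ - (1 - θ)) = 0, and the first
      -- factor is not 0.
      θ′≡conj-θ : θ′ ≡ conj θ
      θ′≡conj-θ = trans (E.x-y≡0⇒x≡y (E.*-cancel-≢0 (λ eq → θ′≢θ (E.x-y≡0⇒x≡y eq)) (begin
        (θ′ E.- θ) E.* (θ′ E.- (E.1# E.- θ))  ≡⟨ E.solve 3 (λ s t o → (s E.:- t) E.:* (s E.:- (o E.:- t)) E.:=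
          (s E.:* s E.:- s E.:* o) E.:- (t E.:* t E.:- t E.:* o)) refl θ′ θ E.1# ⟩
        (θ′ E.* θ′ E.- θ′ E.* E.1#) E.- (θ E.* θ E.- θ E.* E.1#)
          ≡⟨ cong₂ E._-_ (cong₂ E._-_ θ′² (E.*-identityʳ θ′)) (cong₂ E._-_ θ² (E.*-identityʳ θ)) ⟩
        (θ′ E.+ κ c E.- θ′) E.- (θ E.+ κ c E.- θ)  ≡⟨ E.solve 3
          (λ s t c → (s E.:+ c E.:- s) E.:- (t E.:+ c E.:- t) E.:= E.con (ℤ.+ 0)) refl θ′ θ (κ c) ⟩
        E.0#  ∎)))
        (cong₂ _,_ (trans (cong (1# +_) -0#≈0#) (trans (+-identityʳ 1#) (sym (+-identityˡ 1#)))) (+-identityˡ _))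
        where open ≡-Reasoning

    frobenius-conj : ∀ z → z E.↑ size ≡ conj z
    frobenius-conj (u , v) = trans (frobenius-decompose u v) (trans (cong (λ t → κ u E.+ κ v E.* t) θ′≡conj-θ)
      (cong₂ _,_
        (trans (cong₂ (λ x y → u + (v * x + c * y)) (+-identityˡ 1#) (zeroˡ (- 1#)))
           (trans (cong₂ (λ x y → u + (x + y)) (*-identityʳ v) (zeroʳ c)) (cong (u +_) (+-identityʳ v))))
        (trans (solve 2 (λ v o → con (ℤ.+ 0) :+ (v :* (:- o) :+ con (ℤ.+ 0) :* (con (ℤ.+ 0) :+ o) :+ con (ℤ.+ 0) :* (:- o))
          := :- (v :* o)) refl v 1#) (cong (-_) (*-identityʳ v)))))

-- What remains of the construction once the pairs are forgotten. The same interface is used when E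
-- itself is extended in the case q = 3, n = 4.
record Quadratic (K : Field) (size : ℕ) : Set₁ where
  private
    module K = FieldProperties K
  field
    E : Field
    E↔ : HasSize (Field.Carrier E) (size ℕ.* size)
  private
    module E = FieldProperties E
  field
    κ : K.Carrier → E.Carrier
    conj : E.Carrier → E.Carrier
    trace norm : E.Carrier → K.Carrier
    κ-hom : IsRingHom K E κ
    κ-0 : κ K.0# ≡ E.0#
    κ-injective : ∀ {u v} → κ u ≡ κ v → u ≡ v
    κ-sub : ∀ u v → κ (u K.- v) ≡ κ u E.- κ v
    +-conj : ∀ z → z E.+ conj z ≡ κ (trace z)
    *-conj : ∀ z → z E.* conj z ≡ κ (norm z)
    trace-κ : ∀ a → trace (κ a) ≡ a K.+ a
    trace-κ* : ∀ a z → trace (κ a E.* z) ≡ a K.* trace z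
    trace-conj : ∀ z → trace (conj z) ≡ trace z
    norm-≢0 : ∀ {z} → z ≢ E.0# → norm z ≢ K.0#
    frobenius-conj : ∀ z → z E.↑ size ≡ conj z

-- The N-th power of p · 1 is |K| · 1 = 0, and a field has no nilpotent elements other than 0, so p
-- · 1 = 0.
additive-prime-power : ∀ {p} → Prime p → (K : Field) → ∀ N → HasSize (Field.Carrier K) (p ^ N) → AdditivePowers.Additive K p
additive-prime-power {p} pr K N K↔ = additive-char pr p·1≡0
  where
  open AdditivePowers K
  open FiniteField K K↔
  p^k·1 : ∀ k → (p ^ k) · 1# ≡ (p · 1#) ↑ k
  p^k·1 zero = +-identityʳ 1#
  p^k·1 (suc k) = trans (×1-homo-* p (p ^ k)) (cong ((p · 1#) *_) (p^k·1 k))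
  p·1≡0 : p · 1# ≡ 0#
  p·1≡0 with (p · 1#) ≟ 0#
  ... | yes p·1≡0 = p·1≡0
  ... | no p·1≢0 = contradiction (trans (sym (p^k·1 N)) size·1≡0) (↑-≢0 N p·1≢0)

abstract
  quadratic-extension : ∀ {p} → Prime p → (K : Field) → ∀ N → HasSize (Field.Carrier K) (p ^ suc N) → Quadratic K
    (p ^ suc N)
  quadratic-extension {p} pr K N K↔ = record
    { E = Q.E ; E↔ = Q.E↔ ; κ = Q.κ ; conj = Q.conj ; trace = Q.trace ; norm = Q.norm
    ; κ-hom = Q.κ-hom ; κ-0 = refl ; κ-injective = cong proj₁
    ; κ-sub = λ u v → cong (u K.- v ,_) (sym (K.-‿inverseʳ K.0#))
    ; +-conj = Q.+-conj ; *-conj = Q.*-conj ; trace-κ = Q.trace-κ ; trace-κ* = Q.trace-κ*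
    ; trace-conj = Q.trace-conj ; norm-≢0 = Q.norm-≢0
    ; frobenius-conj = Q.frobenius-conj 1<size (AdditivePowers.additive-^ Q.E {p} add-p (suc N)) }
    where
    module K = FiniteField K K↔
    c,irr : ∃ λ c → ∀ u → u K.* u K.- u ≢ c
    c,irr = ArtinSchreier.irreducible K K↔
    module Q = QuadraticExtension K K↔ (proj₁ c,irr) (proj₂ c,irr)
    add-p : AdditivePowers.Additive Q.E p
    add-p = additive-prime-power pr Q.E (suc N ℕ.+ suc N) (subst (HasSize Q.Pair) (sym (ℕ.^-distribˡ-+-* p (suc N) (suc N)))
      Q.E↔)
    1<p : 1 ℕ.< p
    1<p = ℕ.nonTrivial⇒n>1 p ⦃ prime⇒nonTrivial pr ⦄
    1<size : 1 ℕ.< p ^ suc N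
    1<size = ℕ.≤-trans 1<p (ℕ.m≤m*n p (p ^ N) ⦃ ℕ.m^n≢0 p N ⦃ prime⇒nonZero pr ⦄ ⦄)

-- Comparison of K with its quadratic extension

module Lift {F K : Field} {q n′ : ℕ}
  (F↔ : HasSize (Field.Carrier F) q) (K↔ : HasSize (Field.Carrier K) (q ^ suc n′))
  (1<q : 1 ℕ.< q) (add-q : AdditivePowers.Additive K q)
  (ι : Field.Carrier F → Field.Carrier K) (ι-hom : IsRingHom F K ι)
  (L : Quadratic K (q ^ suc n′))
  (add-q-E : AdditivePowers.Additive (Quadratic.E L) q) where

  open Quadratic L
  open IsRingHom κ-hom
  open FiniteField K K↔
  private
    module F = FiniteField F F↔
    module ι = IsRingHom ι-hom

  -- With this form `suc n₂` reduces to `suc n′ ℕ.+ suc n′`, the exponent that `Tr-split` halves.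
  n₂ : ℕ
  n₂ = n′ ℕ.+ suc n′

  E-size : HasSize (Field.Carrier E) (q ^ suc n₂)
  E-size = subst (HasSize (Field.Carrier E)) (sym (ℕ.^-distribˡ-+-* q (suc n′) (suc n′))) E↔

  κι-hom : IsRingHom F E (κ ∘ ι)
  κι-hom = record
    { hom-1 = trans (cong κ ι.hom-1) hom-1
    ; hom-+ = λ a b → trans (cong κ (ι.hom-+ a b)) (hom-+ _ _)
    ; hom-* = λ a b → trans (cong κ (ι.hom-* a b)) (hom-* _ _) }

  private
    module E = FiniteField E E-size
    module CK = Counting {F} {K} {q} {n′} F↔ K↔ 1<q add-q ι ι-hom
  module CE = Counting {F} {E} {q} {n₂} F↔ E-size 1<q add-q-E (κ ∘ ι) κι-hom
  private
    module TrE = Trace E q add-q-E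
    open CK using (T; ∑K; ∑F; χ; d; weight; pairs; N)

    κ-↑ : ∀ a m → κ (a ↑ m) ≡ κ a E.↑ m
    κ-↑ a zero = hom-1
    κ-↑ a (suc m) = trans (hom-* a _) (cong (κ a E.*_) (κ-↑ a m))

    κ-Tr : ∀ k a → TrE.Trace k (κ a) ≡ κ (Tr K q k a)
    κ-Tr zero a = sym κ-0
    κ-Tr (suc k) a = trans (cong₂ E._+_ (κ-Tr k a) (sym (κ-↑ a (q ^ k)))) (sym (hom-+ _ _))

    add-size : AdditivePowers.Additive E (q ^ suc n′)
    add-size = AdditivePowers.additive-^ E {q} add-q-E (suc n′)

  -- Transitivity of the trace. The upper half of the sum of q-powers of z is the lower half formed
  -- for z^|K| = conj z, so both halves combine to the trace of z + conj z.
  TE-trace : ∀ z → CE.T z ≡ κ (T (trace z))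
  TE-trace z = begin
    TrE.Trace (suc n′ ℕ.+ suc n′) z  ≡⟨ TrE.Tr-split (suc n′) (suc n′) z ⟩
    TrE.Trace (suc n′) z E.+ TrE.Trace (suc n′) z E.↑ (q ^ suc n′)
      ≡⟨ cong (TrE.Trace (suc n′) z E.+_) (TrE.Tr-↑ {q ^ suc n′} add-size (suc n′) z) ⟩
    TrE.Trace (suc n′) z E.+ TrE.Trace (suc n′) (z E.↑ (q ^ suc n′))
      ≡⟨ cong (λ w → TrE.Trace (suc n′) z E.+ TrE.Trace (suc n′) w) (frobenius-conj z) ⟩
    TrE.Trace (suc n′) z E.+ TrE.Trace (suc n′) (conj z)  ≡⟨ sym (TrE.Tr-+ (suc n′) z (conj z)) ⟩
    TrE.Trace (suc n′) (z E.+ conj z)  ≡⟨ cong (TrE.Trace (suc n′)) (+-conj z) ⟩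
    TrE.Trace (suc n′) (κ (trace z))  ≡⟨ κ-Tr (suc n′) (trace z) ⟩
    κ (T (trace z))  ∎
    where open ≡-Reasoning

  private
    quadratic-root : ∀ z → z E.* (κ (trace z) E.- z) ≡ κ (norm z)
    quadratic-root z = trans (cong (z E.*_) (trans (cong (E._- z) (sym (+-conj z)))
      (E.solve 2 (λ z w → (z E.:+ w) E.:- z E.:= w) refl z (conj z)))) (*-conj z)

    -- `rootsE` counts the z with characteristic polynomial X² - s X + p over K, so an element of K
    -- enters it only as a double root.
    rootsK rootsE : Carrier → Carrier → ℕ
    rootsK s p = ∑K λ x → 𝟙 (p ≟ x * (s - x))
    rootsE s p = ∑ E-size λ z → 𝟙 (s ≟ trace z) ℕ.* 𝟙 (p ≟ norm z)

    has? : ∀ s p z → Dec (s ≡ trace z × p ≡ norm z)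
    has? s p z = (s ≟ trace z) ×-dec (p ≟ norm z)

    B≡ : ∀ s p → rootsE s p ≡ ∑ E-size (𝟙 ∘ has? s p)
    B≡ s p = ∑-cong E-size λ z → 𝟙-× (s ≟ trace z) (p ≟ norm z)
      where
      𝟙-× : ∀ {P Q : Set} (p : Dec P) (q : Dec Q) → 𝟙 p ℕ.* 𝟙 q ≡ 𝟙 (p ×-dec q)
      𝟙-× (yes _) (yes _) = refl
      𝟙-× (yes _) (no _) = refl
      𝟙-× (no _) _ = refl

    root-equation : ∀ {s p z} → s ≡ trace z × p ≡ norm z → z E.* (κ s E.- z) ≡ κ p
    root-equation {z = z} (refl , refl) = quadratic-root z

    A≤2 : ∀ s p → rootsK s p ℕ.≤ 2
    -- The term `x * (x * 1#)` is `x ↑ 2` unfolded, so that `monic-roots` accepts `refl`.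
    A≤2 s p = ℕ.≤-trans (∑-mono K↔ λ x → 𝟙-mono (p ≟ x * (s - x)) (x * (x * 1#) + (p - s * x) ≟ 0#)
        λ p≡ → trans (cong₂ (λ a b → x * a + (b - s * x)) (*-identityʳ x) p≡)
          (solve 2 (λ s x → x :* x :+ (x :* (s :- x) :- s :* x) := con (ℤ.+ 0)) refl s x))
      (RootBounds.monic-roots K K↔ (poly-sub (poly-weaken (s≤s z≤n) (poly-const p)) (poly-scale s poly-id)) (λ _ → refl))
      where open Polynomials K

    B≤2 : ∀ s p → rootsE s p ℕ.≤ 2
    B≤2 s p = ℕ.≤-trans (ℕ.≤-reflexive (B≡ s p)) (ℕ.≤-trans (∑-mono E-size λ z → 𝟙-mono (has? s p z)
      (z E.* (z E.* E.1#) E.+ (κ p E.- κ s E.* z) E.≟ E.0#)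
        λ h → trans (cong₂ (λ a b → z E.* a E.+ (b E.- κ s E.* z)) (E.*-identityʳ z) (sym (root-equation h)))
          (E.solve 2 (λ s x → x E.:* x E.:+ (x E.:* (s E.:- x) E.:- s E.:* x) E.:= E.con (ℤ.+ 0)) refl (κ s) z))
      (RootBounds.monic-roots E E-size (poly-sub (poly-weaken (s≤s z≤n) (poly-const (κ p))) (poly-scale (κ s) poly-id))
        (λ _ → refl)))
      where open Polynomials E

    -- A quadratic with the roots r and s - r in K has no further root in E: the difference of z (s
    -- - z) and r (s - r) factors.
    roots-in-E : ∀ {s r z} → s ≡ trace z × r * (s - r) ≡ norm z → (z E.- κ r) E.* (z E.- κ (s - r)) ≡ E.0#
    roots-in-E {s} {r} {z} h = begin
      (z E.- κ r) E.* (z E.- κ (s - r))  ≡⟨ cong (λ w → (z E.- κ r) E.* (z E.- w)) (κ-sub s r) ⟩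
      (z E.- κ r) E.* (z E.- (κ s E.- κ r))  ≡⟨ E.solve 3 (λ z r s → (z E.:- r) E.:* (z E.:- (s E.:- r)) E.:= r E.:*
        (s E.:- r) E.:- z E.:* (s E.:- z)) refl z (κ r) (κ s) ⟩
      κ r E.* (κ s E.- κ r) E.- z E.* (κ s E.- z)  ≡⟨ cong₂ E._-_
        (trans (cong (κ r E.*_) (sym (κ-sub s r))) (sym (hom-* r (s - r)))) (root-equation h) ⟩
      κ (r * (s - r)) E.- κ (r * (s - r))  ≡⟨ E.-‿inverseʳ _ ⟩
      E.0#  ∎
      where open ≡-Reasoning

    -- The polynomial X² - s X + p has two roots in K, or two conjugate ones in E, or a double one in K.
    roots : ∀ s p → rootsK s p ℕ.+ rootsE s p ℕ.≤ 2
    roots s p with any? K↔ (λ x → p ≟ x * (s - x))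
    ... | no ∄x = ℕ.+-mono-≤ (ℕ.≤-reflexive (∑-empty K↔ (λ x → p ≟ x * (s - x)) λ x eq → ∄x (x , eq))) (B≤2 s p)
    ... | yes (r , refl) with s - r ≟ r
    ...   | yes s-r≡r = ℕ.+-mono-≤
      (∑-atMostOne K↔ (λ x → r * (s - r) ≟ x * (s - x)) λ p p′ → trans (double p) (sym (double p′)))
      (ℕ.≤-trans (ℕ.≤-reflexive (B≡ s (r * (s - r)))) (∑-atMostOne E-size (has? s (r * (s - r))) λ p p′ → trans (double-E p)
        (sym (double-E p′))))
      where
      double : ∀ {x} → r * (s - r) ≡ x * (s - x) → x ≡ r
      double {x} eq with x ≟ r
      ... | yes x≡r = x≡r
      ... | no x≢r = x-y≡0⇒x≡y (*-cancel-≢0 (λ x-r≡0 → x≢r (x-y≡0⇒x≡y x-r≡0)) (begin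
        (x - r) * (x - r)  ≡⟨ cong (λ t → (x - r) * (x - t)) (sym s-r≡r) ⟩
        (x - r) * (x - (s - r))  ≡⟨ solve 3 (λ x r s → (x :- r) :* (x :- (s :- r)) := r :* (s :- r) :- x :* (s :- x)) refl x
          r s ⟩
        r * (s - r) - x * (s - x)  ≡⟨ x≡y⇒x-y≡0 eq ⟩
        0#  ∎))
        where open ≡-Reasoning
      double-E : ∀ {z} → s ≡ trace z × r * (s - r) ≡ norm z → z ≡ κ r
      double-E {z} h with z E.≟ κ r
      ... | yes z≡r = z≡r
      ... | no z≢r = E.x-y≡0⇒x≡y (E.*-cancel-≢0 (λ z-r≡0 → z≢r (E.x-y≡0⇒x≡y z-r≡0))
        (trans (cong (λ t → (z E.- κ r) E.* (z E.- κ t)) (sym s-r≡r)) (roots-in-E h)))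
    ...   | no s-r≢r = ℕ.+-mono-≤ (A≤2 s (r * (s - r))) (ℕ.≤-reflexive
      (trans (B≡ s (r * (s - r))) (∑-empty E-size (has? s (r * (s - r))) none)))
      where
      none : ∀ z → ¬ (s ≡ trace z × r * (s - r) ≡ norm z)
      none z h with z E.≟ κ r
      ... | yes refl = s-r≢r (trans (cong (_- r) (trans (proj₁ h) (trace-κ r))) (solve 1 (λ r → r :+ r :- r := r) refl r))
      ... | no z≢r = s-r≢r (begin
        s - r  ≡⟨ solve 2 (λ s r → s :- r := ((s :- r) :+ (s :- r)) :- s :+ r) refl s r ⟩
        (s - r) + (s - r) - s + r  ≡⟨ cong (λ t → t - s + r)
          (sym (trans (proj₁ h) (trans (cong trace z≡) (trace-κ (s - r))))) ⟩
        s - s + r  ≡⟨ trans (cong (_+ r) (-‿inverseʳ s)) (+-identityˡ r) ⟩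
        r  ∎)
        where
        open ≡-Reasoning
        z≡ : z ≡ κ (s - r)
        z≡ = E.x-y≡0⇒x≡y (E.*-cancel-≢0 (λ z-r≡0 → z≢r (E.x-y≡0⇒x≡y z-r≡0)) (roots-in-E h))

  *-norm⁻¹-conj : ∀ {z} → z ≢ E.0# → z E.* (κ (norm z ⁻¹) E.* conj z) ≡ E.1#
  *-norm⁻¹-conj {z} z≢0 = begin
    z E.* (κ (norm z ⁻¹) E.* conj z)  ≡⟨ E.solve 3 (λ z n w → z E.:* (n E.:* w) E.:= (z E.:* w) E.:* n) refl z
      (κ (norm z ⁻¹)) (conj z) ⟩
    (z E.* conj z) E.* κ (norm z ⁻¹)  ≡⟨ cong (E._* κ (norm z ⁻¹)) (*-conj z) ⟩
    κ (norm z) E.* κ (norm z ⁻¹)  ≡⟨ sym (hom-* _ _) ⟩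
    κ (norm z * norm z ⁻¹)  ≡⟨ cong κ (*-inverseʳ (norm-≢0 z≢0)) ⟩
    κ 1#  ≡⟨ hom-1 ⟩
    E.1#  ∎
    where open ≡-Reasoning

  module _ {α : Carrier} (α≢0 : α ≢ 0#) where
    private
      w : Carrier → Carrier → ℕ
      w = weight α

      -- Substitute y = x - s and group by p = x (s - x) = - x y; the two trace conditions become
      -- conditions on s and p because α / x - α / y = α s / p. If x or y is 0, then p = 0 and both
      -- sides vanish.
      pairs-weight : pairs α ≡ ∑K (λ s → ∑K (λ p → w s p ℕ.* rootsK s p))
      pairs-weight = begin
        pairs α
          ≡⟨ ∑-cong K↔ (λ x → ∑-cong K↔ (λ y → pointwise x y)) ⟩
        ∑K (λ x → ∑K (λ y → w (x - y) (x * ((x - y) - x))))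
          ≡⟨ ∑-cong K↔ (λ x → sym (∑-reindex K↔ (λ y → x - y) (λ y → x - y) (flip x) (flip x) (λ s → w s (x * (s - x))))) ⟩
        ∑K (λ x → ∑K (λ s → w s (x * (s - x))))
          ≡⟨ ∑-cong K↔ (λ x → ∑-cong K↔ λ s → sym (∑-δ K↔ (x * (s - x)) (_≟ x * (s - x)) (w s))) ⟩
        ∑K (λ x → ∑K (λ s → ∑K (λ p → 𝟙 (p ≟ x * (s - x)) ℕ.* w s p)))
          ≡⟨ trans (∑-swap K↔ K↔ (λ x s → ∑K (λ p → 𝟙 (p ≟ x * (s - x)) ℕ.* w s p)))
            (∑-cong K↔ λ s → ∑-swap K↔ K↔ (λ x p → 𝟙 (p ≟ x * (s - x)) ℕ.* w s p)) ⟩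
        ∑K (λ s → ∑K (λ p → ∑K (λ x → 𝟙 (p ≟ x * (s - x)) ℕ.* w s p)))
          ≡⟨ ∑-cong K↔ (λ s → ∑-cong K↔ (λ p → trans (sym (∑-*ʳ K↔ (w s p) (λ x → 𝟙 (p ≟ x * (s - x)))))
            (ℕ.*-comm (rootsK s p) (w s p)))) ⟩
        ∑K (λ s → ∑K (λ p → w s p ℕ.* rootsK s p)) ∎
        where
        open ≡-Reasoning
        flip : ∀ x y → x - (x - y) ≡ y
        flip = solve 2 (λ x y → x :- (x :- y) := y) refl
        pointwise : ∀ x y → (χ x ℕ.* χ y) ℕ.* (𝟙 (T x ≟ T y) ℕ.* 𝟙 (T (α * x ⁻¹) ≟ T (α * y ⁻¹))) ≡ w (x - y)
          (x * ((x - y) - x))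
        pointwise x y with x ≟ 0# | y ≟ 0#
        ... | yes refl | _ = cong (λ t → t ℕ.* (𝟙 (T (0# - y) ≟ 0#) ℕ.* 𝟙
          (T (α * ((0# - y) * (0# * ((0# - y) - 0#)) ⁻¹)) ≟ 0#)))
          (sym (𝟙-no (¬? (0# * ((0# - y) - 0#) ≟ 0#)) (λ ≢0 → ≢0 (zeroˡ _))))
        ... | no _ | yes refl = cong (λ t → t ℕ.* (𝟙 (T (x - 0#) ≟ 0#) ℕ.* 𝟙
          (T (α * ((x - 0#) * (x * ((x - 0#) - x)) ⁻¹)) ≟ 0#)))
          (sym (𝟙-no (¬? (x * ((x - 0#) - x) ≟ 0#)) (λ ≢0 → ≢0
          (solve 1 (λ x → x :* ((x :- con (ℤ.+ 0)) :- x) := con (ℤ.+ 0)) refl x))))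
        ... | no x≢0 | no y≢0 = cong₂ ℕ._*_
          (sym (𝟙-yes (¬? (x * ((x - y) - x) ≟ 0#)) xy≢0))
          (cong₂ ℕ._*_ (equal-iff-difference (T x) (T y) (T (x - y)) (CKT.Tr-sub (suc n′) x y))
            (equal-iff-difference (T (α * x ⁻¹)) (T (α * y ⁻¹)) _ (trans (cong T fraction) (CKT.Tr-sub (suc n′) _ _))))
          where
          module CKT = Trace K q add-q
          xy≢0 : x * ((x - y) - x) ≢ 0#
          xy≢0 eq = *-≢0 x≢0 y≢0 (trans (solve 2 (λ x y → x :* y := :- (x :* ((x :- y) :- x))) refl x y)
            (trans (cong (-_) eq) -0#≈0#))
          equal-iff-difference : ∀ u v t → t ≡ u - v → 𝟙 (u ≟ v) ≡ 𝟙 (t ≟ 0#)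
          equal-iff-difference u v t t≡ = 𝟙-cong (u ≟ v) (t ≟ 0#) (λ u≡v → trans t≡ (x≡y⇒x-y≡0 u≡v))
            (λ t≡0 → x-y≡0⇒x≡y (trans (sym t≡) t≡0))
          inverse : (x * ((x - y) - x)) ⁻¹ ≡ - (x ⁻¹ * y ⁻¹)
          inverse = sym (*-≡1⇒⁻¹ (trans (solve 4 (λ x y x⁻ y⁻ → (x :* ((x :- y) :- x)) :* (:- (x⁻ :* y⁻)) := (x :* x⁻) :*
            (y :* y⁻)) refl x y (x ⁻¹) (y ⁻¹))
            (trans (cong₂ _*_ (*-inverseʳ x≢0) (*-inverseʳ y≢0)) (*-identityʳ 1#))))
          fraction : α * ((x - y) * (x * ((x - y) - x)) ⁻¹) ≡ α * x ⁻¹ - α * y ⁻¹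
          fraction = begin
            α * ((x - y) * (x * ((x - y) - x)) ⁻¹)  ≡⟨ cong (λ t → α * ((x - y) * t)) inverse ⟩
            α * ((x - y) * - (x ⁻¹ * y ⁻¹))  ≡⟨ solve 5 (λ α x y x⁻ y⁻ → α :* ((x :- y) :* (:- (x⁻ :* y⁻))) := α :*
              (x⁻ :* (y :* y⁻)) :- α :* ((x :* x⁻) :* y⁻)) refl α x y (x ⁻¹) (y ⁻¹) ⟩
            α * (x ⁻¹ * (y * y ⁻¹)) - α * ((x * x ⁻¹) * y ⁻¹)
              ≡⟨ cong₂ (λ s t → α * (x ⁻¹ * s) - α * (t * y ⁻¹)) (*-inverseʳ y≢0) (*-inverseʳ x≢0) ⟩
            α * (x ⁻¹ * 1#) - α * (1# * y ⁻¹)  ≡⟨ cong₂ (λ s t → α * s - α * t) (*-identityʳ _) (*-identityˡ _) ⟩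
            α * x ⁻¹ - α * y ⁻¹  ∎

      -- For z ≠ 0 one has 1 / z = conj z / norm z, so the relative trace of α / z is α s / p with s
      -- and p the trace and norm of z. The condition on z is therefore the weight used over K.
      N-weight : CE.N (κ α) F.0# F.0# ≡ ∑K (λ s → ∑K (λ p → w s p ℕ.* rootsE s p))
      N-weight = begin
        CE.N (κ α) F.0# F.0#
          ≡⟨ ∑-cong E-size pointwise ⟩
        ∑ E-size (λ z → w (trace z) (norm z))
          ≡⟨ ∑-cong E-size (λ z → sym (trans (∑-cong K↔ λ s → ∑-δ K↔ (norm z) (_≟ norm z) (λ p → 𝟙 (s ≟ trace z) ℕ.* w s p))
            (∑-δ K↔ (trace z) (_≟ trace z) (λ s → w s (norm z))))) ⟩
        ∑ E-size (λ z → ∑K (λ s → ∑K (λ p → 𝟙 (p ≟ norm z) ℕ.* (𝟙 (s ≟ trace z) ℕ.* w s p))))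
          ≡⟨ trans (∑-swap E-size K↔ (λ z s → ∑K (λ p → 𝟙 (p ≟ norm z) ℕ.* (𝟙 (s ≟ trace z) ℕ.* w s p))))
            (∑-cong K↔ λ s → ∑-swap E-size K↔ (λ z p → 𝟙 (p ≟ norm z) ℕ.* (𝟙 (s ≟ trace z) ℕ.* w s p))) ⟩
        ∑K (λ s → ∑K (λ p → ∑ E-size (λ z → 𝟙 (p ≟ norm z) ℕ.* (𝟙 (s ≟ trace z) ℕ.* w s p))))
          ≡⟨ ∑-cong K↔ (λ s → ∑-cong K↔ (λ p → trans (∑-cong E-size λ z → shuffle (𝟙 (p ≟ norm z)) (𝟙 (s ≟ trace z))
            (w s p)) (sym (∑-*ˡ E-size (w s p) (λ z → 𝟙 (s ≟ trace z) ℕ.* 𝟙 (p ≟ norm z)))))) ⟩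
        ∑K (λ s → ∑K (λ p → w s p ℕ.* rootsE s p)) ∎
        where
        open ≡-Reasoning
        shuffle : ∀ a b c → a ℕ.* (b ℕ.* c) ≡ c ℕ.* (b ℕ.* a)
        shuffle = solve-∀
        κι0 : κ (ι F.0#) ≡ κ 0#
        κι0 = cong κ (Subfield.ι-0 F↔ K↔ 1<q ι ι-hom)
        zero-test : ∀ {z t} → z ≡ κ t → 𝟙 (z E.≟ κ (ι F.0#)) ≡ 𝟙 (t ≟ 0#)
        zero-test {z} {t} z≡κt = 𝟙-cong (z E.≟ κ (ι F.0#)) (t ≟ 0#)
          (λ z≡0 → κ-injective (trans (sym z≡κt) (trans z≡0 κι0)))
          (λ t≡0 → trans z≡κt (trans (cong κ t≡0) (sym κι0)))
        pointwise : ∀ z → CE.χ z ℕ.* (𝟙 (CE.T z E.≟ κ (ι F.0#)) ℕ.* 𝟙 (CE.T (κ α E.* z E.⁻¹) E.≟ κ (ι F.0#))) ≡ w (trace z)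
          (norm z)
        pointwise z with z E.≟ E.0#
        ... | yes z≡0 = sym (cong (ℕ._* (𝟙 (T (trace z) ≟ 0#) ℕ.* 𝟙 (T (α * (trace z * norm z ⁻¹)) ≟ 0#)))
          (𝟙-no (¬? (norm z ≟ 0#)) (λ N≢0 → N≢0 (κ-injective
            (trans (sym (*-conj z)) (trans (cong (E._* conj z) z≡0) (trans (E.zeroˡ _) (sym κ-0))))))))
        ... | no z≢0 = cong₂ ℕ._*_ (sym (𝟙-yes (¬? (norm z ≟ 0#)) (norm-≢0 z≢0)))
          (cong₂ ℕ._*_ (zero-test (TE-trace z)) (zero-test (trans (TE-trace (κ α E.* z E.⁻¹)) (cong (κ ∘ T) quotient))))
          where
          quotient : trace (κ α E.* z E.⁻¹) ≡ α * (trace z * norm z ⁻¹)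
          quotient = begin
            trace (κ α E.* z E.⁻¹)  ≡⟨ cong (λ t → trace (κ α E.* t)) (sym (E.*-≡1⇒⁻¹ (*-norm⁻¹-conj z≢0))) ⟩
            trace (κ α E.* (κ (norm z ⁻¹) E.* conj z))  ≡⟨ trans (trace-κ* α (κ (norm z ⁻¹) E.* conj z))
              (cong (α *_) (trace-κ* (norm z ⁻¹) (conj z))) ⟩
            α * (norm z ⁻¹ * trace (conj z))  ≡⟨ cong (α *_) (trans (cong (norm z ⁻¹ *_) (trace-conj z)) (*-comm _ _)) ⟩
            α * (trace z * norm z ⁻¹)  ∎

    -- Both Σ N² and the count over E are about d² on average. Hence a lower bound for the latter
    -- leaves Σ N² only the error of that bound, plus 2 q d, above its least possible value.
    ∑N²+N-E : ∑F (λ a → ∑F (λ b → N α a b ℕ.* N α a b)) ℕ.+ CE.N (κ α) F.0# F.0# ℕ.+ 4 ℕ.* d ℕ.≤ 2 ℕ.* (d ℕ.* d ℕ.+ q ℕ.* d)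
    ∑N²+N-E = begin
      ∑F (λ a → ∑F (λ b → N α a b ℕ.* N α a b)) ℕ.+ CE.N (κ α) F.0# F.0# ℕ.+ 4 ℕ.* d
        ≤⟨ ℕ.+-monoˡ-≤ (4 ℕ.* d) (ℕ.+-monoˡ-≤ (CE.N (κ α) F.0# F.0#) (CK.∑N² α)) ⟩
      pairs α ℕ.+ CE.N (κ α) F.0# F.0# ℕ.+ 4 ℕ.* d
        ≡⟨ cong (ℕ._+ 4 ℕ.* d) (cong₂ ℕ._+_ pairs-weight N-weight) ⟩
      ∑K (λ s → ∑K (λ p → w s p ℕ.* rootsK s p)) ℕ.+ ∑K (λ s → ∑K (λ p → w s p ℕ.* rootsE s p)) ℕ.+ 4 ℕ.* d
        ≡⟨ cong (ℕ._+ 4 ℕ.* d)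
          (sym (trans (∑-cong K↔ λ s → trans (∑-cong K↔ λ p → ℕ.*-distribˡ-+ (w s p) (rootsK s p) (rootsE s p))
          (∑-+ K↔ (λ p → w s p ℕ.* rootsK s p) (λ p → w s p ℕ.* rootsE s p)))
              (∑-+ K↔ (λ s → ∑K (λ p → w s p ℕ.* rootsK s p)) (λ s → ∑K (λ p → w s p ℕ.* rootsE s p))))) ⟩
      ∑K (λ s → ∑K (λ p → w s p ℕ.* (rootsK s p ℕ.+ rootsE s p))) ℕ.+ 4 ℕ.* d
        ≤⟨ ℕ.+-monoˡ-≤ (4 ℕ.* d) (∑-mono K↔ λ s → ∑-mono K↔ λ p → ℕ.*-monoʳ-≤ (w s p) (roots s p)) ⟩
      ∑K (λ s → ∑K (λ p → w s p ℕ.* 2)) ℕ.+ 4 ℕ.* d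
        ≡⟨ cong (ℕ._+ 4 ℕ.* d) (sym (trans (∑-*ʳ K↔ 2 (λ s → ∑K (w s))) (∑-cong K↔ λ s → ∑-*ʳ K↔ 2 (w s)))) ⟩
      ∑K (λ s → ∑K (w s)) ℕ.* 2 ℕ.+ 4 ℕ.* d
        ≡⟨ regroup (∑K (λ s → ∑K (w s))) d ⟩
      2 ℕ.* (∑K (λ s → ∑K (w s)) ℕ.+ 2 ℕ.* d)
        ≡⟨ cong (2 ℕ.*_) (CK.∑-weight α α≢0) ⟩
      2 ℕ.* (d ℕ.* d ℕ.+ q ℕ.* d) ∎
      where
      open ℕ.≤-Reasoning
      regroup : ∀ w d → w ℕ.* 2 ℕ.+ 4 ℕ.* d ≡ 2 ℕ.* (w ℕ.+ 2 ℕ.* d)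
      regroup = solve-∀

-- Homogeneous linear systems

module LinearSystems (K : Field) {size : ℕ} (K↔ : HasSize (Field.Carrier K) size) where
  open FiniteField K K↔

  Row : ℕ → Set
  Row U = Fin U → Carrier

  infix 8 _∙_
  _∙_ : ∀ {U} → Row U → Row U → Carrier
  c ∙ r = ∑ᴷ.sum (λ i → c i * r i)

  ∙-sub : ∀ {U} (c r s : Row U) k → c ∙ (λ i → r i - k * s i) ≡ c ∙ r - k * c ∙ s
  ∙-sub {zero} c r s k = sym (trans (cong (λ y → 0# - y) (zeroʳ k)) (-‿inverseʳ 0#))
  ∙-sub {suc U} c r s k = trans (cong (c zero * (r zero - k * s zero) +_) (∙-sub (c ∘ suc) (r ∘ suc) (s ∘ suc) k))
    (solve 6 (λ c r s k x y → c :* (r :- k :* s) :+ (x :- k :* y) := (c :* r :+ x) :- k :* (c :* s :+ y)) refl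
      (c zero) (r zero) (s zero) k _ _)

  0∙ : ∀ {U} (r : Row U) → (λ _ → 0#) ∙ r ≡ 0#
  0∙ {U} r = trans (∑ᴷ.sum-cong-≋ λ i → zeroˡ (r i)) (∑ᴷ.sum-replicate-zero U)

  -- `reassemble` stands in for a permutation between `L` and `pivot ∷ rest`: solutions only need
  -- `All` to be carried back.
  record Pivot {U} (L : List (Row (suc U))) : Set₁ where
    field
      pivot : Row (suc U)
      rest : List (Row (suc U))
      pivot≢0 : pivot zero ≢ 0#
      length-rest : length L ≡ suc (length rest)
      reassemble : ∀ {P : Row (suc U) → Set} → P pivot → All P rest → All P L

  findPivot : ∀ {U} (L : List (Row (suc U))) → All (λ r → r zero ≡ 0#) L ⊎ Pivot L
  findPivot [] = inj₁ []
  findPivot (r ∷ L) with r zero ≟ 0#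
  ... | no r≢0 = inj₂ record { pivot = r ; rest = L ; pivot≢0 = r≢0 ; length-rest = refl ; reassemble = _∷_ }
  ... | yes r≡0 with findPivot L
  ...   | inj₁ L≡0 = inj₁ (r≡0 ∷ L≡0)
  ...   | inj₂ p = inj₂ record
    { pivot = pivot ; rest = r ∷ rest ; pivot≢0 = pivot≢0 ; length-rest = cong suc length-rest
    ; reassemble = λ { Pp (Pr ∷ PL) → Pr ∷ reassemble Pp PL } }
    where open Pivot p

  -- Gaussian elimination: a pivot removes one equation and one unknown, and its own equation then
  -- fixes the first unknown. Without a pivot, the first unit vector solves the system.
  nontrivial-solution : ∀ {U} (L : List (Row U)) → length L ℕ.< U →
                        ∃ λ (c : Row U) → (∃ λ i → c i ≢ 0#) × All (λ r → c ∙ r ≡ 0#) L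
  nontrivial-solution {suc U} L L<U with findPivot L
  ... | inj₁ L≡0 = c , (zero , 1≢0) , All.map (λ {r} r≡0 → trans (cong₂ _+_ (trans (*-identityˡ _) r≡0) (0∙ (r ∘ suc)))
    (+-identityˡ 0#)) L≡0
    where
    c : Row (suc U)
    c zero = 1#
    c (suc _) = 0#
  ... | inj₂ p with nontrivial-solution (map eliminate rest)
    (subst (ℕ._< U) (sym (List.length-map eliminate rest)) (ℕ.≤-pred (subst (ℕ._< suc U) length-rest L<U)))
    where
    open Pivot p
    eliminate : Row (suc U) → Row U
    eliminate r i = r (suc i) - (r zero * pivot zero ⁻¹) * pivot (suc i)
  ...   | c′ , (i , c′i≢0) , solution = c , (suc i , c′i≢0) ,
      reassemble pivot-solved (All.map (λ {r} → rest-solved r) (All.map⁻ solution))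
    where
    open Pivot p
    open ≡-Reasoning
    s = c′ ∙ (pivot ∘ suc)
    c : Row (suc U)
    c zero = - (pivot zero ⁻¹ * s)
    c (suc i) = c′ i
    pivot-solved : c ∙ pivot ≡ 0#
    pivot-solved = begin
      - (pivot zero ⁻¹ * s) * pivot zero + s  ≡⟨ solve 3 (λ v p s → :- (v :* s) :* p :+ s := s :- (p :* v) :* s) refl
        (pivot zero ⁻¹) (pivot zero) s ⟩
      s - (pivot zero * pivot zero ⁻¹) * s  ≡⟨ cong (λ y → s - y * s) (*-inverseʳ pivot≢0) ⟩
      s - 1# * s  ≡⟨ cong (λ y → s - y) (*-identityˡ s) ⟩
      s - s  ≡⟨ -‿inverseʳ s ⟩
      0#  ∎
    rest-solved : ∀ r → c′ ∙ (λ i → r (suc i) - (r zero * pivot zero ⁻¹) * pivot (suc i)) ≡ 0# → c ∙ r ≡ 0#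
    rest-solved r eq = begin
      - (pivot zero ⁻¹ * s) * r zero + c′ ∙ (r ∘ suc)  ≡⟨ solve 4 (λ v r s y → :- (v :* s) :* r :+ y := y :- (r :* v) :* s)
        refl (pivot zero ⁻¹) (r zero) s _ ⟩
      c′ ∙ (r ∘ suc) - (r zero * pivot zero ⁻¹) * s  ≡⟨ sym (∙-sub c′ (r ∘ suc) (pivot ∘ suc) _) ⟩
      c′ ∙ (λ i → r (suc i) - (r zero * pivot zero ⁻¹) * pivot (suc i))  ≡⟨ eq ⟩
      0#  ∎

  -- The index found is the order at 0 of Stepanov's auxiliary function, because `φ e` has order e
  -- there.
  leading : ∀ {U} (c : Row U) → (∃ λ i → c i ≢ 0#) → ∃ λ k → c k ≢ 0# × (∀ i → toℕ i ℕ.< toℕ k → c i ≡ 0#)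
  leading {suc U} c (i , ci≢0) with c zero ≟ 0#
  ... | no c0≢0 = zero , c0≢0 , λ _ ()
  leading {suc U} c (zero , c0≢0) | yes c0≡0 = contradiction c0≡0 c0≢0
  leading {suc U} c (suc i , ci≢0) | yes c0≡0 with leading (c ∘ suc) (i , ci≢0)
  ... | k , ck≢0 , below = suc k , ck≢0 , λ { zero _ → c0≡0 ; (suc j) (s≤s j<k) → below j j<k }

  sum-single : ∀ {U} (f : Row U) k → (∀ i → i ≢ k → f i ≡ 0#) → ∑ᴷ.sum f ≡ f k
  sum-single {suc U} f zero f≡0 = trans (cong (f zero +_) (trans (∑ᴷ.sum-cong-≋ λ i → f≡0 (suc i) λ ())
    (∑ᴷ.sum-replicate-zero U))) (+-identityʳ _)
  sum-single {suc U} f (suc k) f≡0 = trans (cong₂ _+_ (f≡0 zero λ ())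
    (sum-single (f ∘ suc) k λ i i≢k → f≡0 (suc i) (i≢k ∘ Fin.suc-injective))) (+-identityˡ _)

-- Stepanov's method over a field of order Q²

≢⇒<⊎> : ∀ {m n} → m ≢ n → m ℕ.< n ⊎ n ℕ.< m
≢⇒<⊎> {m} {n} m≢n with ℕ.<-cmp m n
... | tri< m<n _ _ = inj₁ m<n
... | tri≈ _ m≡n _ = contradiction m≡n m≢n
... | tri> _ _ m>n = inj₂ m>n

-- At q₁ this is the sum of q₁ - s over s < q₁, to which the degrees of the coefficients `β s` add
-- up in units of Q.
triangle : ℕ → ℕ
triangle zero = 0
triangle (suc m) = suc m ℕ.+ triangle m

module Stepanov (K : Field) {q q₁ n′ : ℕ} (q≡1+q₁ : q ≡ suc q₁) (0<q₁ : 0 ℕ.< q₁)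
  (K↔ : HasSize (Field.Carrier K) (q ^ (suc n′ ℕ.+ suc n′))) (add-q : AdditivePowers.Additive K q)
  (w<d : triangle q₁ ℕ.< q ^ n′) {a : Field.Carrier K} (a≢0 : a ≢ Field.0# K) where

  open FiniteField K K↔
  open AdditivePowers K
  open Polynomials K
  open RootBounds K K↔
  open Trace K q add-q
  open LinearSystems K K↔

  -- There are U = Q J unknowns, one for each choice of i < d, l < q and j < J, and q₁ (Q d + J - Q)
  -- + Q w equations. The choice J = q₁ d + w makes the surplus of unknowns q₁ (Q - J), which is
  -- positive because w < d.
  d Q w J U : ℕ
  d = q ^ n′
  Q = q ^ suc n′
  w = triangle q₁
  J = q₁ ℕ.* d ℕ.+ w
  U = Q ℕ.* J

  private
    instance
      q-nonZero : ℕ.NonZero q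
      q-nonZero = subst ℕ.NonZero (sym q≡1+q₁) _
      d-nonZero : ℕ.NonZero d
      d-nonZero = ℕ.m^n≢0 q n′
      Q-nonZero : ℕ.NonZero Q
      Q-nonZero = ℕ.m^n≢0 q (suc n′)

    0<d : 0 ℕ.< d
    0<d = ℕ.>-nonZero⁻¹ d

    0<J : 0 ℕ.< J
    0<J = ℕ.≤-trans (ℕ.*-mono-≤ 0<q₁ 0<d) (ℕ.m≤m+n (q₁ ℕ.* d) w)

    Q≡d+q₁d : Q ≡ d ℕ.+ q₁ ℕ.* d
    Q≡d+q₁d = cong (ℕ._* d) q≡1+q₁

    1<q : 1 ℕ.< q
    1<q = subst (1 ℕ.<_) (sym q≡1+q₁) (s≤s 0<q₁)

    size≡QQ : q ^ (suc n′ ℕ.+ suc n′) ≡ Q ℕ.* Q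
    size≡QQ = ℕ.^-distribˡ-+-* q (suc n′) (suc n′)

    add-Q : Additive Q
    add-Q = additive-^ {q} add-q (suc n′)

    Frobenius² : ∀ z → z ↑ (Q ℕ.* Q) ≡ z
    Frobenius² z = trans (cong (z ↑_) (sym size≡QQ)) (fermat z)

  -- e = i + d l′ + Q j with i < d and l′ < q.
  digit-i digit-l′ digit-l digit-j : ℕ → ℕ
  digit-i e = e ℕ.% d
  digit-l′ e = (e ℕ./ d) ℕ.% q
  digit-l e = q₁ ∸ digit-l′ e
  digit-j e = e ℕ./ d ℕ./ q

  private
    digits : ∀ e → e ≡ digit-i e ℕ.+ (digit-l′ e ℕ.+ digit-j e ℕ.* q) ℕ.* d
    digits e = trans (ℕ.m≡m%n+[m/n]*n e d) (cong (λ y → digit-i e ℕ.+ y ℕ.* d) (ℕ.m≡m%n+[m/n]*n (e ℕ./ d) q))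

    i≤ : ∀ e → digit-i e ℕ.≤ d ∸ 1
    i≤ e = ℕ.∸-monoˡ-≤ 1 (ℕ.m%n<n e d)

    l′≤ : ∀ e → digit-l′ e ℕ.≤ q₁
    l′≤ e = ℕ.≤-pred (subst (digit-l′ e ℕ.<_) q≡1+q₁ (ℕ.m%n<n (e ℕ./ d) q))

    l′+l : ∀ e → digit-l′ e ℕ.+ digit-l e ≡ q₁
    l′+l e = ℕ.m+[n∸m]≡n (l′≤ e)

    j≤ : ∀ {e} → e ℕ.< U → digit-j e ℕ.≤ J ∸ 1
    j≤ {e} e<U = ℕ.∸-monoˡ-≤ 1 (ℕ.m<n*o⇒m/o<n {e ℕ./ d} {J} {q}
      (ℕ.m<n*o⇒m/o<n {e} {J ℕ.* q} {d} (subst (e ℕ.<_) (rearrange q d J) e<U)))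
      where
      rearrange : ∀ q d J → q ℕ.* d ℕ.* J ≡ J ℕ.* q ℕ.* d
      rearrange = solve-∀

  -- All values of x have trace 0, and each is taken at most q times. X is a common denominator of
  -- the terms h, h^q, ..., h^(q^n′) of T.
  x X : Carrier → Carrier
  x z = z ↑ q - z
  X z = x z ↑ d

  h T t : Carrier → Carrier
  h z = a * x z ⁻¹
  T z = Trace (suc n′) (h z)
  t z = Trace (suc n′ ℕ.+ suc n′) (h z)

  -- σ k is the polynomial x^(q^k) (h + h^q + ... + h^(q^k)), where h = a / x.
  σ : ℕ → Carrier → Carrier
  σ zero z = a
  σ (suc k) z = x z ↑ (q ^ suc k ∸ q ^ k) * σ k z + a ↑ (q ^ suc k)

  τ : Carrier → Carrier
  τ = σ n′

  private
    q^k<q^1+k : ∀ k → q ^ k ℕ.< q ^ suc k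
    q^k<q^1+k k = ℕ.^-monoʳ-< q 1<q (ℕ.n<1+n k)

    xh≡a : ∀ {z} → x z ≢ 0# → x z * h z ≡ a
    xh≡a {z} x≢0 = trans (solve 3 (λ x a y → x :* (a :* y) := a :* (x :* y)) refl (x z) a (x z ⁻¹))
      (trans (cong (a *_) (*-inverseʳ x≢0)) (*-identityʳ a))

    σ-trace : ∀ {z} → x z ≢ 0# → ∀ k → σ k z ≡ x z ↑ (q ^ k) * Trace (suc k) (h z)
    σ-trace {z} x≢0 zero = sym (trans (cong₂ _*_ (↑1 (x z)) (Tr-1 (h z))) (xh≡a x≢0))
    σ-trace {z} x≢0 (suc k) = begin
      x z ↑ (q ^ suc k ∸ q ^ k) * σ k z + a ↑ (q ^ suc k)  ≡⟨ cong₂ _+_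
        (cong (x z ↑ (q ^ suc k ∸ q ^ k) *_) (σ-trace x≢0 k)) (cong (_↑ (q ^ suc k)) (sym (xh≡a x≢0))) ⟩
      x z ↑ (q ^ suc k ∸ q ^ k) * (x z ↑ (q ^ k) * Trace (suc k) (h z)) + (x z * h z) ↑ (q ^ suc k)
        ≡⟨ cong₂ _+_ (trans (sym (*-assoc _ _ _)) (cong (_* Trace (suc k) (h z))
        (trans (sym (↑-+ (x z) (q ^ suc k ∸ q ^ k) (q ^ k))) (cong (x z ↑_) (ℕ.m∸n+n≡m (ℕ.<⇒≤ (q^k<q^1+k k)))))))
        (↑-distrib-* (x z) (h z) (q ^ suc k)) ⟩
      x z ↑ (q ^ suc k) * Trace (suc k) (h z) + x z ↑ (q ^ suc k) * h z ↑ (q ^ suc k)  ≡⟨ sym (distribˡ _ _ _) ⟩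
      x z ↑ (q ^ suc k) * Trace (suc (suc k)) (h z)  ∎
      where open ≡-Reasoning

    τ≡XT : ∀ {z} → x z ≢ 0# → τ z ≡ X z * T z
    τ≡XT x≢0 = σ-trace x≢0 n′

    σ-0 : ∀ {z} → x z ≡ 0# → ∀ k → σ k z ≡ a ↑ (q ^ k)
    σ-0 x≡0 zero = sym (↑1 a)
    σ-0 {z} x≡0 (suc k) = trans (cong (λ y → y * σ k z + a ↑ (q ^ suc k))
      (trans (cong (_↑ (q ^ suc k ∸ q ^ k)) x≡0) (0↑ (ℕ.m<n⇒0<n∸m (q^k<q^1+k k)))))
      (trans (cong (_+ a ↑ (q ^ suc k)) (zeroˡ _)) (+-identityˡ _))

    poly-x : Poly (suc q) x
    poly-x = poly-sub (poly-monomial q) (poly-weaken (s≤s (ℕ.<⇒≤ 1<q)) poly-id)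

    poly-X : Poly (suc Q) X
    poly-X = subst (λ m → Poly (suc m) X) (ℕ.*-comm d q) (poly-↑ poly-x d)

    poly-σ : ∀ k → Poly (suc (q ^ suc k)) (σ k)
    poly-σ zero = poly-weaken (s≤s z≤n) (poly-const a)
    poly-σ (suc k) = poly-+ (subst (λ m → Poly (suc m) (λ z → x z ↑ (q ^ suc k ∸ q ^ k) * σ k z)) degree
      (poly-* (poly-↑ poly-x (q ^ suc k ∸ q ^ k)) (poly-σ k)))
      (poly-weaken (s≤s z≤n) (poly-const _))
      where
      factor : ∀ y q z → y ℕ.* q ℕ.+ q ℕ.* z ≡ q ℕ.* (y ℕ.+ z)
      factor = solve-∀
      degree : (q ^ suc k ∸ q ^ k) ℕ.* q ℕ.+ q ^ suc k ≡ q ^ suc (suc k)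
      degree = trans (factor (q ^ suc k ∸ q ^ k) q (q ^ k)) (cong (q ℕ.*_) (ℕ.m∸n+n≡m (ℕ.<⇒≤ (q^k<q^1+k k))))

    poly-τ : Poly (suc Q) τ
    poly-τ = poly-σ n′

  -- The coefficients of (y - τ)^l = Σ_s ε l s y^s.
  ε : ℕ → ℕ → Carrier → Carrier
  ε zero zero z = 1#
  ε zero (suc s) z = 0#
  ε (suc l) zero z = - (τ z * ε l zero z)
  ε (suc l) (suc s) z = ε l s z - τ z * ε l (suc s) z

  private
    ε-0 : ∀ {l s} → l ℕ.< s → ∀ z → ε l s z ≡ 0#
    ε-0 {zero} {suc s} _ z = refl
    ε-0 {suc l} {suc s} (s≤s l<s) z = trans (cong₂ _-_ (ε-0 l<s z)
      (trans (cong (τ z *_) (ε-0 (ℕ.m≤n⇒m≤1+n l<s) z)) (zeroʳ _))) (-‿inverseʳ 0#)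

    -- Up to sign ε l s is a binomial coefficient times τ^(l - s), of degree at most Q (l - s). Any
    -- D with l ≤ s + D takes the place of the difference.
    poly-ε : ∀ l s D → l ℕ.≤ s ℕ.+ D → Poly (suc (Q ℕ.* D)) (ε l s)
    poly-τε : ∀ l s D → l ℕ.≤ s ℕ.+ D → Poly (suc (Q ℕ.* suc D)) (λ z → τ z * ε l s z)
    poly-τε l s D l≤ = subst (λ m → Poly (suc m) (λ z → τ z * ε l s z)) (sym (ℕ.*-suc Q D))
      (poly-* poly-τ (poly-ε l s D l≤))
    poly-ε zero zero D _ = poly-weaken (s≤s z≤n) (poly-const 1#)
    poly-ε zero (suc s) D _ = poly-0 _
    poly-ε (suc l) zero (suc D) (s≤s l≤) = poly-neg (poly-τε l zero D l≤)
    poly-ε (suc l) (suc s) zero (s≤s l≤) = poly-cong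
      (λ z → sym (trans (cong (λ y → ε l s z - y) (trans (cong (τ z *_)
        (ε-0 {l} {suc s} (s≤s (subst (l ℕ.≤_) (ℕ.+-identityʳ s) l≤)) z)) (zeroʳ _)))
        (solve 1 (λ y → y :- con (ℤ.+ 0) := y) refl _)))
      (poly-ε l s zero l≤)
    poly-ε (suc l) (suc s) (suc D) (s≤s l≤) = poly-sub (poly-ε l s (suc D) l≤)
      (poly-τε l (suc s) D (subst (l ℕ.≤_) (ℕ.+-suc s D) l≤))

    expand : ∀ {m} l → l ℕ.< m → ∀ y z → (y - τ z) ↑ l ≡ ∑ᴷ.sum {m} (λ s → y ↑ toℕ s * ε l (toℕ s) z)
    expand {suc m} zero _ y z = sym (trans (cong₂ _+_ (*-identityʳ 1#)
      (trans (∑ᴷ.sum-cong-≋ {m} λ s → zeroʳ _) (∑ᴷ.sum-replicate-zero m))) (+-identityʳ 1#))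
    expand {suc m} (suc l) (s≤s l<m) y z = begin
      (y - τ z) * (y - τ z) ↑ l  ≡⟨ distribʳ _ _ _ ⟩
      y * (y - τ z) ↑ l + - τ z * (y - τ z) ↑ l  ≡⟨ cong₂ (λ u v → y * u + - τ z * v) (expand {m} l l<m y z)
        (expand {suc m} l (ℕ.m≤n⇒m≤1+n l<m) y z) ⟩
      y * S + - τ z * (1# * ε l 0 z + S′)  ≡⟨ solve 6 (λ y s τ o e s′ → y :* s :+ (:- τ) :* (o :* e :+ s′) := o :*
        (:- (τ :* e)) :+ (y :* s :+ (:- τ) :* s′)) refl y S (τ z) 1# (ε l 0 z) S′ ⟩
      1# * - (τ z * ε l 0 z) + (y * S + - τ z * S′)  ≡⟨ cong (1# * - (τ z * ε l 0 z) +_) (begin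
        y * S + - τ z * S′  ≡⟨ cong₂ _+_ (∑ᴷ.*-distribˡ-sum y (λ (s : Fin m) → y ↑ toℕ s * ε l (toℕ s) z))
          (∑ᴷ.*-distribˡ-sum (- τ z) (λ (s : Fin m) → y ↑ suc (toℕ s) * ε l (suc (toℕ s)) z)) ⟩
        ∑ᴷ.sum {m} (λ s → y * (y ↑ toℕ s * ε l (toℕ s) z)) + ∑ᴷ.sum {m}
          (λ s → - τ z * (y ↑ suc (toℕ s) * ε l (suc (toℕ s)) z))
          ≡⟨ sym (∑ᴷ.∑-distrib-+ {m} (λ s → y * (y ↑ toℕ s * ε l (toℕ s) z))
            (λ s → - τ z * (y ↑ suc (toℕ s) * ε l (suc (toℕ s)) z))) ⟩
        ∑ᴷ.sum {m} (λ s → y * (y ↑ toℕ s * ε l (toℕ s) z) + - τ z * (y ↑ suc (toℕ s) * ε l (suc (toℕ s)) z))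
          ≡⟨ ∑ᴷ.sum-cong-≋ {m} (λ s → solve 5 (λ y p e τ e′ → y :* (p :* e) :+ (:- τ) :* ((y :* p) :* e′) := (y :* p) :*
            (e :- τ :* e′)) refl y (y ↑ toℕ s) (ε l (toℕ s) z) (τ z) (ε l (suc (toℕ s)) z)) ⟩
        ∑ᴷ.sum {m} (λ s → y ↑ suc (toℕ s) * ε (suc l) (suc (toℕ s)) z) ∎) ⟩
      1# * - (τ z * ε l 0 z) + ∑ᴷ.sum {m} (λ s → y ↑ suc (toℕ s) * ε (suc l) (suc (toℕ s)) z) ∎
      where
      open ≡-Reasoning
      S S′ : Carrier
      S = ∑ᴷ.sum {m} (λ s → y ↑ toℕ s * ε l (toℕ s) z)
      S′ = ∑ᴷ.sum {m} (λ s → y ↑ suc (toℕ s) * ε l (suc (toℕ s)) z)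

  -- The Q-th power of z^(i + Q j), in which z^(Q Q) = z has turned z^(Q Q j) into z^j. This drop in
  -- degree is what the method lives on.
  monomial : ℕ → Carrier → Carrier
  monomial e z = z ↑ (Q ℕ.* digit-i e ℕ.+ digit-j e)

  -- `γ s` is the coefficient of y^s for y = X t. In `β` the coefficient of y^q₁ = X^q₁ is folded
  -- into that of y^0. With q blocks of equations in place of q₁, the equations would outnumber the
  -- unknowns.
  γ β : ℕ → ℕ → Carrier → Carrier
  γ s e z = monomial e z * (X z ↑ digit-l′ e * ε (digit-l e) s z)
  β zero e z = γ zero e z + X z ↑ q₁ * γ q₁ e z
  β (suc s) e z = γ (suc s) e z

  -- One more than a degree: Q (d - 1) and J - 1 come from z^(Q i + j), and X^l′ with ε adds Q l′ +
  -- Q (l - s) = Q (q₁ - s). Folding costs nothing: `γ q₁` lacks exactly the Q q₁ that X^q₁ brings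
  -- in.
  bound : ℕ → ℕ
  bound s = suc (Q ℕ.* (d ∸ 1) ℕ.+ (J ∸ 1) ℕ.+ Q ℕ.* (q₁ ∸ s))

  private
    poly-γ : ∀ s {e} → e ℕ.< U → Poly (bound s) (γ s e)
    poly-γ s {e} e<U = [ high , low ]′ (ℕ.≤-<-connex s (digit-l e))
      where
      degree : s ℕ.≤ digit-l e → digit-l′ e ℕ.* Q ℕ.+ Q ℕ.* (digit-l e ∸ s) ≡ Q ℕ.* (q₁ ∸ s)
      degree s≤l = trans (cong (ℕ._+ Q ℕ.* (digit-l e ∸ s)) (ℕ.*-comm (digit-l′ e) Q))
        (trans (sym (ℕ.*-distribˡ-+ Q (digit-l′ e) (digit-l e ∸ s)))
          (cong (Q ℕ.*_) (trans (sym (ℕ.+-∸-assoc (digit-l′ e) s≤l)) (cong (_∸ s) (l′+l e)))))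
      low : digit-l e ℕ.< s → Poly (bound s) (γ s e)
      low l<s = poly-cong (λ z → sym (trans (cong (λ y → monomial e z * (X z ↑ digit-l′ e * y)) (ε-0 l<s z))
        (trans (cong (monomial e z *_) (zeroʳ _)) (zeroʳ _)))) (poly-0 _)
      high : s ℕ.≤ digit-l e → Poly (bound s) (γ s e)
      high s≤l = poly-weaken (s≤s (ℕ.+-mono-≤ (ℕ.+-mono-≤ (ℕ.*-monoʳ-≤ Q (i≤ e)) (j≤ e<U)) (ℕ.≤-reflexive (degree s≤l))))
        (poly-* (poly-monomial (Q ℕ.* digit-i e ℕ.+ digit-j e)) (poly-* (poly-↑ poly-X (digit-l′ e))
          (poly-ε (digit-l e) s (digit-l e ∸ s) (ℕ.≤-reflexive (sym (ℕ.m+[n∸m]≡n s≤l))))))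

    poly-β : ∀ s {e} → e ℕ.< U → Poly (bound s) (β s e)
    poly-β (suc s) e<U = poly-γ (suc s) e<U
    poly-β zero {e} e<U = poly-+ (poly-γ zero e<U)
      (poly-weaken (ℕ.≤-reflexive degree) (poly-* (poly-↑ poly-X q₁) (poly-γ q₁ e<U)))
      where
      shift : ∀ u y v → u ℕ.* v ℕ.+ (y ℕ.+ v ℕ.* 0) ≡ y ℕ.+ v ℕ.* u
      shift = solve-∀
      degree : suc (q₁ ℕ.* Q ℕ.+ (Q ℕ.* (d ∸ 1) ℕ.+ (J ∸ 1) ℕ.+ Q ℕ.* (q₁ ∸ q₁))) ≡ bound zero
      degree = cong suc (trans (cong (λ y → q₁ ℕ.* Q ℕ.+ (Q ℕ.* (d ∸ 1) ℕ.+ (J ∸ 1) ℕ.+ Q ℕ.* y)) (ℕ.n∸n≡0 q₁))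
        (shift q₁ (Q ℕ.* (d ∸ 1) ℕ.+ (J ∸ 1)) Q))

    -- Only t^q₁ = 1 merges the top coefficient into the constant one; this is where t ≠ 0 enters.
    expand-β : ∀ e {z} → t z ↑ q₁ ≡ 1# →
               monomial e z * (X z ↑ digit-l′ e * (X z * t z - τ z) ↑ digit-l e) ≡ ∑ᴷ.sum {q₁}
                 (λ s → (X z * t z) ↑ toℕ s * β (toℕ s) e z)
    expand-β e {z} t^q₁≡1 = begin
      μ * (Y * (y - τ z) ↑ l)  ≡⟨ cong (λ u → μ * (Y * u)) (expand {suc q₁} l (s≤s (ℕ.m∸n≤m q₁ (digit-l′ e))) y z) ⟩
      μ * (Y * ∑ᴷ.sum {suc q₁} (λ s → y ↑ toℕ s * ε l (toℕ s) z))
        ≡⟨ trans (cong (μ *_) (∑ᴷ.*-distribˡ-sum {suc q₁} Y (λ s → y ↑ toℕ s * ε l (toℕ s) z)))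
        (∑ᴷ.*-distribˡ-sum {suc q₁} μ (λ s → Y * (y ↑ toℕ s * ε l (toℕ s) z))) ⟩
      ∑ᴷ.sum {suc q₁} (λ s → μ * (Y * (y ↑ toℕ s * ε l (toℕ s) z)))
        ≡⟨ ∑ᴷ.sum-cong-≋ {suc q₁} (λ s → solve 4 (λ μ Y p e → μ :* (Y :* (p :* e)) := p :* (μ :* (Y :* e))) refl μ Y
        (y ↑ toℕ s) (ε l (toℕ s) z)) ⟩
      ∑ᴷ.sum {suc q₁} (λ s → y ↑ toℕ s * γ (toℕ s) e z)  ≡⟨ merge q₁ 0<q₁ refl ⟩
      ∑ᴷ.sum {q₁} (λ s → y ↑ toℕ s * β (toℕ s) e z)  ∎
      where
      open ≡-Reasoning
      μ = monomial e z
      Y = X z ↑ digit-l′ e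
      y = X z * t z
      l = digit-l e
      merge : ∀ r → 0 ℕ.< r → r ≡ q₁ → ∑ᴷ.sum {suc r} (λ s → y ↑ toℕ s * γ (toℕ s) e z) ≡ ∑ᴷ.sum {r}
        (λ s → y ↑ toℕ s * β (toℕ s) e z)
      merge (suc r) _ r≡q₁ = begin
        1# * γ 0 e z + ∑ᴷ.sum {suc r} g  ≡⟨ cong (1# * γ 0 e z +_) (∑ᴷ.sum-init-last {r} g) ⟩
        1# * γ 0 e z + (∑ᴷ.sum {r} (λ s → g (Fin.inject₁ s)) + g (Fin.fromℕ r))
          ≡⟨ cong₂ (λ u v → 1# * γ 0 e z + (u + v)) (∑ᴷ.sum-cong-≋ {r} λ s → cong (λ i → y ↑ suc i * γ (suc i) e z)
            (Fin.toℕ-inject₁ s)) top ⟩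
        1# * γ 0 e z + (∑ᴷ.sum {r} g′ + X z ↑ q₁ * γ q₁ e z)
          ≡⟨ solve 4 (λ o a b c → o :* a :+ (b :+ c) := (o :* a :+ c) :+ b) refl 1# (γ 0 e z) (∑ᴷ.sum {r} g′)
          (X z ↑ q₁ * γ q₁ e z) ⟩
        (1# * γ 0 e z + X z ↑ q₁ * γ q₁ e z) + ∑ᴷ.sum {r} g′
          ≡⟨ cong (_+ ∑ᴷ.sum {r} g′) (trans (cong (_+ X z ↑ q₁ * γ q₁ e z) (*-identityˡ _)) (sym (*-identityˡ _))) ⟩
        1# * β 0 e z + ∑ᴷ.sum {r} g′  ∎
        where
        g : Fin (suc r) → Carrier
        g s = y ↑ suc (toℕ s) * γ (suc (toℕ s)) e z
        g′ : Fin r → Carrier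
        g′ s = y ↑ suc (toℕ s) * γ (suc (toℕ s)) e z
        top : g (Fin.fromℕ r) ≡ X z ↑ q₁ * γ q₁ e z
        top = trans (cong (λ i → y ↑ suc i * γ (suc i) e z) (Fin.toℕ-fromℕ r)) (trans (cong (λ i → y ↑ i * γ i e z) r≡q₁)
          (cong (_* γ q₁ e z) (trans (↑-distrib-* (X z) (t z) q₁) (trans (cong (X z ↑ q₁ *_) t^q₁≡1) (*-identityʳ _)))))

  point : Fin (q ^ (suc n′ ℕ.+ suc n′)) → Carrier
  point = Inverse.from K↔

  private
    sum-prefix : ∀ {m N} (g : Fin N → ℕ) (m≤N : m ℕ.≤ N) → (∀ i → 1 ℕ.≤ g (Fin.inject≤ i m≤N)) → m ℕ.≤ sum g
    sum-prefix {zero} g _ _ = z≤n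
    sum-prefix {suc m} {suc N} g m≤N 1≤g = ℕ.+-mono-≤ (1≤g zero) (sum-prefix (g ∘ suc) (ℕ.≤-pred m≤N) (1≤g ∘ suc))

    d∸1+1 : d ∸ 1 ℕ.+ 1 ≡ d
    d∸1+1 = ℕ.m∸n+n≡m 0<d

    J∸1+1 : J ∸ 1 ℕ.+ 1 ≡ J
    J∸1+1 = ℕ.m∸n+n≡m 0<J

    J+[d∸w]≡Q : J ℕ.+ (d ∸ w) ≡ Q
    J+[d∸w]≡Q = begin
      q₁ ℕ.* d ℕ.+ w ℕ.+ (d ∸ w)  ≡⟨ ℕ.+-assoc (q₁ ℕ.* d) w (d ∸ w) ⟩
      q₁ ℕ.* d ℕ.+ (w ℕ.+ (d ∸ w))  ≡⟨ cong (q₁ ℕ.* d ℕ.+_) (ℕ.m+[n∸m]≡n (ℕ.<⇒≤ w<d)) ⟩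
      q₁ ℕ.* d ℕ.+ d  ≡⟨ ℕ.+-comm (q₁ ℕ.* d) d ⟩
      d ℕ.+ q₁ ℕ.* d  ≡⟨ sym Q≡d+q₁d ⟩
      Q  ∎
      where open ≡-Reasoning

    bound+Q : ∀ s → bound s ℕ.+ Q ≡ Q ℕ.* d ℕ.+ J ℕ.+ Q ℕ.* (q₁ ∸ s)
    bound+Q s = trans (regroup Q (d ∸ 1) (J ∸ 1) (q₁ ∸ s)) (cong₂ (λ u v → Q ℕ.* u ℕ.+ v ℕ.+ Q ℕ.* (q₁ ∸ s)) d∸1+1 J∸1+1)
      where
      regroup : ∀ Q u v r → suc (Q ℕ.* u ℕ.+ v ℕ.+ Q ℕ.* r) ℕ.+ Q ≡ Q ℕ.* (u ℕ.+ 1) ℕ.+ (v ℕ.+ 1) ℕ.+ Q ℕ.* r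
      regroup = solve-∀

    bound≤size : ∀ s → bound s ℕ.≤ q ^ (suc n′ ℕ.+ suc n′)
    bound≤size s = ℕ.+-cancelʳ-≤ Q (bound s) _ (begin
      bound s ℕ.+ Q  ≡⟨ bound+Q s ⟩
      Q ℕ.* d ℕ.+ J ℕ.+ Q ℕ.* (q₁ ∸ s)  ≤⟨ ℕ.+-mono-≤ (ℕ.+-monoʳ-≤ (Q ℕ.* d) (ℕ.m+n≤o⇒m≤o J (ℕ.≤-reflexive J+[d∸w]≡Q)))
        (ℕ.*-monoʳ-≤ Q (ℕ.≤-trans (ℕ.m∸n≤m q₁ s) (ℕ.m≤m*n q₁ d))) ⟩
      Q ℕ.* d ℕ.+ Q ℕ.+ Q ℕ.* (q₁ ℕ.* d)  ≡⟨ regroup Q d (q₁ ℕ.* d) ⟩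
      Q ℕ.* (d ℕ.+ q₁ ℕ.* d) ℕ.+ Q  ≡⟨ cong (λ y → Q ℕ.* y ℕ.+ Q) (sym Q≡d+q₁d) ⟩
      Q ℕ.* Q ℕ.+ Q  ≡⟨ cong (ℕ._+ Q) (sym size≡QQ) ⟩
      q ^ (suc n′ ℕ.+ suc n′) ℕ.+ Q  ∎)
      where
      open ℕ.≤-Reasoning
      regroup : ∀ Q d y → Q ℕ.* d ℕ.+ Q ℕ.+ Q ℕ.* y ≡ Q ℕ.* (d ℕ.+ y) ℕ.+ Q
      regroup = solve-∀

  -- A polynomial is made to vanish through its values at `bound s` points of the field, since
  -- `Poly` does not expose coefficients; by `bound≤size` there are enough points.
  equations : ∀ s → Fin (bound s) → Row U
  equations s i e = β s (toℕ e) (point (Fin.inject≤ i (bound≤size s)))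

  system : ℕ → List (Row U)
  system zero = []
  system (suc s) = List.tabulate (equations s) List.++ system s

  private
    -- The term with `triangle (q₁ ∸ m)` accounts for the blocks still to come and m Q for the Q
    -- added in `bound+Q`, so that the induction runs without subtraction.
    length-system : ∀ {m} → m ℕ.≤ q₁ → length (system m) ℕ.+ Q ℕ.* triangle (q₁ ∸ m) ℕ.+ m ℕ.* Q ≡ m ℕ.* (Q ℕ.* d ℕ.+ J)
      ℕ.+ Q ℕ.* w
    length-system {zero} _ = ℕ.+-identityʳ _
    length-system {suc m} m<q₁ = begin
      length (system (suc m)) ℕ.+ Q ℕ.* triangle (q₁ ∸ suc m) ℕ.+ suc m ℕ.* Q
        ≡⟨ cong (λ y → y ℕ.+ Q ℕ.* triangle (q₁ ∸ suc m) ℕ.+ suc m ℕ.* Q)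
          (trans (List.length-++ (List.tabulate (equations m)))
          (cong (ℕ._+ length (system m)) (List.length-tabulate (equations m)))) ⟩
      bound m ℕ.+ length (system m) ℕ.+ Q ℕ.* triangle (q₁ ∸ suc m) ℕ.+ suc m ℕ.* Q
        ≡⟨ regroup (bound m) (length (system m)) (Q ℕ.* triangle (q₁ ∸ suc m)) m Q ⟩
      bound m ℕ.+ Q ℕ.+ (length (system m) ℕ.+ Q ℕ.* triangle (q₁ ∸ suc m) ℕ.+ m ℕ.* Q)
        ≡⟨ cong (ℕ._+ (length (system m) ℕ.+ Q ℕ.* triangle (q₁ ∸ suc m) ℕ.+ m ℕ.* Q))
          (trans (bound+Q m) (cong (λ y → Q ℕ.* d ℕ.+ J ℕ.+ Q ℕ.* y) q₁∸m)) ⟩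
      Q ℕ.* d ℕ.+ J ℕ.+ Q ℕ.* suc (q₁ ∸ suc m) ℕ.+ (length (system m) ℕ.+ Q ℕ.* triangle (q₁ ∸ suc m) ℕ.+ m ℕ.* Q)
        ≡⟨ regroup′ (Q ℕ.* d ℕ.+ J) Q (q₁ ∸ suc m) (length (system m)) (triangle (q₁ ∸ suc m)) (m ℕ.* Q) ⟩
      Q ℕ.* d ℕ.+ J ℕ.+ (length (system m) ℕ.+ Q ℕ.* triangle (suc (q₁ ∸ suc m)) ℕ.+ m ℕ.* Q)
        ≡⟨ cong (λ y → Q ℕ.* d ℕ.+ J ℕ.+ (length (system m) ℕ.+ Q ℕ.* triangle y ℕ.+ m ℕ.* Q)) (sym q₁∸m) ⟩
      Q ℕ.* d ℕ.+ J ℕ.+ (length (system m) ℕ.+ Q ℕ.* triangle (q₁ ∸ m) ℕ.+ m ℕ.* Q)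
        ≡⟨ cong (Q ℕ.* d ℕ.+ J ℕ.+_) (length-system (ℕ.<⇒≤ m<q₁)) ⟩
      Q ℕ.* d ℕ.+ J ℕ.+ (m ℕ.* (Q ℕ.* d ℕ.+ J) ℕ.+ Q ℕ.* w)
        ≡⟨ sym (ℕ.+-assoc (Q ℕ.* d ℕ.+ J) (m ℕ.* (Q ℕ.* d ℕ.+ J)) (Q ℕ.* w)) ⟩
      suc m ℕ.* (Q ℕ.* d ℕ.+ J) ℕ.+ Q ℕ.* w ∎
      where
      open ≡-Reasoning
      q₁∸m : q₁ ∸ m ≡ suc (q₁ ∸ suc m)
      q₁∸m = ℕ.+-∸-assoc 1 m<q₁
      regroup : ∀ b l t m Q → b ℕ.+ l ℕ.+ t ℕ.+ (Q ℕ.+ m ℕ.* Q) ≡ b ℕ.+ Q ℕ.+ (l ℕ.+ t ℕ.+ m ℕ.* Q)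
      regroup = solve-∀
      regroup′ : ∀ y Q r l t v → y ℕ.+ Q ℕ.* suc r ℕ.+ (l ℕ.+ Q ℕ.* t ℕ.+ v) ≡ y ℕ.+ (l ℕ.+ Q ℕ.* (suc r ℕ.+ t) ℕ.+ v)
      regroup′ = solve-∀

    system<U : length (system q₁) ℕ.< U
    system<U = ℕ.+-cancelʳ-< (q₁ ℕ.* Q) _ _ (begin-strict
      length (system q₁) ℕ.+ q₁ ℕ.* Q  ≡⟨ cong (ℕ._+ q₁ ℕ.* Q)
        (sym (trans (cong (λ y → length (system q₁) ℕ.+ Q ℕ.* triangle y) (ℕ.n∸n≡0 q₁))
        (trans (cong (length (system q₁) ℕ.+_) (ℕ.*-zeroʳ Q)) (ℕ.+-identityʳ _)))) ⟩
      length (system q₁) ℕ.+ Q ℕ.* triangle (q₁ ∸ q₁) ℕ.+ q₁ ℕ.* Q  ≡⟨ length-system ℕ.≤-refl ⟩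
      q₁ ℕ.* (Q ℕ.* d ℕ.+ J) ℕ.+ Q ℕ.* w  ≡⟨ regroup q₁ Q d J w ⟩
      U ℕ.+ q₁ ℕ.* J  <⟨ ℕ.+-monoʳ-< U (ℕ.*-monoʳ-< q₁ ⦃ ℕ.>-nonZero 0<q₁ ⦄ J<Q) ⟩
      U ℕ.+ q₁ ℕ.* Q  ∎)
      where
      open ℕ.≤-Reasoning
      regroup : ∀ q₁ Q d J w → q₁ ℕ.* (Q ℕ.* d ℕ.+ J) ℕ.+ Q ℕ.* w ≡ Q ℕ.* (q₁ ℕ.* d ℕ.+ w) ℕ.+ q₁ ℕ.* J
      regroup = solve-∀
      J<Q : J ℕ.< Q
      J<Q = subst (J ℕ.<_) J+[d∸w]≡Q (ℕ.m<m+n J (ℕ.m<n⇒0<n∸m w<d))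

    solved : ∀ {c′ : Row U} m → All (λ r → c′ ∙ r ≡ 0#) (system m) → ∀ s → s ℕ.< m → ∀ z → ∑ᴷ.sum
      (λ e → c′ e * β s (toℕ e) z) ≡ 0#
    solved {c′} (suc m) all s s<1+m = [ (λ s<m → solved m (All.++⁻ʳ (List.tabulate (equations m)) all) s s<m) ,
      (λ { refl → last }) ]′
      (ℕ.m≤n⇒m<n∨m≡n (ℕ.≤-pred s<1+m))
      where
      last : ∀ z → ∑ᴷ.sum (λ e → c′ e * β m (toℕ e) z) ≡ 0#
      last = vanishing (poly-sum _ λ e → poly-scale (c′ e) (poly-β m (Fin.toℕ<n e)))
        (sum-prefix _ (bound≤size m) λ i → ℕ.≤-reflexive (sym
          (𝟙-yes (_ ≟ 0#) (All.tabulate⁻ {f = equations m} (All.++⁻ˡ (List.tabulate (equations m)) all) i))))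

  good? : ∀ z → Dec (x z ≢ 0# × t z ≢ 0#)
  good? z = ¬? (x z ≟ 0#) ×-dec ¬? (t z ≟ 0#)

  -- Where x ≠ 0 this is X^q₁ z^i (z^j)^Q T^l: one factor X^q₁ clears the denominators of all T^l.
  -- Since τ is not 0 at 0, the powers X^l′ shift the order there by d l′ and give different e
  -- different orders.
  φ : ℕ → Carrier → Carrier
  φ e z = z ↑ (digit-i e ℕ.+ Q ℕ.* digit-j e) * (τ z ↑ digit-l e * X z ↑ digit-l′ e)

  private
    t≡T+T^Q : ∀ z → t z ≡ T z + T z ↑ Q
    t≡T+T^Q z = Tr-split (suc n′) (suc n′) (h z)

    -- From T^Q = t - T follows τ^Q = X^Q (t - T). The factor X^q₁ on the left turns t - T into X t
    -- - τ, a polynomial in X t with coefficients of small degree. The large powers of X collect in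
    -- (X^Q)^q₁, which is common to all e and splits off.
    φ^Q : ∀ e {z} → x z ≢ 0# → X z ↑ q₁ * φ e z ↑ Q ≡ (X z ↑ Q) ↑ q₁
      * (monomial e z * (X z ↑ digit-l′ e * (X z * t z - τ z) ↑ digit-l e))
    φ^Q e {z} x≢0 = begin
      X z ↑ q₁ * φ e z ↑ Q
        ≡⟨ cong (X z ↑ q₁ *_) (trans (↑-distrib-* _ _ Q) (cong₂ _*_ power
          (trans (↑-distrib-* _ _ Q) (cong₂ _*_ (trans (↑-comm (τ z) l Q) (cong (_↑ l) τ^Q)) (↑-comm (X z) l′ Q))))) ⟩
      X z ↑ q₁ * (monomial e z * ((Y * (t z - T z)) ↑ l * Y ↑ l′))
        ≡⟨ cong₂ (λ u v → u * (monomial e z * (v * Y ↑ l′))) (split (X z)) (↑-distrib-* Y (t z - T z) l) ⟩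
      (X z ↑ l′ * X z ↑ l) * (monomial e z * ((Y ↑ l * (t z - T z) ↑ l) * Y ↑ l′))
        ≡⟨ solve 6 (λ a b m c u d → (a :* b) :* (m :* ((c :* u) :* d)) := (d :* c) :* (m :* (a :* (b :* u)))) refl
          (X z ↑ l′) (X z ↑ l) (monomial e z) (Y ↑ l) ((t z - T z) ↑ l) (Y ↑ l′) ⟩
      (Y ↑ l′ * Y ↑ l) * (monomial e z * (X z ↑ l′ * (X z ↑ l * (t z - T z) ↑ l)))
        ≡⟨ cong₂ (λ u v → u * (monomial e z * (X z ↑ l′ * v))) (sym (split Y))
          (trans (sym (↑-distrib-* (X z) (t z - T z) l)) (cong (_↑ l) difference)) ⟩
      Y ↑ q₁ * (monomial e z * (X z ↑ l′ * (X z * t z - τ z) ↑ l)) ∎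
      where
      open ≡-Reasoning
      l = digit-l e
      l′ = digit-l′ e
      Y = X z ↑ Q
      split : ∀ y → y ↑ q₁ ≡ y ↑ l′ * y ↑ l
      split y = trans (cong (y ↑_) (sym (l′+l e))) (↑-+ y l′ l)
      difference : X z * (t z - T z) ≡ X z * t z - τ z
      difference = trans (solve 3 (λ X t T → X :* (t :- T) := X :* t :- X :* T) refl (X z) (t z) (T z))
        (cong (λ y → X z * t z - y) (sym (τ≡XT x≢0)))
      τ^Q : τ z ↑ Q ≡ Y * (t z - T z)
      τ^Q = trans (cong (_↑ Q) (τ≡XT x≢0)) (trans (↑-distrib-* (X z) (T z) Q)
        (cong (Y *_) (trans (solve 2 (λ T u → u := (T :+ u) :- T) refl (T z) (T z ↑ Q)) (cong (_- T z) (sym (t≡T+T^Q z))))))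
      exponent : ∀ i Q j → (i ℕ.+ Q ℕ.* j) ℕ.* Q ≡ Q ℕ.* i ℕ.+ (Q ℕ.* Q) ℕ.* j
      exponent = solve-∀
      power : (z ↑ (digit-i e ℕ.+ Q ℕ.* digit-j e)) ↑ Q ≡ monomial e z
      power = begin
        (z ↑ (digit-i e ℕ.+ Q ℕ.* digit-j e)) ↑ Q  ≡⟨ sym (↑-* z (digit-i e ℕ.+ Q ℕ.* digit-j e) Q) ⟩
        z ↑ ((digit-i e ℕ.+ Q ℕ.* digit-j e) ℕ.* Q)  ≡⟨ cong (z ↑_) (exponent (digit-i e) Q (digit-j e)) ⟩
        z ↑ (Q ℕ.* digit-i e ℕ.+ (Q ℕ.* Q) ℕ.* digit-j e)  ≡⟨ ↑-+ z (Q ℕ.* digit-i e) ((Q ℕ.* Q) ℕ.* digit-j e) ⟩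
        z ↑ (Q ℕ.* digit-i e) * z ↑ ((Q ℕ.* Q) ℕ.* digit-j e)
          ≡⟨ cong (z ↑ (Q ℕ.* digit-i e) *_) (trans (↑-* z (Q ℕ.* Q) (digit-j e)) (cong (_↑ digit-j e) (Frobenius² z))) ⟩
        z ↑ (Q ℕ.* digit-i e) * z ↑ digit-j e  ≡⟨ sym (↑-+ z (Q ℕ.* digit-i e) (digit-j e)) ⟩
        monomial e z  ∎

    t^q₁ : ∀ {z} → t z ≢ 0# → t z ↑ q₁ ≡ 1#
    t^q₁ {z} t≢0 = *-cancelˡ t≢0 (trans (cong (t z ↑_) (sym q≡1+q₁))
      (trans (Tr-fixed (suc n′ ℕ.+ suc n′) (h z) (fermat (h z))) (sym (*-identityʳ (t z)))))

    -- The coefficients are Q-th powers so that raising the sum R to the Q-th power restores c′,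
    -- because c′^(Q Q) = c′. The solved equations then give X^q₁ R^Q = 0, and X ≠ 0 forces R = 0.
    φ-vanishes : ∀ {c′ : Row U} → All (λ r → c′ ∙ r ≡ 0#) (system q₁) →
                 ∀ {z} → x z ≢ 0# → t z ≢ 0# → ∑ᴷ.sum (λ e → c′ e ↑ Q * φ (toℕ e) z) ≡ 0#
    φ-vanishes {c′} all {z} x≢0 t≢0 = decidable-stable (R ≟ 0#) λ R≢0 → (*-≢0 (↑-≢0 q₁ (↑-≢0 d x≢0)) (↑-≢0 Q R≢0)) (begin
      X z ↑ q₁ * R ↑ Q  ≡⟨ cong (X z ↑ q₁ *_) (trans (sum-additive Q add-Q {U} (λ e → c′ e ↑ Q * φ (toℕ e) z))
        (∑ᴷ.sum-cong-≋ {U} λ e → trans (↑-distrib-* _ _ Q) (cong (_* φ (toℕ e) z ↑ Q)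
        (trans (sym (↑-* (c′ e) Q Q)) (Frobenius² (c′ e)))))) ⟩
      X z ↑ q₁ * ∑ᴷ.sum {U} (λ e → c′ e * φ (toℕ e) z ↑ Q)  ≡⟨ ∑ᴷ.*-distribˡ-sum {U} (X z ↑ q₁)
        (λ e → c′ e * φ (toℕ e) z ↑ Q) ⟩
      ∑ᴷ.sum {U} (λ e → X z ↑ q₁ * (c′ e * φ (toℕ e) z ↑ Q))
        ≡⟨ ∑ᴷ.sum-cong-≋ {U} (λ e → trans (swap _ _ _) (trans
        (cong (c′ e *_) (trans (φ^Q (toℕ e) x≢0) (cong (Y *_) (expand-β (toℕ e) (t^q₁ t≢0))))) (swap _ _ _))) ⟩
      ∑ᴷ.sum {U} (λ e → Y * (c′ e * ∑ᴷ.sum {q₁} (λ s → y ↑ toℕ s * β (toℕ s) (toℕ e) z)))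
        ≡⟨ sym (∑ᴷ.*-distribˡ-sum {U} Y _) ⟩
      Y * ∑ᴷ.sum {U} (λ e → c′ e * ∑ᴷ.sum {q₁} (λ s → y ↑ toℕ s * β (toℕ s) (toℕ e) z))
        ≡⟨ cong (Y *_) (trans (∑ᴷ.sum-cong-≋ {U} λ e → trans (∑ᴷ.*-distribˡ-sum {q₁} (c′ e)
        (λ s → y ↑ toℕ s * β (toℕ s) (toℕ e) z)) (∑ᴷ.sum-cong-≋ {q₁} λ s → swap _ _ _))
        (∑ᴷ.∑-comm {U} {q₁} (λ e s → y ↑ toℕ s * (c′ e * β (toℕ s) (toℕ e) z)))) ⟩
      Y * ∑ᴷ.sum {q₁} (λ s → ∑ᴷ.sum {U} (λ e → y ↑ toℕ s * (c′ e * β (toℕ s) (toℕ e) z)))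
        ≡⟨ cong (Y *_) (trans (∑ᴷ.sum-cong-≋ {q₁} λ s → trans (sym
        (∑ᴷ.*-distribˡ-sum {U} (y ↑ toℕ s) (λ e → c′ e * β (toℕ s) (toℕ e) z)))
        (trans (cong (y ↑ toℕ s *_) (solved {c′} q₁ all (toℕ s) (Fin.toℕ<n s) z)) (zeroʳ _))) (∑ᴷ.sum-replicate-zero q₁)) ⟩
      Y * 0#  ≡⟨ zeroʳ Y ⟩
      0#  ∎)
      where
      open ≡-Reasoning
      R = ∑ᴷ.sum (λ e → c′ e ↑ Q * φ (toℕ e) z)
      Y = (X z ↑ Q) ↑ q₁
      y = X z * t z
      swap : ∀ a b c → a * (b * c) ≡ b * (a * c)
      swap = solve 3 (λ a b c → a :* (b :* c) := b :* (a :* c)) refl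

  -- φ e vanishes to order exactly e at 0: φ e z = z^e υ e z with υ e 0 ≠ 0.
  X′ : Carrier → Carrier
  X′ z = (z ↑ q₁ - 1#) ↑ d

  υ : ℕ → Carrier → Carrier
  υ e z = τ z ↑ digit-l e * X′ z ↑ digit-l′ e

  private
    x-factor : ∀ z → x z ≡ z * (z ↑ q₁ - 1#)
    x-factor z = trans (cong (λ r → z ↑ r - z) q≡1+q₁) (trans (cong (λ y → z * z ↑ q₁ - y) (sym (*-identityʳ z)))
      (solve 3 (λ z y o → z :* y :- z :* o := z :* (y :- o)) refl z (z ↑ q₁) 1#))

    x-0 : x 0# ≡ 0#
    x-0 = trans (x-factor 0#) (zeroˡ _)

    φ-factor : ∀ e z → φ e z ≡ z ↑ e * υ e z
    φ-factor e z = begin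
      z ↑ (i ℕ.+ Q ℕ.* j) * (τ z ↑ l * X z ↑ l′)  ≡⟨ cong (λ y → z ↑ (i ℕ.+ Q ℕ.* j) * (τ z ↑ l * y))
        (trans (cong (_↑ l′) (trans (cong (_↑ d) (x-factor z)) (↑-distrib-* z (z ↑ q₁ - 1#) d)))
        (trans (↑-distrib-* (z ↑ d) (X′ z) l′) (cong (_* X′ z ↑ l′) (sym (↑-* z d l′))))) ⟩
      z ↑ (i ℕ.+ Q ℕ.* j) * (τ z ↑ l * (z ↑ (d ℕ.* l′) * X′ z ↑ l′))
        ≡⟨ solve 4 (λ a b c e → a :* (b :* (c :* e)) := (a :* c) :* (b :* e)) refl (z ↑ (i ℕ.+ Q ℕ.* j)) (τ z ↑ l)
        (z ↑ (d ℕ.* l′)) (X′ z ↑ l′) ⟩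
      (z ↑ (i ℕ.+ Q ℕ.* j) * z ↑ (d ℕ.* l′)) * υ e z  ≡⟨ cong (_* υ e z)
        (trans (sym (↑-+ z (i ℕ.+ Q ℕ.* j) (d ℕ.* l′))) (cong (z ↑_) exponent)) ⟩
      z ↑ e * υ e z  ∎
      where
      open ≡-Reasoning
      i = digit-i e
      j = digit-j e
      l = digit-l e
      l′ = digit-l′ e
      regroup : ∀ i q d j l′ → i ℕ.+ q ℕ.* d ℕ.* j ℕ.+ d ℕ.* l′ ≡ i ℕ.+ (l′ ℕ.+ j ℕ.* q) ℕ.* d
      regroup = solve-∀
      exponent : i ℕ.+ Q ℕ.* j ℕ.+ d ℕ.* l′ ≡ e
      exponent = trans (regroup i q d j l′) (sym (digits e))

    υ-0 : ∀ e → υ e 0# ≢ 0#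
    υ-0 e = *-≢0 (↑-≢0 (digit-l e) τ0≢0) (↑-≢0 (digit-l′ e) (↑-≢0 d λ eq → 1≢0
      (sym (trans (sym (0↑ 0<q₁)) (x-y≡0⇒x≡y eq)))))
      where
      τ0≢0 : τ 0# ≢ 0#
      τ0≢0 τ0≡0 = ↑-≢0 d a≢0 (trans (sym (σ-0 x-0 n′)) τ0≡0)

  degree-bound : ℕ
  degree-bound = (d ∸ 1) ℕ.+ Q ℕ.* (J ∸ 1) ℕ.+ Q ℕ.* q₁

  private
    poly-X′ : Poly (suc (d ℕ.* q₁)) X′
    poly-X′ = poly-↑ (poly-sub (poly-monomial q₁) (poly-weaken (s≤s z≤n) (poly-const 1#))) d

    poly-υ : ∀ e₀ {e} → e ℕ.< U → Poly (suc degree-bound) (λ z → z ↑ (e ∸ e₀) * υ e z)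
    poly-υ e₀ {e} e<U = poly-weaken (s≤s (begin
      (e ∸ e₀) ℕ.+ (l ℕ.* Q ℕ.+ l′ ℕ.* (d ℕ.* q₁))  ≤⟨ ℕ.+-monoˡ-≤ _ (ℕ.m∸n≤m e e₀) ⟩
      e ℕ.+ (l ℕ.* Q ℕ.+ l′ ℕ.* (d ℕ.* q₁))  ≡⟨ cong (ℕ._+ (l ℕ.* Q ℕ.+ l′ ℕ.* (d ℕ.* q₁))) (digits e) ⟩
      i ℕ.+ (l′ ℕ.+ j ℕ.* q) ℕ.* d ℕ.+ (l ℕ.* Q ℕ.+ l′ ℕ.* (d ℕ.* q₁))  ≡⟨ regroup i l l′ j q d q₁ ⟩
      i ℕ.+ Q ℕ.* j ℕ.+ (l ℕ.* Q ℕ.+ l′ ℕ.* (d ℕ.+ q₁ ℕ.* d))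
        ≡⟨ cong (i ℕ.+ Q ℕ.* j ℕ.+_) (trans (cong (λ y → l ℕ.* Q ℕ.+ l′ ℕ.* y) (sym Q≡d+q₁d))
        (trans (collect l l′ Q) (cong (Q ℕ.*_) (l′+l e)))) ⟩
      i ℕ.+ Q ℕ.* j ℕ.+ Q ℕ.* q₁  ≤⟨ ℕ.+-monoˡ-≤ (Q ℕ.* q₁) (ℕ.+-mono-≤ (i≤ e) (ℕ.*-monoʳ-≤ Q (j≤ e<U))) ⟩
      degree-bound  ∎))
      (poly-* (poly-monomial (e ∸ e₀)) (poly-* (poly-↑ poly-τ l) (poly-↑ poly-X′ l′)))
      where
      open ℕ.≤-Reasoning
      i = digit-i e
      j = digit-j e
      l = digit-l e
      l′ = digit-l′ e
      regroup : ∀ i l l′ j q d q₁ → i ℕ.+ (l′ ℕ.+ j ℕ.* q) ℕ.* d ℕ.+ (l ℕ.* (q ℕ.* d) ℕ.+ l′ ℕ.* (d ℕ.* q₁)) ≡ i ℕ.+ q ℕ.* d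
        ℕ.* j ℕ.+ (l ℕ.* (q ℕ.* d) ℕ.+ l′ ℕ.* (d ℕ.+ q₁ ℕ.* d))
      regroup = solve-∀
      collect : ∀ l l′ Q → l ℕ.* Q ℕ.+ l′ ℕ.* Q ≡ Q ℕ.* (l′ ℕ.+ l)
      collect = solve-∀

  -- Let e₀ be the lowest index with a nonzero coefficient. Dividing the sum of c^Q φ e by z^e₀
  -- gives H with H(0) ≠ 0, since every other surviving term has higher order. H still vanishes at
  -- all good z, which are nonzero as x 0 = 0, so more than `degree-bound` of them would make H zero
  -- everywhere. One value thus replaces a proof of linear independence.
  few-good : ∑ K↔ (𝟙 ∘ good?) ℕ.≤ degree-bound
  few-good = ℕ.≮⇒≥ λ many → *-≢0 (↑-≢0 Q c′k≢0) (υ-0 e₀)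
    (trans (sym H-0) (vanishing poly-H (ℕ.≤-trans many (∑-mono K↔ λ z → 𝟙-mono (good? z) (H z ≟ 0#) H-vanishes)) 0#))
    where
    solution : ∃ λ (c : Row U) → (∃ λ i → c i ≢ 0#) × All (λ r → c ∙ r ≡ 0#) (system q₁)
    solution = nontrivial-solution (system q₁) system<U
    c′ : Row U
    c′ = proj₁ solution
    first : ∃ λ k → c′ k ≢ 0# × (∀ i → toℕ i ℕ.< toℕ k → c′ i ≡ 0#)
    first = leading c′ (proj₁ (proj₂ solution))
    k : Fin U
    k = proj₁ first
    c′k≢0 : c′ k ≢ 0#
    c′k≢0 = proj₁ (proj₂ first)
    below : ∀ i → toℕ i ℕ.< toℕ k → c′ i ≡ 0#
    below = proj₂ (proj₂ first)
    e₀ : ℕ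
    e₀ = toℕ k
    H : Carrier → Carrier
    H z = ∑ᴷ.sum (λ e → c′ e ↑ Q * (z ↑ (toℕ e ∸ e₀) * υ (toℕ e) z))
    poly-H : Poly (suc degree-bound) H
    poly-H = poly-sum _ λ e → poly-scale (c′ e ↑ Q) (poly-υ e₀ (Fin.toℕ<n e))
    low-term : ∀ e → toℕ e ℕ.< e₀ → ∀ y → c′ e ↑ Q * y ≡ 0#
    low-term e e<e₀ y = trans (cong (_* y) (trans (cong (_↑ Q) (below e e<e₀)) (0↑ (ℕ.>-nonZero⁻¹ Q)))) (zeroˡ y)
    H-0 : H 0# ≡ c′ k ↑ Q * υ e₀ 0#
    H-0 = trans (sum-single (λ e → c′ e ↑ Q * (0# ↑ (toℕ e ∸ e₀) * υ (toℕ e) 0#)) k other)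
      (cong (c′ k ↑ Q *_) (trans (cong (λ r → 0# ↑ r * υ e₀ 0#) (ℕ.n∸n≡0 e₀)) (*-identityˡ _)))
      where
      other : ∀ e → e ≢ k → c′ e ↑ Q * (0# ↑ (toℕ e ∸ e₀) * υ (toℕ e) 0#) ≡ 0#
      other e e≢k = [ (λ e<e₀ → low-term e e<e₀ (0# ↑ (toℕ e ∸ e₀) * υ (toℕ e) 0#)) , high-term ]′
        (≢⇒<⊎> λ e≡e₀ → e≢k (Fin.toℕ-injective e≡e₀))
        where
        high-term : e₀ ℕ.< toℕ e → c′ e ↑ Q * (0# ↑ (toℕ e ∸ e₀) * υ (toℕ e) 0#) ≡ 0#
        high-term e>e₀ = trans (cong (c′ e ↑ Q *_) (trans (cong (_* υ (toℕ e) 0#) (0↑ (ℕ.m<n⇒0<n∸m e>e₀))) (zeroˡ _)))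
          (zeroʳ _)
    z^e₀H : ∀ z → z ↑ e₀ * H z ≡ ∑ᴷ.sum (λ e → c′ e ↑ Q * φ (toℕ e) z)
    z^e₀H z = trans (∑ᴷ.*-distribˡ-sum (z ↑ e₀) (λ e → c′ e ↑ Q * (z ↑ (toℕ e ∸ e₀) * υ (toℕ e) z))) (∑ᴷ.sum-cong-≋ term)
      where
      term : ∀ e → z ↑ e₀ * (c′ e ↑ Q * (z ↑ (toℕ e ∸ e₀) * υ (toℕ e) z)) ≡ c′ e ↑ Q * φ (toℕ e) z
      term e = [ low , high ]′ (ℕ.<-≤-connex (toℕ e) e₀)
        where
        low : toℕ e ℕ.< e₀ → z ↑ e₀ * (c′ e ↑ Q * (z ↑ (toℕ e ∸ e₀) * υ (toℕ e) z)) ≡ c′ e ↑ Q * φ (toℕ e) z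
        low e<e₀ = trans (cong (z ↑ e₀ *_) (low-term e e<e₀ _)) (trans (zeroʳ _) (sym (low-term e e<e₀ _)))
        high : e₀ ℕ.≤ toℕ e → z ↑ e₀ * (c′ e ↑ Q * (z ↑ (toℕ e ∸ e₀) * υ (toℕ e) z)) ≡ c′ e ↑ Q * φ (toℕ e) z
        high e₀≤e = trans (solve 4 (λ a b c e → a :* (b :* (c :* e)) := b :* ((a :* c) :* e)) refl (z ↑ e₀) (c′ e ↑ Q)
          (z ↑ (toℕ e ∸ e₀)) (υ (toℕ e) z))
          (cong (c′ e ↑ Q *_) (trans (cong (_* υ (toℕ e) z) (trans (sym (↑-+ z e₀ (toℕ e ∸ e₀)))
            (cong (z ↑_) (ℕ.m+[n∸m]≡n e₀≤e)))) (sym (φ-factor (toℕ e) z))))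
    H-vanishes : ∀ {z} → x z ≢ 0# × t z ≢ 0# → H z ≡ 0#
    H-vanishes {z} (x≢0 , t≢0) = *-cancel-≢0 (↑-≢0 e₀ λ z≡0 → x≢0 (trans (cong x z≡0) x-0))
      (trans (z^e₀H z) (φ-vanishes {c′} (proj₂ (proj₂ solution)) x≢0 t≢0))

  zeros : ℕ
  zeros = ∑ K↔ λ y → 𝟙 (¬? (y ≟ 0#)) ℕ.* (𝟙 (Trace (suc n′ ℕ.+ suc n′) y ≟ 0#) ℕ.* 𝟙
    (Trace (suc n′ ℕ.+ suc n′) (a * y ⁻¹) ≟ 0#))

  -- Of the Q² elements z, at most q have x z = 0 and at most `degree-bound` are good. Every
  -- remaining z is sent by x to an element counted in `zeros`, and each such element has at most q
  -- preimages.
  many-zeros : Q ℕ.* d ℕ.+ Q ℕ.≤ q ℕ.* zeros ℕ.+ (Q ℕ.* (w ℕ.+ q₁) ℕ.+ d ℕ.+ q₁)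
  -- Adding Q q₁ d completes Q d to Q Q, while Q and the 1 undo the truncated subtractions J ∸ 1 and
  -- d ∸ 1 in `degree-bound`.
  many-zeros = ℕ.+-cancelʳ-≤ (1 ℕ.+ Q ℕ.* (q₁ ℕ.* d)) _ _ (begin
    Q ℕ.* d ℕ.+ Q ℕ.+ (1 ℕ.+ Q ℕ.* (q₁ ℕ.* d))  ≡⟨ regroup₁ Q d (q₁ ℕ.* d) ⟩
    Q ℕ.* (d ℕ.+ q₁ ℕ.* d) ℕ.+ Q ℕ.+ 1  ≡⟨ cong (λ y → Q ℕ.* y ℕ.+ Q ℕ.+ 1) (sym Q≡d+q₁d) ⟩
    Q ℕ.* Q ℕ.+ Q ℕ.+ 1  ≤⟨ ℕ.+-monoˡ-≤ 1 (ℕ.+-monoˡ-≤ Q partition) ⟩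
    q ℕ.+ degree-bound ℕ.+ q ℕ.* zeros ℕ.+ Q ℕ.+ 1  ≡⟨ regroup₂ q (d ∸ 1) Q (J ∸ 1) q₁ zeros ⟩
    q ℕ.+ (d ∸ 1 ℕ.+ 1) ℕ.+ Q ℕ.* (J ∸ 1 ℕ.+ 1) ℕ.+ Q ℕ.* q₁ ℕ.+ q ℕ.* zeros
      ≡⟨ cong₂ (λ u v → q ℕ.+ u ℕ.+ Q ℕ.* v ℕ.+ Q ℕ.* q₁ ℕ.+ q ℕ.* zeros) d∸1+1 J∸1+1 ⟩
    q ℕ.+ d ℕ.+ Q ℕ.* J ℕ.+ Q ℕ.* q₁ ℕ.+ q ℕ.* zeros  ≡⟨ cong (λ y → y ℕ.+ d ℕ.+ Q ℕ.* J ℕ.+ Q ℕ.* q₁ ℕ.+ q ℕ.* zeros)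
      q≡1+q₁ ⟩
    suc q₁ ℕ.+ d ℕ.+ Q ℕ.* J ℕ.+ Q ℕ.* q₁ ℕ.+ q ℕ.* zeros  ≡⟨ regroup₃ q₁ d Q (q₁ ℕ.* d) w (q ℕ.* zeros) ⟩
    q ℕ.* zeros ℕ.+ (Q ℕ.* (w ℕ.+ q₁) ℕ.+ d ℕ.+ q₁) ℕ.+ (1 ℕ.+ Q ℕ.* (q₁ ℕ.* d)) ∎)
    where
    open ℕ.≤-Reasoning
    regroup₁ : ∀ Q d y → Q ℕ.* d ℕ.+ Q ℕ.+ (1 ℕ.+ Q ℕ.* y) ≡ Q ℕ.* (d ℕ.+ y) ℕ.+ Q ℕ.+ 1
    regroup₁ = solve-∀
    regroup₂ : ∀ q u Q v q₁ z → q ℕ.+ (u ℕ.+ Q ℕ.* v ℕ.+ Q ℕ.* q₁) ℕ.+ q ℕ.* z ℕ.+ Q ℕ.+ 1 ≡ q ℕ.+ (u ℕ.+ 1) ℕ.+ Q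
      ℕ.* (v ℕ.+ 1) ℕ.+ Q ℕ.* q₁ ℕ.+ q ℕ.* z
    regroup₂ = solve-∀
    regroup₃ : ∀ q₁ d Q y w z → suc q₁ ℕ.+ d ℕ.+ Q ℕ.* (y ℕ.+ w) ℕ.+ Q ℕ.* q₁ ℕ.+ z ≡ z ℕ.+ (Q ℕ.* (w ℕ.+ q₁) ℕ.+ d ℕ.+ q₁)
      ℕ.+ (1 ℕ.+ Q ℕ.* y)
    regroup₃ = solve-∀
    Tr₂ : Carrier → Carrier
    Tr₂ = Trace (suc n′ ℕ.+ suc n′)
    ζ : Carrier → ℕ
    ζ y = 𝟙 (¬? (y ≟ 0#)) ℕ.* (𝟙 (Tr₂ y ≟ 0#) ℕ.* 𝟙 (Tr₂ (a * y ⁻¹) ≟ 0#))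
    fibre≤q : ∀ y → ∑ K↔ (λ z → 𝟙 (y ≟ x z)) ℕ.≤ q
    fibre≤q y = ℕ.≤-trans (∑-mono K↔ λ z → 𝟙-mono (y ≟ x z) (z ↑ q + (- z - y) ≟ 0#)
        λ { refl → solve 2 (λ u z → u :+ ((:- z) :- (u :- z)) := con (ℤ.+ 0)) refl (z ↑ q) z })
      (monic-roots (poly-sub (poly-neg (poly-weaken 1<q poly-id)) (poly-weaken (ℕ.<⇒≤ 1<q) (poly-const y))) (λ _ → refl))
    Tr-x : ∀ z → Tr₂ (x z) ≡ 0#
    Tr-x z = trans (Tr-telescope (suc n′ ℕ.+ suc n′) z) (trans (cong (_- z) (fermat z)) (-‿inverseʳ z))
    pull-back : ∑ K↔ (λ z → ζ (x z)) ℕ.≤ q ℕ.* zeros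
    pull-back = begin
      ∑ K↔ (λ z → ζ (x z))  ≡⟨ ∑-cong K↔ (λ z → sym (∑-δ K↔ (x z) (_≟ x z) ζ)) ⟩
      ∑ K↔ (λ z → ∑ K↔ (λ y → 𝟙 (y ≟ x z) ℕ.* ζ y))  ≡⟨ ∑-swap K↔ K↔ (λ z y → 𝟙 (y ≟ x z) ℕ.* ζ y) ⟩
      ∑ K↔ (λ y → ∑ K↔ (λ z → 𝟙 (y ≟ x z) ℕ.* ζ y))  ≡⟨ ∑-cong K↔ (λ y → sym (∑-*ʳ K↔ (ζ y) (λ z → 𝟙 (y ≟ x z)))) ⟩
      ∑ K↔ (λ y → ∑ K↔ (λ z → 𝟙 (y ≟ x z)) ℕ.* ζ y)  ≤⟨ ∑-mono K↔ (λ y → ℕ.*-monoˡ-≤ (ζ y) (fibre≤q y)) ⟩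
      ∑ K↔ (λ y → q ℕ.* ζ y)  ≡⟨ sym (∑-*ˡ K↔ q ζ) ⟩
      q ℕ.* zeros  ∎
    cover : ∀ z → 1 ℕ.≤ 𝟙 (0# ≟ x z) ℕ.+ 𝟙 (good? z) ℕ.+ ζ (x z)
    cover z = go (0# ≟ x z) (x z ≟ 0#) (t z ≟ 0#) (Tr₂ (x z) ≟ 0#)
      where
      go : (p : Dec (0# ≡ x z)) (e : Dec (x z ≡ 0#)) (f : Dec (t z ≡ 0#)) (g : Dec (Tr₂ (x z) ≡ 0#)) →
           1 ℕ.≤ 𝟙 p ℕ.+ 𝟙 (¬? e ×-dec ¬? f) ℕ.+ 𝟙 (¬? e) ℕ.* (𝟙 g ℕ.* 𝟙 f)
      go (yes _) _ _ _ = s≤s z≤n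
      go (no 0≢x) (yes x≡0) _ _ = contradiction (sym x≡0) 0≢x
      go (no _) (no _) (no _) _ = s≤s z≤n
      go (no _) (no _) (yes _) (yes _) = s≤s z≤n
      go (no _) (no _) (yes _) (no Tr≢0) = contradiction (Tr-x z) Tr≢0
    partition : Q ℕ.* Q ℕ.≤ q ℕ.+ degree-bound ℕ.+ q ℕ.* zeros
    partition = begin
      Q ℕ.* Q  ≡⟨ trans (sym size≡QQ) (sym (trans (∑-const K↔ 1) (ℕ.*-identityʳ _))) ⟩
      ∑ K↔ (λ _ → 1)  ≤⟨ ∑-mono K↔ cover ⟩
      ∑ K↔ (λ z → 𝟙 (0# ≟ x z) ℕ.+ 𝟙 (good? z) ℕ.+ ζ (x z))
        ≡⟨ trans (∑-+ K↔ (λ z → 𝟙 (0# ≟ x z) ℕ.+ 𝟙 (good? z)) (ζ ∘ x))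
        (cong (ℕ._+ ∑ K↔ (ζ ∘ x)) (∑-+ K↔ (λ z → 𝟙 (0# ≟ x z)) (𝟙 ∘ good?))) ⟩
      ∑ K↔ (λ z → 𝟙 (0# ≟ x z)) ℕ.+ ∑ K↔ (𝟙 ∘ good?) ℕ.+ ∑ K↔ (ζ ∘ x)
        ≤⟨ ℕ.+-mono-≤ (ℕ.+-mono-≤ (fibre≤q 0#) few-good) pull-back ⟩
      q ℕ.+ degree-bound ℕ.+ q ℕ.* zeros  ∎

-- The second moment and the numerical inequalities

module Arithmetic where
  open import Data.Nat.Base using (_+_; _*_)

  2xy≤x²+y² : ∀ x y → 2 * (x * y) ℕ.≤ x * x + y * y
  2xy≤x²+y² x y with ℕ.≤-total x y
  ... | inj₁ x≤y = subst (λ y → 2 * (x * y) ℕ.≤ x * x + y * y) (ℕ.m+[n∸m]≡n x≤y)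
    (ℕ.≤-trans (ℕ.m≤m+n _ ((y ∸ x) * (y ∸ x))) (ℕ.≤-reflexive (expand x (y ∸ x))))
    where
    expand : ∀ x e → 2 * (x * (x + e)) + e * e ≡ x * x + (x + e) * (x + e)
    expand = solve-∀
  ... | inj₂ y≤x = subst (λ x → 2 * (x * y) ℕ.≤ x * x + y * y) (ℕ.m+[n∸m]≡n y≤x)
    (ℕ.≤-trans (ℕ.m≤m+n _ ((x ∸ y) * (x ∸ y))) (ℕ.≤-reflexive (expand y (x ∸ y))))
    where
    expand : ∀ y e → 2 * ((y + e) * y) + e * e ≡ (y + e) * (y + e) + y * y
    expand = solve-∀

  2*triangle : ∀ m → 2 * triangle m ≡ m * suc m
  2*triangle zero = refl
  2*triangle (suc m) = trans (expand m (triangle m)) (trans (cong (2 * suc m +_) (2*triangle m)) (factor m))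
    where
    expand : ∀ m t → 2 * (suc m + t) ≡ 2 * suc m + 2 * t
    expand = solve-∀
    factor : ∀ m → 2 * suc m + m * suc m ≡ suc m * suc (suc m)
    factor = solve-∀

  -- N₂ stands for the number N(0,0) over the quadratic extension, ρ and ρ′ for a row and a column sum.
  record Estimates (q q₁ d S₁ S₂ ρ ρ′ N₂ : ℕ) : Set where
    field
      total : S₁ + 1 ≡ q * d
      row : d ℕ.≤ ρ + 1
      column : d ℕ.≤ ρ′ + 1
      lift : S₂ + N₂ + 4 * d ℕ.≤ 2 * (d * d + q * d)

  -- A record rather than a synonym: comparing unfolded products of numerals and variables is infeasible.
  record Moment (q S₁ S₂ ρ ρ′ N₀ A B C W₂ : ℕ) : Set where
    constructor moment
    field
      inequality :
        2 * A * S₁ + 2 * B * (ρ + ρ′) + (A * A + 4 * A * B + 2 * B * B)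
        ℕ.≤ S₂ + q * (q * (A * A)) + 2 * q * (2 * A * B + B * B) + W₂ * W₂ + 2 * C * N₀

  -- Σ (N - W)² ≥ 0 for the function W equal to A off the row a₀ and the column b₀, to A + B on
  -- exactly one of them and to W₂ = A + 2 B - C at (a₀ , b₀), arranged so that no subtraction occurs.
  second-moment : ∀ {F : Set} {q} (F↔ : HasSize F q) (N : F → F → ℕ) (a₀ b₀ : F) {A B C W₂ : ℕ} → W₂ + C ≡ A + 2 * B →
    Moment q (∑ F↔ (λ a → ∑ F↔ (N a))) (∑ F↔ (λ a → ∑ F↔ (λ b → N a b * N a b))) (∑ F↔ (N a₀)) (∑ F↔ (λ a → N a b₀))
      (N a₀ b₀) A B C W₂
  second-moment {F} {q} F↔ N a₀ b₀ {A} {B} {C} {W₂} W₂+C = moment (begin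
    2 * A * ∑F (λ a → ∑F (N a)) + 2 * B * (∑F (N a₀) + ∑F (λ a → N a b₀)) + E
      ≡⟨ regroup₁ (2 * A) (2 * B) _ _ _ E ⟩
    (2 * A * ∑F (λ a → ∑F (N a)) + 2 * B * ∑F (λ a → N a b₀)) + (2 * B * ∑F (N a₀) + E)
      ≡⟨ sym left ⟩
    ∑F (λ a → ∑F (λ b → L a b))
      ≤⟨ ∑-mono F↔ (λ a → ∑-mono F↔ (λ b → pointwise (N a b) (a ≟ a₀) (b ≟ b₀))) ⟩
    ∑F (λ a → ∑F (λ b → R a b))
      ≡⟨ right ⟩
    (S₂ + q * (q * (A * A) + K)) + (q * K + (W₂ * W₂ + 2 * C * N a₀ b₀))
      ≡⟨ regroup₂ S₂ q (q * (A * A)) K (W₂ * W₂) _ ⟩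
    S₂ + q * (q * (A * A)) + 2 * q * K + W₂ * W₂ + 2 * C * N a₀ b₀ ∎)
    where
    open ℕ.≤-Reasoning
    _≟_ = decEq F↔
    ∑F = ∑ F↔
    E K S₂ : ℕ
    E = A * A + 4 * A * B + 2 * B * B
    K = 2 * A * B + B * B
    S₂ = ∑F (λ a → ∑F (λ b → N a b * N a b))
    regroup₁ : ∀ u v s r c e → u * s + v * (r + c) + e ≡ (u * s + v * c) + (v * r + e)
    regroup₁ = solve-∀
    regroup₂ : ∀ s q x k w n → (s + q * (x + k)) + (q * k + (w + n)) ≡ s + q * x + 2 * q * k + w + n
    regroup₂ = solve-∀
    L R : F → F → ℕ
    L a b = (2 * A * N a b + 𝟙 (a ≟ a₀) * (2 * B * N a b)) + 𝟙 (b ≟ b₀) * (2 * B * N a b + 𝟙 (a ≟ a₀) * E)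
    R a b = (N a b * N a b + (A * A + 𝟙 (a ≟ a₀) * K)) + 𝟙 (b ≟ b₀) * (K + 𝟙 (a ≟ a₀) * (W₂ * W₂ + 2 * C * N a b))
    pointwise : ∀ n {P Q : Set} (p : Dec P) (q : Dec Q) →
      (2 * A * n + 𝟙 p * (2 * B * n)) + 𝟙 q * (2 * B * n + 𝟙 p * E)
      ℕ.≤ (n * n + (A * A + 𝟙 p * K)) + 𝟙 q * (K + 𝟙 p * (W₂ * W₂ + 2 * C * n))
    pointwise n (no _) (no _) = begin
      2 * A * n + 0 + 0  ≡⟨ e₁ A n ⟩
      2 * (n * A)  ≤⟨ 2xy≤x²+y² n A ⟩
      n * n + A * A  ≡⟨ e₂ (n * n) (A * A) ⟩
      n * n + (A * A + 0) + 0  ∎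
      where
      e₁ : ∀ A n → 2 * A * n + 0 + 0 ≡ 2 * (n * A)
      e₁ = solve-∀
      e₂ : ∀ x y → x + y ≡ x + (y + 0) + 0
      e₂ = solve-∀
    pointwise n (yes _) (no _) = begin
      2 * A * n + 1 * (2 * B * n) + 0  ≡⟨ e₁ A B n ⟩
      2 * (n * (A + B))  ≤⟨ 2xy≤x²+y² n (A + B) ⟩
      n * n + (A + B) * (A + B)  ≡⟨ e₂ A B n ⟩
      n * n + (A * A + 1 * K) + 0  ∎
      where
      e₁ : ∀ A B n → 2 * A * n + 1 * (2 * B * n) + 0 ≡ 2 * (n * (A + B))
      e₁ = solve-∀
      e₂ : ∀ A B n → n * n + (A + B) * (A + B) ≡ n * n + (A * A + 1 * (2 * A * B + B * B)) + 0
      e₂ = solve-∀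
    pointwise n (no _) (yes _) = begin
      2 * A * n + 0 + 1 * (2 * B * n + 0)  ≡⟨ e₁ A B n ⟩
      2 * (n * (A + B))  ≤⟨ 2xy≤x²+y² n (A + B) ⟩
      n * n + (A + B) * (A + B)  ≡⟨ e₂ A B n ⟩
      n * n + (A * A + 0) + 1 * (K + 0)  ∎
      where
      e₁ : ∀ A B n → 2 * A * n + 0 + 1 * (2 * B * n + 0) ≡ 2 * (n * (A + B))
      e₁ = solve-∀
      e₂ : ∀ A B n → n * n + (A + B) * (A + B) ≡ n * n + (A * A + 0) + 1 * (2 * A * B + B * B + 0)
      e₂ = solve-∀
    pointwise n (yes _) (yes _) = begin
      2 * A * n + 1 * (2 * B * n) + 1 * (2 * B * n + 1 * E)  ≡⟨ e₁ A B n E ⟩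
      2 * n * (A + 2 * B) + E  ≡⟨ cong (λ y → 2 * n * y + E) (sym W₂+C) ⟩
      2 * n * (W₂ + C) + E  ≡⟨ e₂ n W₂ C E ⟩
      2 * (n * W₂) + (2 * C * n + E)  ≤⟨ ℕ.+-monoˡ-≤ _ (2xy≤x²+y² n W₂) ⟩
      n * n + W₂ * W₂ + (2 * C * n + E)  ≡⟨ e₃ A B (n * n) (W₂ * W₂) (2 * C * n) ⟩
      n * n + (A * A + 1 * K) + 1 * (K + 1 * (W₂ * W₂ + 2 * C * n)) ∎
      where
      e₁ : ∀ A B n E → 2 * A * n + 1 * (2 * B * n) + 1 * (2 * B * n + 1 * E) ≡ 2 * n * (A + 2 * B) + E
      e₁ = solve-∀
      e₂ : ∀ n w c E → 2 * n * (w + c) + E ≡ 2 * (n * w) + (2 * c * n + E)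
      e₂ = solve-∀
      e₃ : ∀ A B x w y → x + w + (y + (A * A + 4 * A * B + 2 * B * B))
         ≡ x + (A * A + 1 * (2 * A * B + B * B)) + 1 * ((2 * A * B + B * B) + 1 * (w + y))
      e₃ = solve-∀
    ∑-+δ : ∀ x₀ (f g : F → ℕ) → ∑F (λ x → f x + 𝟙 (x ≟ x₀) * g x) ≡ ∑F f + g x₀
    ∑-+δ x₀ f g = trans (∑-+ F↔ f (λ x → 𝟙 (x ≟ x₀) * g x)) (cong (∑F f +_) (∑-δ F↔ x₀ (_≟ x₀) g))
    left : ∑F (λ a → ∑F (λ b → L a b)) ≡ (2 * A * ∑F (λ a → ∑F (N a)) + 2 * B * ∑F (λ a → N a b₀)) + (2 * B * ∑F (N a₀) + E)
    left = begin-equality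
      ∑F (λ a → ∑F (λ b → L a b))
        ≡⟨ ∑-cong F↔ (λ a → trans (∑-+δ b₀ (λ b → 2 * A * N a b + 𝟙 (a ≟ a₀) * (2 * B * N a b))
          (λ b → 2 * B * N a b + 𝟙 (a ≟ a₀) * E)) (cong (_+ (2 * B * N a b₀ + 𝟙 (a ≟ a₀) * E)) (row a))) ⟩
      ∑F (λ a → (2 * A * ∑F (N a) + 𝟙 (a ≟ a₀) * (2 * B * ∑F (N a))) + (2 * B * N a b₀ + 𝟙 (a ≟ a₀) * E))
        ≡⟨ ∑-cong F↔ (λ a → collect (2 * A * ∑F (N a)) (𝟙 (a ≟ a₀)) (2 * B * ∑F (N a)) (2 * B * N a b₀) E) ⟩
      ∑F (λ a → (2 * A * ∑F (N a) + 2 * B * N a b₀) + 𝟙 (a ≟ a₀) * (2 * B * ∑F (N a) + E))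
        ≡⟨ ∑-+δ a₀ (λ a → 2 * A * ∑F (N a) + 2 * B * N a b₀) (λ a → 2 * B * ∑F (N a) + E) ⟩
      ∑F (λ a → 2 * A * ∑F (N a) + 2 * B * N a b₀) + (2 * B * ∑F (N a₀) + E)
        ≡⟨ cong (_+ (2 * B * ∑F (N a₀) + E)) (trans (∑-+ F↔ (λ a → 2 * A * ∑F (N a)) (λ a → 2 * B * N a b₀))
          (sym (cong₂ ℕ._+_ (∑-*ˡ F↔ (2 * A) (λ a → ∑F (N a))) (∑-*ˡ F↔ (2 * B) (λ a → N a b₀))))) ⟩
      (2 * A * ∑F (λ a → ∑F (N a)) + 2 * B * ∑F (λ a → N a b₀)) + (2 * B * ∑F (N a₀) + E) ∎
      where
      collect : ∀ x δ y z e → (x + δ * y) + (z + δ * e) ≡ (x + z) + δ * (y + e)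
      collect = solve-∀
      row : ∀ a → ∑F (λ b → 2 * A * N a b + 𝟙 (a ≟ a₀) * (2 * B * N a b)) ≡ 2 * A * ∑F (N a) + 𝟙 (a ≟ a₀)
        * (2 * B * ∑F (N a))
      row a = trans (∑-+ F↔ (λ b → 2 * A * N a b) (λ b → 𝟙 (a ≟ a₀) * (2 * B * N a b)))
        (sym (cong₂ ℕ._+_ (∑-*ˡ F↔ (2 * A) (N a)) (trans (cong (𝟙 (a ≟ a₀) *_) (∑-*ˡ F↔ (2 * B) (N a)))
          (∑-*ˡ F↔ (𝟙 (a ≟ a₀)) (λ b → 2 * B * N a b)))))
    right : ∑F (λ a → ∑F (λ b → R a b)) ≡ (S₂ + q * (q * (A * A) + K)) + (q * K + (W₂ * W₂ + 2 * C * N a₀ b₀))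
    right = begin-equality
      ∑F (λ a → ∑F (λ b → R a b))
        ≡⟨ ∑-cong F↔ (λ a → trans (∑-+δ b₀ (λ b → N a b * N a b + (A * A + 𝟙 (a ≟ a₀) * K))
          (λ b → K + 𝟙 (a ≟ a₀) * (W₂ * W₂ + 2 * C * N a b)))
             (trans (cong (_+ (K + 𝟙 (a ≟ a₀) * (W₂ * W₂ + 2 * C * N a b₀))) (row a))
               (collect (S a) q (A * A) (𝟙 (a ≟ a₀)) K (W₂ * W₂ + 2 * C * N a b₀)))) ⟩
      ∑F (λ a → (S a + (q * (A * A) + K)) + 𝟙 (a ≟ a₀) * (q * K + (W₂ * W₂ + 2 * C * N a b₀)))
        ≡⟨ ∑-+δ a₀ (λ a → S a + (q * (A * A) + K)) (λ a → q * K + (W₂ * W₂ + 2 * C * N a b₀)) ⟩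
      ∑F (λ a → S a + (q * (A * A) + K)) + (q * K + (W₂ * W₂ + 2 * C * N a₀ b₀))
        ≡⟨ cong (_+ (q * K + (W₂ * W₂ + 2 * C * N a₀ b₀))) (trans (∑-+ F↔ S (λ _ → q * (A * A) + K))
          (cong (S₂ +_) (∑-const F↔ (q * (A * A) + K)))) ⟩
      (S₂ + q * (q * (A * A) + K)) + (q * K + (W₂ * W₂ + 2 * C * N a₀ b₀)) ∎
      where
      S : F → ℕ
      S a = ∑F (λ b → N a b * N a b)
      row : ∀ a → ∑F (λ b → N a b * N a b + (A * A + 𝟙 (a ≟ a₀) * K)) ≡ S a + q * (A * A + 𝟙 (a ≟ a₀) * K)
      row a = trans (∑-+ F↔ (λ b → N a b * N a b) (λ _ → A * A + 𝟙 (a ≟ a₀) * K))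
        (cong (S a +_) (∑-const F↔ (A * A + 𝟙 (a ≟ a₀) * K)))
      collect : ∀ s q x δ k y → (s + q * (x + δ * k)) + (k + δ * y) ≡ (s + (q * x + k)) + δ * (q * k + y)
      collect = solve-∀

  -- `many-zeros` with Q written as q d: N₂ falls short of d² by an error of order q² d at most.
  Stepanov-bound : (q q₁ d N₂ : ℕ) → Set
  Stepanov-bound q q₁ d N₂ = q * d * d + q * d ℕ.≤ q * N₂ + (q * d * (triangle q₁ + q₁) + d + q₁)

  lift-lower : (q d A B N : ℕ) → ℕ
  lift-lower q d A B N =
    2 * A * (q * d) + 4 * B * d + (A * A + 4 * A * B + 2 * B * B) + N + 4 * d

  lift-upper : (q d A B C W₂ k : ℕ) → ℕ
  lift-upper q d A B C W₂ k =
    2 * (d * d + q * d) + (q * (q * (A * A)) + 2 * q * (2 * A * B + B * B) + W₂ * W₂ + 2 * C * k + 2 * A + 4 * B)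

  lift-lower-mono : ∀ q d A B {N N′} → N ℕ.≤ N′ → lift-lower q d A B N ℕ.≤ lift-lower q d A B N′
  lift-lower-mono q d A B N≤N′ = ℕ.+-monoˡ-≤ (4 * d) (ℕ.+-monoʳ-≤
    (2 * A * (q * d) + 4 * B * d + (A * A + 4 * A * B + 2 * B * B)) N≤N′)

  gap-lower : (q d A B : ℕ) → ℕ
  gap-lower q d A B =
    q * (2 * A * (q * d) + 4 * B * d + (A * A + 4 * A * B + 2 * B * B) + 4 * d)
      + (q * d * d + q * d)

  gap-upper : (q q₁ d A B C W₂ k : ℕ) → ℕ
  gap-upper q q₁ d A B C W₂ k = q * lift-upper q d A B C W₂ k + (q * d * (triangle q₁ + q₁) + d + q₁)

  gap-upper-mono : ∀ q q₁ d A B C W₂ {k k′} → k ℕ.≤ k′ → gap-upper q q₁ d A B C W₂ k ℕ.≤ gap-upper q q₁ d A B C W₂ k′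
  gap-upper-mono q q₁ d A B C W₂ k≤k′ = ℕ.+-monoˡ-≤ (q * d * (triangle q₁ + q₁) + d + q₁) (ℕ.*-monoʳ-≤ q
    (ℕ.+-monoʳ-≤ (2 * (d * d + q * d)) (ℕ.+-monoˡ-≤ (4 * B) (ℕ.+-monoˡ-≤ (2 * A)
      (ℕ.+-monoʳ-≤ (q * (q * (A * A)) + 2 * q * (2 * A * B + B * B) + W₂ * W₂) (ℕ.*-monoʳ-≤ (2 * C) k≤k′))))))

  -- What is left after eliminating S₁, S₂, ρ, ρ′ and N₂: a condition on numbers alone, in which k
  -- stands for N(a₀ , b₀).
  record Gap (q q₁ d A B C W₂ k : ℕ) : Set where
    constructor mkGap
    field
      lower≤upper : gap-lower q d A B ℕ.≤ gap-upper q q₁ d A B C W₂ k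

  module _ {q q₁ d S₁ S₂ ρ ρ′ N₂ : ℕ} (est : Estimates q q₁ d S₁ S₂ ρ ρ′ N₂) where
    open Estimates est

    -- S₂ is bounded below by the moment inequality and above by `lift`, so it cancels from the sum
    -- of the two. The terms 2 A + 4 B pay for the units by which the total, the row and the column
    -- may fall short.
    moment+lift : ∀ {N₀ A B C W₂} → Moment q S₁ S₂ ρ ρ′ N₀ A B C W₂ → lift-lower q d A B N₂ ℕ.≤ lift-upper q d A B C W₂ N₀
    moment+lift {N₀} {A} {B} {C} {W₂} (moment inequality) = ℕ.+-cancelˡ-≤ S₂ _ _ (begin
      S₂ + (2 * A * (q * d) + 4 * B * d + E + N₂ + 4 * d)
        ≡⟨ e₁ S₂ A (q * d) B d E N₂ ⟩
      2 * A * (q * d) + 2 * B * (d + d) + E + (S₂ + N₂ + 4 * d)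
        ≤⟨ ℕ.+-mono-≤ (ℕ.+-monoˡ-≤ E (ℕ.+-mono-≤ (ℕ.≤-reflexive (cong (2 * A *_) (sym total)))
          (ℕ.*-monoʳ-≤ (2 * B) (ℕ.+-mono-≤ row column)))) lift ⟩
      2 * A * (S₁ + 1) + 2 * B * (ρ + 1 + (ρ′ + 1)) + E + Z
        ≡⟨ e₂ A S₁ B ρ ρ′ E Z ⟩
      2 * A * S₁ + 2 * B * (ρ + ρ′) + E + (2 * A + 4 * B + Z)
        ≤⟨ ℕ.+-monoˡ-≤ (2 * A + 4 * B + Z) inequality ⟩
      S₂ + x + y + W₂ * W₂ + 2 * C * N₀ + (2 * A + 4 * B + Z)
        ≡⟨ e₃ S₂ x y (W₂ * W₂) (2 * C * N₀) (2 * A) (4 * B) Z ⟩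
      S₂ + (Z + (x + y + W₂ * W₂ + 2 * C * N₀ + 2 * A + 4 * B)) ∎)
      where
      open ℕ.≤-Reasoning
      E x y Z : ℕ
      E = A * A + 4 * A * B + 2 * B * B
      x = q * (q * (A * A))
      y = 2 * q * (2 * A * B + B * B)
      Z = 2 * (d * d + q * d)
      e₁ : ∀ S A u B d E N → S + (2 * A * u + 4 * B * d + E + N + 4 * d) ≡ 2 * A * u + 2 * B * (d + d) + E + (S + N + 4 * d)
      e₁ = solve-∀
      e₂ : ∀ A S B r r′ E Z → 2 * A * (S + 1) + 2 * B * (r + 1 + (r′ + 1)) + E + Z ≡ 2 * A * S + 2 * B * (r + r′) + E
        + (2 * A + 4 * B + Z)
      e₂ = solve-∀
      e₃ : ∀ S x y w c a b Z → S + x + y + w + c + (a + b + Z) ≡ S + (Z + (x + y + w + c + a + b))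
      e₃ = solve-∀

    gap : ∀ {N₀ A B C W₂} → Moment q S₁ S₂ ρ ρ′ N₀ A B C W₂ → Stepanov-bound q q₁ d N₂ →
          Gap q q₁ d A B C W₂ N₀
    gap {N₀} {A} {B} {C} {W₂} mom stepanov = mkGap (ℕ.+-cancelʳ-≤ (q * N₂) _ _ (begin
      gap-lower q d A B + q * N₂
        ≡⟨ e₁ q M d N₂ (q * d * d + q * d) ⟩
      q * (M + N₂ + 4 * d) + (q * d * d + q * d)
        ≤⟨ ℕ.+-mono-≤ (ℕ.*-monoʳ-≤ q (moment+lift {N₀} {A} {B} {C} {W₂} mom)) stepanov ⟩
      q * Y + (q * N₂ + Z)
        ≡⟨ e₂ (q * Y) (q * N₂) Z ⟩
      gap-upper q q₁ d A B C W₂ N₀ + q * N₂ ∎))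
      where
      open ℕ.≤-Reasoning
      M Y Z : ℕ
      M = 2 * A * (q * d) + 4 * B * d + (A * A + 4 * A * B + 2 * B * B)
      Y = 2 * (d * d + q * d) + (q * (q * (A * A)) + 2 * q * (2 * A * B + B * B) + W₂ * W₂ + 2 * C * N₀ + 2 * A + 4 * B)
      Z = q * d * (triangle q₁ + q₁) + d + q₁
      e₁ : ∀ q M d N Y → q * (M + 4 * d) + Y + q * N ≡ q * (M + N + 4 * d) + Y
      e₁ = solve-∀
      e₂ : ∀ x y z → x + (y + z) ≡ x + z + y
      e₂ = solve-∀

  -- For q = 2 + u and r = q^(n-4) the test function is centred at q² r and N(a₀ , b₀) = 0 is impossible.
  A[_,_] B[_,_] C[_,_] W₂[_,_] : ℕ → ℕ → ℕ
  A[ u , r ] = r * (suc u * (3 + u))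
  B[ u , r ] = r * (2 + u)
  C[ u , r ] = r * ((2 + u) * (2 + u))
  W₂[ u , r ] = r * (3 + 2 * u)

  -- The test function is q² r - r v(a) v(b), with v equal to q - 1 at the distinguished index and
  -- -1 elsewhere. Its values are (q² - 1) r, (q² + q - 1) r and, at the dip, (2 q - 1) r; every row
  -- and column sums to q³ r = d.
  weights : ∀ u r → W₂[ u , r ] + C[ u , r ] ≡ A[ u , r ] + 2 * B[ u , r ]
  weights = identity
    where
    identity : ∀ u r → r * (3 + 2 * u) + r * ((2 + u) * (2 + u)) ≡ r * (suc u * (3 + u)) + 2 * (r * (2 + u))
    identity = solve-∀

  NoGap : (u d r : ℕ) → Set
  NoGap u d r = ¬ Gap (2 + u) (suc u) d A[ u , r ] B[ u , r ] C[ u , r ] W₂[ u , r ] 0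

  -- The two sides evaluate to 610 and 607.
  no-gap-2-4 : ∀ {u d} → u ≡ 0 → d ≡ 8 → NoGap u d 1
  no-gap-2-4 refl refl (mkGap lower≤upper) = from-no (gap-lower 2 8 3 2 ℕ.≤? gap-upper 2 1 8 3 2 4 3 0) lower≤upper

  -- Twice the difference of the two sides is r² M - r N - 2 (q - 1); doubling removes the half in
  -- `triangle`. Since q M = N + S with S ≥ 120, the hypothesis r ≥ q makes this positive. For r = 1
  -- it equals 6 when q = 2 but is negative when q = 3, where M = 756 and N = 1194.
  no-gap-5 : ∀ {q u d r} → q ≡ 2 + u → q ℕ.≤ r → d ≡ q * (q * (q * r)) → NoGap u d r
  no-gap-5 {u = u} {r = r} refl q≤r refl (mkGap lower≤upper) = ℕ.<⇒≱ small (ℕ.+-cancelˡ-≤ (2 * upper + x) _ _ (begin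
    2 * upper + x + r * (r * M)  ≡⟨ cong (λ y → 2 * upper + q * d * y + r * (r * M)) (2*triangle (suc u)) ⟩
    2 * upper + q * d * (suc u * q) + r * (r * M)  ≡⟨ sym (balance u r (triangle (suc u))) ⟩
    2 * gap-lower q d A[ u , r ] B[ u , r ] + x + (r * N + (2 + 2 * u))
      ≤⟨ ℕ.+-monoˡ-≤ (r * N + (2 + 2 * u)) (ℕ.+-monoˡ-≤ x (ℕ.*-monoʳ-≤ 2 lower≤upper)) ⟩
    2 * upper + x + (r * N + (2 + 2 * u))  ∎))
    where
    open ℕ.≤-Reasoning
    q d x upper M N S : ℕ
    q = 2 + u
    d = q * (q * (q * r))
    x = q * d * (2 * triangle (suc u))
    upper = gap-upper q (suc u) d A[ u , r ] B[ u , r ] C[ u , r ] W₂[ u , r ] 0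
    M = 112 + u * (264 + u * (244 + u * (110 + u * (24 + u * 2))))
    N = 104 + u * (308 + u * (396 + u * (270 + u * (98 + u * (17 + u * 1)))))
    S = 120 + u * (332 + u * (356 + u * (194 + u * (60 + u * (11 + u * 1)))))
    balance : ∀ u r t →
      let q = 2 + u ; q₁ = suc u ; d = q * (q * (q * r))
          A = r * (suc u * (3 + u)) ; B = r * (2 + u) ; C = r * ((2 + u) * (2 + u)) ; W₂ = r * (3 + 2 * u) in
      2 * (q * (2 * A * (q * d) + 4 * B * d + (A * A + 4 * A * B + 2 * B * B) + 4 * d) + (q * d * d + q * d))
        + q * d * (2 * t)
        + (r * (104 + u * (308 + u * (396 + u * (270 + u * (98 + u * (17 + u * 1)))))) + (2 + 2 * u))
      ≡ 2 * (q * (2 * (d * d + q * d) + (q * (q * (A * A)) + 2 * q * (2 * A * B + B * B) + W₂ * W₂ + 2 * C * 0 + 2 * A + 4 *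
        B)) + (q * d * (t + q₁) + d + q₁))
        + q * d * (q₁ * q)
        + r * (r * (112 + u * (264 + u * (244 + u * (110 + u * (24 + u * 2))))))
    balance = solve-∀
    split : ∀ u → (2 + u) * (112 + u * (264 + u * (244 + u * (110 + u * (24 + u * 2)))))
      ≡ 104 + u * (308 + u * (396 + u * (270 + u * (98 + u * (17 + u * 1)))))
        + (120 + u * (332 + u * (356 + u * (194 + u * (60 + u * (11 + u * 1))))))
    split = solve-∀
    slack : ∀ u → suc (2 + 2 * u) + (237 + 118 * u) ≡ (2 + u) * 120
    slack = solve-∀
    small : r * N + (2 + 2 * u) ℕ.< r * (r * M)
    small = begin-strict
      r * N + (2 + 2 * u)  <⟨ ℕ.+-monoʳ-< (r * N) (ℕ.≤-trans (ℕ.m+n≤o⇒m≤o (suc (2 + 2 * u)) (ℕ.≤-reflexive (slack u)))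
        (ℕ.*-monoˡ-≤ 120 q≤r)) ⟩
      r * N + r * 120  ≤⟨ ℕ.+-monoʳ-≤ (r * N) (ℕ.*-monoʳ-≤ r
        (ℕ.m≤m+n 120 (u * (332 + u * (356 + u * (194 + u * (60 + u * (11 + u * 1)))))))) ⟩
      r * N + r * S  ≡⟨ sym (ℕ.*-distribˡ-+ r N S) ⟩
      r * (N + S)  ≡⟨ cong (r *_) (sym (split u)) ⟩
      r * ((2 + u) * M)  ≤⟨ ℕ.*-monoʳ-≤ r (ℕ.*-monoˡ-≤ M q≤r) ⟩
      r * (r * M)  ∎

  -- For q = 3 and n = 4 one quadratic extension is not enough: the bound for the field with 3⁸
  -- elements is obtained from the one with 3¹⁶ elements.
  642≤N : ∀ {q q₁ d N₀} → q ≡ 3 → q₁ ≡ 2 → d ≡ 2187 → Gap q q₁ d 708 63 189 645 N₀ → 642 ℕ.≤ N₀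
  642≤N {N₀ = N₀} refl refl refl (mkGap lower≤upper) = ℕ.≮⇒≥ λ N₀<642 → from-no
    (gap-lower 3 2187 708 63 ℕ.≤? gap-upper 3 2 2187 708 63 189 645 641)
    (ℕ.≤-trans lower≤upper (gap-upper-mono 3 2 2187 708 63 189 645 {N₀} {641} (ℕ.≤-pred N₀<642)))

  -- The test function is 9 - 2 v(a) v(b), with 9 = 3² the mean of N and 2 the integer nearest to
  -- 9/4, for which the dip would reach 0. At N₂ = 642 the sides are 2821 and 2820, so 642 is the
  -- least value that suffices.
  no-gap-3-4 : ∀ {q q₁ d S₁ S₂ ρ ρ′ N₂} → q ≡ 3 → d ≡ 27 → Estimates q q₁ d S₁ S₂ ρ ρ′ N₂ → 642 ℕ.≤ N₂ → ¬ Moment q S₁ S₂ ρ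
    ρ′ 0 7 6 18 1
  no-gap-3-4 {N₂ = N₂} refl refl est 642≤N₂ mom = contradiction
    (ℕ.≤-trans (lift-lower-mono 3 27 7 6 {642} {N₂} 642≤N₂) (moment+lift est {0} {7} {6} {18} {1} mom))
    (from-no (lift-lower 3 27 7 6 642 ℕ.≤? lift-upper 3 27 7 6 18 1 0))

open Arithmetic

-- Assembly of the estimates and the case distinction

private
  no-gap′ : ∀ {q u q₁ r d} → q ≡ 2 ℕ.+ u → q₁ ≡ suc u → NoGap u d r →
    ¬ Gap q q₁ d A[ u , r ] B[ u , r ] C[ u , r ] W₂[ u , r ] 0
  no-gap′ refl refl noGap = noGap

module PrimePower {F : Field} {p k q q₁ : ℕ} (pr : Prime p) (q≡p^ : q ≡ p ^ suc k) (q≡1+q₁ : q ≡ suc q₁) (0<q₁ : 0 ℕ.< q₁)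
  (F↔ : HasSize (Field.Carrier F) q) where

  1<q : 1 ℕ.< q
  1<q = subst (1 ℕ.<_) (sym q≡1+q₁) (s≤s 0<q₁)

  additive-q : ∀ K m → HasSize (Field.Carrier K) (q ^ m) → AdditivePowers.Additive K q
  additive-q K m K↔ = subst (AdditivePowers.Additive K) (sym q≡p^)
    (AdditivePowers.additive-^ K {p} (additive-prime-power pr K (suc k ℕ.* m) (subst (HasSize (Field.Carrier K)) size≡ K↔))
      (suc k))
    where
    size≡ : q ^ m ≡ p ^ (suc k ℕ.* m)
    size≡ = trans (cong (_^ m) q≡p^) (ℕ.^-*-assoc p (suc k) m)

  triangle<d : ∀ {n} → 2 ℕ.≤ n → triangle q₁ ℕ.< q ^ n
  triangle<d {n} 2≤n = begin-strict
    triangle q₁  ≤⟨ ℕ.m≤m+n (triangle q₁) _ ⟩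
    2 ℕ.* triangle q₁  ≡⟨ 2*triangle q₁ ⟩
    q₁ ℕ.* suc q₁  <⟨ ℕ.*-monoˡ-< (suc q₁) (ℕ.n<1+n q₁) ⟩
    suc q₁ ℕ.* suc q₁  ≡⟨ cong₂ ℕ._*_ (sym q≡1+q₁) (trans (sym q≡1+q₁) (sym (ℕ.*-identityʳ q))) ⟩
    q ^ 2  ≤⟨ ℕ.^-monoʳ-≤ q ⦃ ℕ.>-nonZero (ℕ.<⇒≤ 1<q) ⦄ 2≤n ⟩
    q ^ n  ∎
    where open ℕ.≤-Reasoning

  -- One passage from a field to its quadratic extension with all resulting estimates, parametrised
  -- so that it can be repeated with E as the lower field.
  module Tower {K : Field} {n′ : ℕ} (K↔ : HasSize (Field.Carrier K) (q ^ suc n′))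
    (add-q : AdditivePowers.Additive K q) (ι : Field.Carrier F → Field.Carrier K) (ι-hom : IsRingHom F K ι) where

    open FiniteField K K↔ using (0#)

    size≡ : q ^ suc n′ ≡ p ^ suc (n′ ℕ.+ k ℕ.* suc n′)
    size≡ = trans (cong (_^ suc n′) q≡p^) (ℕ.^-*-assoc p (suc k) (suc n′))

    L : Quadratic K (q ^ suc n′)
    L = subst (Quadratic K) (sym size≡) (quadratic-extension pr K (n′ ℕ.+ k ℕ.* suc n′)
      (subst (HasSize (Field.Carrier K)) size≡ K↔))

    open Quadratic L using (E; κ; κ-injective; κ-0) public

    add-E : AdditivePowers.Additive E q
    add-E = additive-q E (suc n′ ℕ.+ suc n′) (subst (HasSize (Field.Carrier E)) (sym (ℕ.^-distribˡ-+-* q (suc n′) (suc n′)))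
      (Quadratic.E↔ L))

    open Lift {F} {K} {q} {n′} F↔ K↔ 1<q add-q ι ι-hom L add-E public using (n₂; E-size; κι-hom; module CE; ∑N²+N-E)
    open Counting {F} {K} {q} {n′} F↔ K↔ 1<q add-q ι ι-hom public

    module _ {α : Field.Carrier K} (α≢0 : α ≢ 0#) (a b : Field.Carrier F) where

      κα≢0 : κ α ≢ Field.0# E
      κα≢0 κα≡0 = α≢0 (κ-injective (trans κα≡0 (sym κ-0)))

      N₂ : ℕ
      N₂ = CE.N (κ α) (Field.0# F) (Field.0# F)

      estimates : Estimates q q₁ d (∑F (λ a → ∑F (N α a))) (∑F (λ a → ∑F (λ b → N α a b ℕ.* N α a b))) (∑F (N α a))
        (∑F (λ a → N α a b)) N₂
      estimates = record
        { total = N-total α ; row = N-row α a ; column = N-column α α≢0 b ; lift = ∑N²+N-E α≢0 }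

      N-moment : ∀ {A B C W₂} → W₂ ℕ.+ C ≡ A ℕ.+ 2 ℕ.* B →
        Moment q (∑F (λ a → ∑F (N α a))) (∑F (λ a → ∑F (λ b → N α a b ℕ.* N α a b))) (∑F (N α a)) (∑F (λ a → N α a b))
          (N α a b) A B C W₂
      N-moment {A} {B} {C} {W₂} = second-moment F↔ (N α) a b {A} {B} {C} {W₂}

      stepanov : 2 ℕ.≤ n′ → Stepanov-bound q q₁ d N₂
      stepanov 2≤n′ = subst (λ z → q ℕ.* d ℕ.* d ℕ.+ q ℕ.* d ℕ.≤
        q ℕ.* z ℕ.+ (q ℕ.* d ℕ.* (triangle q₁ ℕ.+ q₁) ℕ.+ d ℕ.+ q₁)) zeros≡N₂ S.many-zeros
        where
        module S = Stepanov E {q} {q₁} {n′} q≡1+q₁ 0<q₁ E-size add-E (triangle<d 2≤n′) {κ α} κα≢0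
        module E = FiniteField E E-size
        zeros≡N₂ : S.zeros ≡ N₂
        zeros≡N₂ = ∑-cong E-size λ y → cong (CE.χ y ℕ.*_) (cong₂ ℕ._*_ (CE.T≟0 (κ α) y) (CE.T≟0 (κ α) (κ α E.* y E.⁻¹)))

  module Existence {K : Field} {n′ : ℕ} (K↔ : HasSize (Field.Carrier K) (q ^ suc n′))
    (ι : Field.Carrier F → Field.Carrier K) (ι-hom : IsRingHom F K ι)
    {α : Field.Carrier K} (α≢0 : α ≢ Field.0# K) (a b : Field.Carrier F) where

    add-K : AdditivePowers.Additive K q
    add-K = additive-q K (suc n′) K↔

    open Tower {K} {n′} K↔ add-K ι ι-hom

    S₁ S₂ ρ ρ′ : ℕ
    S₁ = ∑F (λ a → ∑F (N α a))
    S₂ = ∑F (λ a → ∑F (λ b → N α a b ℕ.* N α a b))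
    ρ = ∑F (N α a)
    ρ′ = ∑F (λ a → N α a b)

    moment₀ : N α a b ≡ 0 → ∀ {A B C W₂} → W₂ ℕ.+ C ≡ A ℕ.+ 2 ℕ.* B → Moment q S₁ S₂ ρ ρ′ 0 A B C W₂
    moment₀ N≡0 {A} {B} {C} {W₂} W₂+C =
      subst (λ N₀ → Moment q S₁ S₂ ρ ρ′ N₀ A B C W₂) N≡0 (N-moment α≢0 a b {A} {B} {C} {W₂} W₂+C)

    found : N α a b ≢ 0 → ∃₂ λ x y → Tr K q (suc n′) x ≡ ι a × Tr K q (suc n′) y ≡ ι b × α ≡ Field._*_ K x y
    found N≢0 = N-solution α (ℕ.n≢0⇒n>0 N≢0)

    generic : ∀ u r → q ≡ 2 ℕ.+ u → q₁ ≡ suc u → 2 ℕ.≤ n′ → NoGap u (q ^ n′) r → N α a b ≢ 0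
    generic u r q≡2+u q₁≡1+u 2≤n′ noGap N≡0 = no-gap′ {q} {u} {q₁} {r} {q ^ n′} q≡2+u q₁≡1+u noGap
      (gap (estimates α≢0 a b) {0} {A[ u , r ]} {B[ u , r ]} {C[ u , r ]} {W₂[ u , r ]}
        (moment₀ N≡0 {A[ u , r ]} {B[ u , r ]} {C[ u , r ]} {W₂[ u , r ]} (weights u r)) (stepanov α≢0 a b 2≤n′))

    module Ternary (q≡3 : q ≡ 3) (q₁≡2 : q₁ ≡ 2) (n′≡3 : n′ ≡ 3) where
      -- Here E, with 3⁸ elements, takes the place of K. Its d is 3⁷, and Stepanov's error is much
      -- smaller relative to d² than for d = 3³.
      module L₂ = Tower {E} {n₂} E-size add-E (κ ∘ ι) κι-hom

      0F : Field.Carrier F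
      0F = Field.0# F

      n₂≡7 : n₂ ≡ 7
      n₂≡7 = cong (λ m → m ℕ.+ suc m) n′≡3

      -- The test function is 729 - 21 v(a) v(b), where 729 = 3⁶ is the mean over E and 21 is close
      -- to (729 - 642) / 4, so that the dip 645 lies next to the threshold required by
      -- `no-gap-3-4`.
      642≤N₂ : 642 ℕ.≤ N₂ α≢0 a b
      642≤N₂ = 642≤N q≡3 q₁≡2 (cong₂ _^_ q≡3 n₂≡7)
        (gap (L₂.estimates (κα≢0 α≢0 a b) 0F 0F) {N₂ α≢0 a b} {708} {63} {189} {645}
          (L₂.N-moment (κα≢0 α≢0 a b) 0F 0F {708} {63} {189} {645} refl)
          (L₂.stepanov (κα≢0 α≢0 a b) 0F 0F (ℕ.≤-trans (s≤s (s≤s z≤n)) (ℕ.≤-reflexive (sym n₂≡7)))))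

      ternary : N α a b ≢ 0
      ternary N≡0 = no-gap-3-4 q≡3 (cong₂ _^_ q≡3 n′≡3) (estimates α≢0 a b) 642≤N₂ (moment₀ N≡0 {7} {6} {18} {1} refl)

  existence : ∀ {u} → q₁ ≡ suc u → (n : ℕ) → (5 ≤ n ⊎ (n ≡ 4 × (q ≡ 2 ⊎ q ≡ 3))) →
    (K : Field) → HasSize (Field.Carrier K) (q ^ n) →
    (ι : Field.Carrier F → Field.Carrier K) → IsRingHom F K ι →
    (α : Field.Carrier K) → α ≢ Field.0# K → (a b : Field.Carrier F) →
    ∃₂ λ x y → Tr K q n x ≡ ι a × Tr K q n y ≡ ι b × α ≡ Field._*_ K x y
  existence {u} q₁≡1+u (suc .(4 ℕ.+ m)) (inj₁ (s≤s (s≤s (s≤s (s≤s (s≤s {n = m} z≤n)))))) K K↔ ι ι-hom α α≢0 a b =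
    Existence.found {K} {4 ℕ.+ m} K↔ ι ι-hom α≢0 a b
      (Existence.generic {K} {4 ℕ.+ m} K↔ ι ι-hom α≢0 a b u (q ^ suc m) q≡2+u q₁≡1+u (s≤s (s≤s z≤n))
        (no-gap-5 {q} {u} q≡2+u q≤r refl))
    where
    q≡2+u : q ≡ 2 ℕ.+ u
    q≡2+u = trans q≡1+q₁ (cong suc q₁≡1+u)
    q≤r : q ℕ.≤ q ^ suc m
    q≤r = ℕ.m≤m*n q (q ^ m) ⦃ ℕ.m^n≢0 q m ⦃ ℕ.>-nonZero (ℕ.<⇒≤ 1<q) ⦄ ⦄
  existence {u} q₁≡1+u n (inj₂ (refl , inj₁ q≡2)) K K↔ ι ι-hom α α≢0 a b =
    Existence.found {K} {3} K↔ ι ι-hom α≢0 a b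
      (Existence.generic {K} {3} K↔ ι ι-hom α≢0 a b u 1 q≡2+u q₁≡1+u (s≤s (s≤s z≤n))
        (no-gap-2-4 {u} {q ^ 3} (ℕ.+-cancelˡ-≡ 2 u 0 (trans (sym q≡2+u) q≡2)) (cong (_^ 3) q≡2)))
    where
    q≡2+u : q ≡ 2 ℕ.+ u
    q≡2+u = trans q≡1+q₁ (cong suc q₁≡1+u)
  existence {u} q₁≡1+u n (inj₂ (refl , inj₂ q≡3)) K K↔ ι ι-hom α α≢0 a b =
    Existence.found {K} {3} K↔ ι ι-hom α≢0 a b
      (Existence.Ternary.ternary {K} {3} K↔ ι ι-hom α≢0 a b q≡3 (ℕ.suc-injective (trans (sym q≡1+q₁) q≡3)) refl)

theorem5p1 : (q n : ℕ) → IsPrimePower q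
    → (5 ≤ n ⊎ (n ≡ 4 × (q ≡ 2 ⊎ q ≡ 3)))
    → (F K : Field) → HasSize (Field.Carrier F) q → HasSize (Field.Carrier K) (q ^ n)
    → (ι : Field.Carrier F → Field.Carrier K) → IsRingHom F K ι
    → (α : Field.Carrier K) → ¬ (α ≡ Field.0# K)
    → (a b : Field.Carrier F)
    → ∃₂ λ x y → Tr K q n x ≡ ι a × Tr K q n y ≡ ι b × α ≡ Field._*_ K x y
theorem5p1 q n (p , k , pr , q≡p^) cases F K F↔ K↔ ι ι-hom α α≢0 a b =
  -- Writing q - 1 as `suc (q ∸ 2)` yields its positivity and u = q - 2 by computation.
  PrimePower.existence {F} {p} {k} {q} {suc (q ∸ 2)} pr q≡p^ (sym (ℕ.m+[n∸m]≡n 2≤q)) (s≤s z≤n) F↔ refl n cases K K↔ ι ι-hom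
    α α≢0 a b
  where
  1<p : 1 ℕ.< p
  1<p = ℕ.nonTrivial⇒n>1 p ⦃ prime⇒nonTrivial pr ⦄

  2≤q : 2 ℕ.≤ q
  2≤q = ℕ.≤-trans (ℕ.≤-trans 1<p (ℕ.m≤m*n p (p ^ k) ⦃ ℕ.m^n≢0 p k ⦃ prime⇒nonZero pr ⦄ ⦄)) (ℕ.≤-reflexive (sym q≡p^))
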